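{- ${\rm LZFC}+GC+V=L\vdash \neg(TMA)$. In particular, ${\rm LZFC}+\text{"every set is countable"}+V=L\vdash \neg(TMA)$.
   Context: All theories are in the language $\{\in\}$. BST is the theory with axioms: Empty set, Extensionality, Pair, Union, Cartesian Product, "$\omega$ exists", $\Delta_0$-Separation. $Loc({\rm ZFC})$ is the statement $\forall x\exists y(x\in y\wedge Tr(y)\wedge (y,\in)\models{\rm ZFC})$, where $Tr(y)$ means $y$ is transitive; ${\rm LZFC}={\rm BST}+Loc({\rm ZFC})$. "Model" means a (set) transitive model of ZFC. The expressions $|x|=|y|$, $|x|\leq|y|$, $|x|<|y|$ have their usual meaning in terms of existence of bijections/injections. $GC$ ("there is a greatest cardinality") is the statement $(\exists \kappa)(\forall y)(|y|\leq |\kappa|)$, with $\kappa$ ranging over ordinals. "Every set is countable" is $(\forall x)(|x|\leq\omega)$. $TMA$ (Tall Model Axiom) is the statement $$(\forall \kappa)(\exists \alpha>\kappa)(\forall \delta\geq \alpha)(\exists M)(\delta\in M \wedge M\models |\kappa|<|\alpha|),$$ where $\kappa,\alpha,\delta$ range over ordinals and $M$ over models. $V=L$ says that every set belongs to some $L_\alpha$, $\alpha$ an ordinal (in LZFC each $L_\alpha$ exists, since it can be computed absolutely in any model containing $\alpha$). -}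

module Defs where

open import Data.Nat.Base using (ℕ; zero; suc)
open import Data.Fin.Base using (Fin; zero; suc; toℕ; opposite; _↑ʳ_)
open import Data.Fin.Patterns
open import Data.List.Base using (List; []; _∷_; map; foldr)
open import Data.List.Membership.Propositional using (_∈_)
open import Data.Sum.Base using (_⊎_)
open import Relation.Binary.PropositionalEquality.Core using (_≡_)

------------------------------------------------------------------------
-- First-order logic with equality over the language {∈}

infix  4 _∈̇_ _≐_
infixr 2 _⇒_

-- Formula n: formulas whose free variables are among n de Bruijn indices.
data Formula : ℕ → Set where
  _∈̇_ : ∀ {n} → Fin n → Fin n → Formula n
  _≐_ : ∀ {n} → Fin n → Fin n → Formula n
  ⊥̇   : ∀ {n} → Formula n
  _⇒_ : ∀ {n} → Formula n → Formula n → Formula n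
  ∀̇   : ∀ {n} → Formula (suc n) → Formula n

Sentence : Set
Sentence = Formula 0

ext : ∀ {m n} → (Fin m → Fin n) → Fin (suc m) → Fin (suc n)
ext ρ zero    = zero
ext ρ (suc i) = suc (ρ i)

rename : ∀ {m n} → (Fin m → Fin n) → Formula m → Formula n
rename ρ (x ∈̇ y) = ρ x ∈̇ ρ y
rename ρ (x ≐ y) = ρ x ≐ ρ y
rename ρ ⊥̇       = ⊥̇
rename ρ (φ ⇒ ψ) = rename ρ φ ⇒ rename ρ ψ
rename ρ (∀̇ φ)   = ∀̇ (rename (ext ρ) φ)

instantiate : ∀ {n} → Fin n → Fin (suc n) → Fin n
instantiate i zero    = i
instantiate i (suc j) = j

-- Variables are the only terms of the language, so substitution is renaming.
_[_] : ∀ {n} → Formula (suc n) → Fin n → Formula n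
φ [ i ] = rename (instantiate i) φ

infix  6 ¬̇_
infixr 3 _∧̇_
infixr 3 _∨̇_
infix  1 _⇔_

¬̇_ : ∀ {n} → Formula n → Formula n
¬̇ φ = φ ⇒ ⊥̇

_∧̇_ _∨̇_ _⇔_ : ∀ {n} → Formula n → Formula n → Formula n
φ ∧̇ ψ = ¬̇ (φ ⇒ ¬̇ ψ)
φ ∨̇ ψ = ¬̇ φ ⇒ ψ
φ ⇔ ψ = (φ ⇒ ψ) ∧̇ (ψ ⇒ φ)

∃̇ : ∀ {n} → Formula (suc n) → Formula n
∃̇ φ = ¬̇ (∀̇ (¬̇ φ))

∀∈ ∃∈ : ∀ {n} → Fin n → Formula (suc n) → Formula n
∀∈ x φ = ∀̇ (0F ∈̇ suc x ⇒ φ)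
∃∈ x φ = ¬̇ (∀∈ x (¬̇ φ))

Theory : Set₁
Theory = Sentence → Set

infixl 5 _⊕_

_⊕_ : Theory → Sentence → Theory
(T ⊕ σ) τ = T τ ⊎ τ ≡ σ

-- Classical natural deduction.  At n = 0 nothing forces the domain to be
-- nonempty; the theories considered here have the empty set axiom.
data Derivation (T : Theory) : ∀ {n} → List (Formula n) → Formula n → Set where
  axiom  : ∀ {n} {Γ : List (Formula n)} {σ : Sentence} →
           T σ → Derivation T Γ (rename (λ ()) σ)
  assume : ∀ {n} {Γ : List (Formula n)} {φ} →
           φ ∈ Γ → Derivation T Γ φ
  ⇒-intro : ∀ {n} {Γ : List (Formula n)} {φ ψ} →
           Derivation T (φ ∷ Γ) ψ → Derivation T Γ (φ ⇒ ψ)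
  ⇒-elim : ∀ {n} {Γ : List (Formula n)} {φ ψ} →
           Derivation T Γ (φ ⇒ ψ) → Derivation T Γ φ → Derivation T Γ ψ
  raa    : ∀ {n} {Γ : List (Formula n)} {φ} →
           Derivation T ((¬̇ φ) ∷ Γ) ⊥̇ → Derivation T Γ φ
  ∀-intro : ∀ {n} {Γ : List (Formula n)} {φ : Formula (suc n)} →
           Derivation T (map (rename suc) Γ) φ → Derivation T Γ (∀̇ φ)
  ∀-elim : ∀ {n} {Γ : List (Formula n)} {φ : Formula (suc n)} →
           Derivation T Γ (∀̇ φ) → (i : Fin n) → Derivation T Γ (φ [ i ])
  ≐-refl : ∀ {n} {Γ : List (Formula n)} (i : Fin n) →
           Derivation T Γ (i ≐ i)
  ≐-subst : ∀ {n} {Γ : List (Formula n)} (φ : Formula (suc n)) {i j : Fin n} →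
           Derivation T Γ (i ≐ j) → Derivation T Γ (φ [ i ]) →
           Derivation T Γ (φ [ j ])

infix 1 _⊢_

_⊢_ : Theory → Sentence → Set
T ⊢ σ = Derivation T [] σ

------------------------------------------------------------------------
-- Elementary set-theoretic notions

infix 4 _⊆̇_ ⟨_,_⟩∈̇_

_⊆̇_ : ∀ {n} → Fin n → Fin n → Formula n
x ⊆̇ y = ∀∈ x (0F ∈̇ suc y)

Empty NonEmpty Tr : ∀ {n} → Fin n → Formula n
Empty x    = ∀̇ (¬̇ (0F ∈̇ suc x))
NonEmpty x = ∃̇ (0F ∈̇ suc x)
Tr x       = ∀∈ x (0F ⊆̇ suc x)

-- z = {x , y}
IsUPair : ∀ {n} → Fin n → Fin n → Fin n → Formula n
IsUPair z x y = x ∈̇ z ∧̇ y ∈̇ z ∧̇ ∀∈ z (0F ≐ suc x ∨̇ 0F ≐ suc y)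

-- p = (x , y) = {{x} , {x , y}}
IsOPair : ∀ {n} → Fin n → Fin n → Fin n → Formula n
IsOPair p x y =
  ∃∈ p (∃∈ (suc p)
    (IsUPair 1F (2 ↑ʳ x) (2 ↑ʳ x) ∧̇
     IsUPair 0F (2 ↑ʳ x) (2 ↑ʳ y) ∧̇
     IsUPair (2 ↑ʳ p) 1F 0F))

⟨_,_⟩∈̇_ : ∀ {n} → Fin n → Fin n → Fin n → Formula n
⟨ x , y ⟩∈̇ f = ∃∈ f (IsOPair 0F (suc x) (suc y))

-- f is a function with domain d
IsFunOn : ∀ {n} → Fin n → Fin n → Formula n
IsFunOn f d =
  ∀∈ f (∃∈ (suc d) (∃̇ (IsOPair 2F 1F 0F))) ∧̇
  ∀∈ d (∃̇ (∀̇ (⟨ 2F , 0F ⟩∈̇ (3 ↑ʳ f) ⇔ 0F ≐ 1F)))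

-- f : d → y
IsFun : ∀ {n} → Fin n → Fin n → Fin n → Formula n
IsFun f d y =
  ∀∈ f (∃∈ (suc d) (∃∈ (2 ↑ʳ y) (IsOPair 2F 1F 0F))) ∧̇
  ∀∈ d (∃∈ (suc y) (∀∈ (2 ↑ʳ y) (⟨ 2F , 0F ⟩∈̇ (3 ↑ʳ f) ⇔ 0F ≐ 1F)))

IsInjection : ∀ {n} → Fin n → Fin n → Fin n → Formula n
IsInjection f x y =
  IsFun f x y ∧̇
  ∀∈ x (∀∈ (suc x) (∀∈ (2 ↑ʳ y)
    (⟨ 2F , 0F ⟩∈̇ (3 ↑ʳ f) ∧̇ ⟨ 1F , 0F ⟩∈̇ (3 ↑ʳ f) ⇒ 2F ≐ 1F)))

IsBijection : ∀ {n} → Fin n → Fin n → Fin n → Formula n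
IsBijection f x y =
  IsInjection f x y ∧̇ ∀∈ y (∃∈ (suc x) (⟨ 0F , 1F ⟩∈̇ (2 ↑ʳ f)))

infix 4 _≼_ _≈_ _≺_

-- |x| ≤ |y|,  |x| = |y|,  |x| < |y|
_≼_ _≈_ _≺_ : ∀ {n} → Fin n → Fin n → Formula n
x ≼ y = ∃̇ (IsInjection 0F (suc x) (suc y))
x ≈ y = ∃̇ (IsBijection 0F (suc x) (suc y))
x ≺ y = x ≼ y ∧̇ ¬̇ (x ≈ y)

-- z = x ∪ {x}
IsSuc : ∀ {n} → Fin n → Fin n → Formula n
IsSuc z x = x ∈̇ z ∧̇ x ⊆̇ z ∧̇ ∀∈ z (0F ∈̇ suc x ∨̇ 0F ≐ suc x)

-- Foundation is not an axiom of BST, so well-foundedness is part of the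
-- definition of an ordinal: a transitive set well-ordered by ∈.
IsOrd : ∀ {n} → Fin n → Formula n
IsOrd x =
  Tr x ∧̇
  ∀∈ x (∀∈ (suc x) (1F ∈̇ 0F ∨̇ 1F ≐ 0F ∨̇ 0F ∈̇ 1F)) ∧̇
  ∀̇ (0F ⊆̇ suc x ∧̇ NonEmpty 0F ⇒ ∃∈ 0F (∀∈ 1F (¬̇ (0F ∈̇ 1F))))

IsLimit : ∀ {n} → Fin n → Formula n
IsLimit x = IsOrd x ∧̇ NonEmpty x ∧̇ ∀∈ x (∃∈ (suc x) (1F ∈̇ 0F))

-- w = ω, the least limit ordinal
IsOmega : ∀ {n} → Fin n → Formula n
IsOmega w = IsLimit w ∧̇ ∀∈ w (¬̇ (IsLimit 0F))

-- k ∈ ω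
IsNat : ∀ {n} → Fin n → Formula n
IsNat k = ∃̇ (IsOmega 0F ∧̇ suc k ∈̇ 0F)

-- x is the von Neumann numeral of k
IsNumeral : ∀ {n} → ℕ → Fin n → Formula n
IsNumeral zero    x = Empty x
IsNumeral (suc k) x = ∃̇ (IsNumeral k 0F ∧̇ IsSuc (suc x) 0F)

------------------------------------------------------------------------
-- Set-coded formulas and the satisfaction relation, inside {∈}
--
-- Set-coded formulas have named variables v_i (i ∈ ω).  The codes are
--   v_i ∈ v_j ↦ (0,(i,j))    v_i = v_j ↦ (1,(i,j))    ⊥ ↦ (2,(∅,∅))
--   φ ⇒ ψ ↦ (3,(φ,ψ))        ∀ v_i φ ↦ (4,(i,φ))

-- c = (k , (a , b)), k a numeral
IsNode : ∀ {n} → ℕ → Fin n → Fin n → Fin n → Formula n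
IsNode k c a b =
  ∃̇ (∃̇ (IsNumeral k 1F ∧̇
         IsOPair 0F (2 ↑ʳ a) (2 ↑ʳ b) ∧̇
         IsOPair (2 ↑ʳ c) 1F 0F))

IsMemCode IsEqCode IsImpCode IsAllCode :
  ∀ {n} → Fin n → Fin n → Fin n → Formula n
IsMemCode = IsNode 0
IsEqCode  = IsNode 1
IsImpCode = IsNode 3
IsAllCode = IsNode 4

IsBotCode : ∀ {n} → Fin n → Formula n
IsBotCode c = ∃̇ (Empty 0F ∧̇ IsNode 2 (suc c) 0F 0F)

-- a = g(l) for some l ∈ m
Earlier : ∀ {n} → Fin n → Fin n → Fin n → Formula n
Earlier g m a = ∃∈ m (⟨ 0F , suc a ⟩∈̇ suc g)

-- c is atomic with variable indices in N, or is built from values of g at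
-- arguments in m by a connective or a quantifier with index in N
FormationStep : ∀ {n} → Fin n → Fin n → Fin n → Fin n → Formula n
FormationStep N g m c =
  ∃∈ N (∃∈ (suc N) (IsMemCode (2 ↑ʳ c) 1F 0F)) ∨̇
  ∃∈ N (∃∈ (suc N) (IsEqCode (2 ↑ʳ c) 1F 0F)) ∨̇
  IsBotCode c ∨̇
  ∃̇ (∃̇ (Earlier (2 ↑ʳ g) (2 ↑ʳ m) 1F ∧̇
         Earlier (2 ↑ʳ g) (2 ↑ʳ m) 0F ∧̇
         IsImpCode (2 ↑ʳ c) 1F 0F)) ∨̇
  ∃∈ N (∃̇ (Earlier (2 ↑ʳ g) (2 ↑ʳ m) 0F ∧̇
            IsAllCode (2 ↑ʳ c) 1F 0F))

-- g is a finite formation sequence of formulas in the variables v_i, i ∈ N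
IsFormation : ∀ {n} → Fin n → Fin n → Formula n
IsFormation N g =
  ∃̇ (IsNat 0F ∧̇ IsFunOn (suc g) 0F ∧̇
     ∀∈ 0F (∃̇ (⟨ 1F , 0F ⟩∈̇ (3 ↑ʳ g) ∧̇
                FormationStep (3 ↑ʳ N) (3 ↑ʳ g) 1F 0F)))

InRange : ∀ {n} → Fin n → Fin n → Formula n
InRange g c = ∃̇ (⟨ 0F , suc c ⟩∈̇ suc g)

-- c codes a formula all of whose variables, free or bound, are v_i with i ∈ N
IsForm : ∀ {n} → Fin n → Fin n → Formula n
IsForm N c = ∃̇ (IsFormation (suc N) 0F ∧̇ InRange 0F (suc c))

-- t′ : k → y is t with the value at i changed to x
IsUpdate : ∀ {n} → Fin n → Fin n → Fin n → Fin n → Fin n → Fin n → Formula n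
IsUpdate k y t′ t i x =
  IsFun t′ k y ∧̇ ⟨ i , x ⟩∈̇ t′ ∧̇
  ∀∈ k (¬̇ (0F ≐ suc i) ⇒
        ∀∈ (suc y) (⟨ 1F , 0F ⟩∈̇ (2 ↑ʳ t) ⇒ ⟨ 1F , 0F ⟩∈̇ (2 ↑ʳ t′)))

-- Tarski's conditions on S, where (c , t) ∈ S is read as (y , ∈) ⊨ c [ t ],
-- for the formula c and the assignment t : k → y
TarskiAt : ∀ {n} → Fin n → Fin n → Fin n → Fin n → Fin n → Formula n
TarskiAt k y S c t =
  ∀̇ (∀̇ (IsMemCode (2 ↑ʳ c) 1F 0F ⇒
    (⟨ 2 ↑ʳ c , 2 ↑ʳ t ⟩∈̇ (2 ↑ʳ S) ⇔
     ∃̇ (∃̇ (⟨ 3F , 1F ⟩∈̇ (4 ↑ʳ t) ∧̇ ⟨ 2F , 0F ⟩∈̇ (4 ↑ʳ t) ∧̇ 1F ∈̇ 0F))))) ∧̇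
  ∀̇ (∀̇ (IsEqCode (2 ↑ʳ c) 1F 0F ⇒
    (⟨ 2 ↑ʳ c , 2 ↑ʳ t ⟩∈̇ (2 ↑ʳ S) ⇔
     ∃̇ (∃̇ (⟨ 3F , 1F ⟩∈̇ (4 ↑ʳ t) ∧̇ ⟨ 2F , 0F ⟩∈̇ (4 ↑ʳ t) ∧̇ 1F ≐ 0F))))) ∧̇
  (IsBotCode c ⇒ ¬̇ (⟨ c , t ⟩∈̇ S)) ∧̇
  ∀̇ (∀̇ (IsImpCode (2 ↑ʳ c) 1F 0F ⇒
    (⟨ 2 ↑ʳ c , 2 ↑ʳ t ⟩∈̇ (2 ↑ʳ S) ⇔
     (⟨ 1F , 2 ↑ʳ t ⟩∈̇ (2 ↑ʳ S) ⇒ ⟨ 0F , 2 ↑ʳ t ⟩∈̇ (2 ↑ʳ S))))) ∧̇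
  ∀̇ (∀̇ (IsAllCode (2 ↑ʳ c) 1F 0F ⇒
    (⟨ 2 ↑ʳ c , 2 ↑ʳ t ⟩∈̇ (2 ↑ʳ S) ⇔
     ∀∈ (2 ↑ʳ y) (∀̇ (IsUpdate (4 ↑ʳ k) (4 ↑ʳ y) 0F (4 ↑ʳ t) 3F 1F ⇒
                      ⟨ 2F , 0F ⟩∈̇ (4 ↑ʳ S))))))

-- (y , ∈) ⊨ c [ s ], where k ∈ ω, s : k → y and c is the code of a formula in
-- the variables v_i, i < k: some S satisfies Tarski's conditions along a
-- formation sequence of c and contains (c , s).
Sat : ∀ {n} → Fin n → Fin n → Fin n → Fin n → Formula n
Sat k y s c =
  IsNat k ∧̇ IsFun s k y ∧̇
  ∃̇ (IsFormation (suc k) 0F ∧̇ InRange 0F (suc c) ∧̇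
     ∃̇ (∀̇ (InRange 2F 0F ⇒
             ∀̇ (IsFun 0F (4 ↑ʳ k) (4 ↑ʳ y) ⇒
                 TarskiAt (4 ↑ʳ k) (4 ↑ʳ y) 2F 1F 0F)) ∧̇
        ⟨ 2 ↑ʳ c , 2 ↑ʳ s ⟩∈̇ 0F))

------------------------------------------------------------------------
-- Codes of concrete formulas

-- Formulas with named variables and h schematic letters.
data Named (h : ℕ) : Set where
  mem eq : ℕ → ℕ → Named h
  bot    : Named h
  _imp_  : Named h → Named h → Named h
  all    : ℕ → Named h → Named h
  letter : Fin h → Named h

infixr 2 _imp_
infixr 3 _and_
infix  1 _iff_

_and_ _iff_ : ∀ {h} → Named h → Named h → Named h
φ and ψ = (φ imp (ψ imp bot)) imp bot
φ iff ψ = (φ imp ψ) and (ψ imp φ)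

ex : ∀ {h} → ℕ → Named h → Named h
ex i φ = all i (φ imp bot) imp bot

-- De Bruijn levels serve as names: of n free variables, index i is named
-- v_(n-1-i), and a quantifier under n variables binds v_n.
name : ∀ {n h} → Formula n → Named h
name (x ∈̇ y)     = mem (toℕ (opposite x)) (toℕ (opposite y))
name (x ≐ y)     = eq (toℕ (opposite x)) (toℕ (opposite y))
name ⊥̇           = bot
name (φ ⇒ ψ)     = name φ imp name ψ
name {n} (∀̇ φ)   = all n (name φ)

-- c is the code of φ, when its schematic letters stand for the codes χ
IsCode : ∀ {h n} → Named h → (Fin h → Fin n) → Fin n → Formula n
IsCode (mem i j)  χ c =
  ∃̇ (∃̇ (IsNumeral i 1F ∧̇ IsNumeral j 0F ∧̇ IsMemCode (2 ↑ʳ c) 1F 0F))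
IsCode (eq i j)   χ c =
  ∃̇ (∃̇ (IsNumeral i 1F ∧̇ IsNumeral j 0F ∧̇ IsEqCode (2 ↑ʳ c) 1F 0F))
IsCode bot        χ c = IsBotCode c
IsCode (φ imp ψ)  χ c =
  ∃̇ (∃̇ (IsCode φ (λ l → 2 ↑ʳ χ l) 1F ∧̇
         IsCode ψ (λ l → 2 ↑ʳ χ l) 0F ∧̇
         IsImpCode (2 ↑ʳ c) 1F 0F))
IsCode (all i φ)  χ c =
  ∃̇ (∃̇ (IsNumeral i 1F ∧̇
         IsCode φ (λ l → 2 ↑ʳ χ l) 0F ∧̇
         IsAllCode (2 ↑ʳ c) 1F 0F))
IsCode (letter l) χ c = c ≐ χ l

------------------------------------------------------------------------
-- ZFC as a set-theoretically defined collection of codes, and its models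

extensionality foundation pairing union powerset infinity choice : Sentence
extensionality = ∀̇ (∀̇ (∀̇ (0F ∈̇ 2F ⇔ 0F ∈̇ 1F) ⇒ 1F ≐ 0F))
foundation     = ∀̇ (NonEmpty 0F ⇒ ∃∈ 0F (∀∈ 1F (¬̇ (0F ∈̇ 1F))))
pairing        = ∀̇ (∀̇ (∃̇ (IsUPair 0F 2F 1F)))
union          = ∀̇ (∃̇ (∀̇ (0F ∈̇ 1F ⇔ ∃∈ 2F (1F ∈̇ 0F))))
powerset       = ∀̇ (∃̇ (∀̇ (0F ∈̇ 1F ⇔ 0F ⊆̇ 2F)))
infinity       = ∃̇ (∃∈ 0F (Empty 0F) ∧̇ ∀∈ 0F (∃∈ 1F (IsSuc 0F 1F)))
-- every set of nonempty pairwise disjoint sets has a transversal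
choice         =
  ∀̇ (∀∈ 0F (NonEmpty 0F) ∧̇
     ∀∈ 0F (∀∈ 1F (∃̇ (0F ∈̇ 2F ∧̇ 0F ∈̇ 1F) ⇒ 1F ≐ 0F)) ⇒
     ∃̇ (∀∈ 1F (∃̇ (∀̇ (0F ∈̇ 2F ∧̇ 0F ∈̇ 3F ⇔ 0F ≐ 1F)))))

singleAxioms : List Sentence
singleAxioms =
  extensionality ∷ foundation ∷ pairing ∷ union ∷ powerset ∷ infinity ∷
  choice ∷ []

-- In both schemas v_3 and v_4 must not occur in the schematic letter ψ; any
-- other variable may occur, as a parameter.
--   ∀a ∃b ∀x (x ∈ b ⇔ x ∈ a ∧ ψ),                    with x, a, b = v_0, v_2, v_3
--   ∀a ((∀x ∈ a) ∃!z ψ ⇒ ∃b ∀z (z ∈ b ⇔ ∃x (x ∈ a ∧ ψ))),             z = v_1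
separationSchema replacementSchema : Named 1
separationSchema =
  all 2 (ex 3 (all 0 (mem 0 3 iff mem 0 2 and letter 0F)))
replacementSchema =
  all 2 (all 0 (mem 0 2 imp ex 4 (all 1 (letter 0F iff eq 1 4))) imp
         ex 3 (all 1 (mem 1 3 iff ex 0 (mem 0 2 and letter 0F))))

-- c is the code of an instance of the schema σ
IsInstance : ∀ {n} → Named 1 → Fin n → Formula n
IsInstance σ c =
  ∃̇ (∃̇ (∀∈ 1F (IsNat 0F ∧̇ ¬̇ (IsNumeral 3 0F) ∧̇ ¬̇ (IsNumeral 4 0F)) ∧̇
         IsForm 1F 0F ∧̇
         IsCode σ (λ _ → 0F) (2 ↑ʳ c)))

IsZFCAxiom : ∀ {n} → Fin n → Formula n
IsZFCAxiom c =
  foldr (λ σ φ → IsCode {h = 0} (name σ) (λ ()) c ∨̇ φ)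
        (IsInstance separationSchema c ∨̇ IsInstance replacementSchema c)
        singleAxioms

-- (y , ∈) ⊨ ZFC.  An axiom with parameters holds if every assignment
-- k → y covering its variables satisfies it.
_⊨ZFC : ∀ {n} → Fin n → Formula n
y ⊨ZFC =
  NonEmpty y ∧̇
  ∀̇ (IsZFCAxiom 0F ⇒
     ∀̇ (∀̇ (IsNat 1F ∧̇ IsFun 0F 1F (3 ↑ʳ y) ∧̇ IsForm 1F 2F ⇒
             Sat 1F (3 ↑ʳ y) 0F 2F)))

IsModel : ∀ {n} → Fin n → Formula n
IsModel M = Tr M ∧̇ M ⊨ZFC

-- (M , ∈) ⊨ φ [ a , b ], where a is the value of index 1F of φ and b that
-- of index 0F; these are named v_0 and v_1 by name.
Holds₂ : ∀ {n} → Fin n → Formula 2 → Fin n → Fin n → Formula n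
Holds₂ M φ a b =
  ∃̇ (∃̇ (∃̇ (IsCode {h = 0} (name φ) (λ ()) 0F ∧̇
    ∃̇ (IsNumeral 0 0F ∧̇ ⟨ 0F , 4 ↑ʳ a ⟩∈̇ 2F) ∧̇
    ∃̇ (IsNumeral 1 0F ∧̇ ⟨ 0F , 4 ↑ʳ b ⟩∈̇ 2F) ∧̇
    Sat 2F (3 ↑ʳ M) 1F 0F)))

------------------------------------------------------------------------
-- The theories BST and LZFC

data Δ₀ : ∀ {n} → Formula n → Set where
  Δ₀-∈ : ∀ {n} (x y : Fin n) → Δ₀ (x ∈̇ y)
  Δ₀-≐ : ∀ {n} (x y : Fin n) → Δ₀ (x ≐ y)
  Δ₀-⊥ : ∀ {n} → Δ₀ {n} ⊥̇
  Δ₀-⇒ : ∀ {n} {φ ψ : Formula n} → Δ₀ φ → Δ₀ ψ → Δ₀ (φ ⇒ ψ)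
  Δ₀-∀ : ∀ {n} (x : Fin n) {φ : Formula (suc n)} → Δ₀ φ → Δ₀ (∀∈ x φ)

close : ∀ {n} → Formula n → Sentence
close {zero}  φ = φ
close {suc n} φ = close (∀̇ φ)

-- ∀ parameters ∀a ∃b ∀x (x ∈ b ⇔ x ∈ a ∧ φ), where 0F in φ stands for x and
-- the other indices for the parameters
separation : ∀ {n} → Formula (suc n) → Sentence
separation φ =
  close (∀̇ (∃̇ (∀̇ (0F ∈̇ 1F ⇔ 0F ∈̇ 2F ∧̇ rename (ext (2 ↑ʳ_)) φ))))

emptySet cartesianProduct ωExists Loc-ZFC : Sentence
emptySet         = ∃̇ (Empty 0F)
cartesianProduct =
  ∀̇ (∀̇ (∃̇ (∀̇ (0F ∈̇ 1F ⇔ ∃∈ 3F (∃∈ 3F (IsOPair 2F 1F 0F))))))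
ωExists          = ∃̇ (IsOmega 0F)
Loc-ZFC          = ∀̇ (∃̇ (1F ∈̇ 0F ∧̇ Tr 0F ∧̇ 0F ⊨ZFC))

data BST : Theory where
  bst-empty   : BST emptySet
  bst-ext     : BST extensionality
  bst-pair    : BST pairing
  bst-union   : BST union
  bst-product : BST cartesianProduct
  bst-ω       : BST ωExists
  bst-sep     : ∀ {n} {φ : Formula (suc n)} → Δ₀ φ → BST (separation φ)

LZFC : Theory
LZFC = BST ⊕ Loc-ZFC

------------------------------------------------------------------------
-- The constructible hierarchy

-- z ∈ Def(X): z ⊆ X is {x ∈ X : (X , ∈) ⊨ c [ s(0 ↦ x) ]} for some code c and
-- some finite assignment s : k → X
IsDefinable : ∀ {n} → Fin n → Fin n → Formula n
IsDefinable z X =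
  z ⊆̇ X ∧̇
  ∃̇ (∃̇ (∃̇ (IsNat 2F ∧̇ IsFun 1F 2F (3 ↑ʳ X) ∧̇ IsForm 2F 0F ∧̇
    ∀∈ (3 ↑ʳ X)
      (0F ∈̇ (4 ↑ʳ z) ⇔
       ∃̇ (∃̇ (IsNumeral 0 1F ∧̇
              IsUpdate 5F (6 ↑ʳ X) 0F 4F 1F 2F ∧̇
              Sat 5F (6 ↑ʳ X) 0F 3F))))))

-- D = Def(X)
IsDef : ∀ {n} → Fin n → Fin n → Formula n
IsDef D X = ∀̇ (0F ∈̇ suc D ⇔ IsDefinable 0F (suc X))

-- Y = f(β) obeys L_0 = ∅, L_(γ+1) = Def(L_γ), L_β = ⋃_(γ<β) L_γ for limit β
LClause : ∀ {n} → Fin n → Fin n → Fin n → Formula n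
LClause f β Y =
  (Empty β ⇒ Empty Y) ∧̇
  ∀̇ (IsSuc (suc β) 0F ⇒ ∃̇ (⟨ 1F , 0F ⟩∈̇ (2 ↑ʳ f) ∧̇ IsDef (2 ↑ʳ Y) 0F)) ∧̇
  (IsLimit β ⇒
   ∀̇ (0F ∈̇ suc Y ⇔
       ∃∈ (suc β) (∃̇ (⟨ 1F , 0F ⟩∈̇ (3 ↑ʳ f) ∧̇ 2F ∈̇ 0F))))

-- X = L_α, for an ordinal α
IsL : ∀ {n} → Fin n → Fin n → Formula n
IsL X α =
  ∃̇ (∃̇ (IsSuc 1F (2 ↑ʳ α) ∧̇ IsFunOn 0F 1F ∧̇
     ∀∈ 1F (∃̇ (⟨ 1F , 0F ⟩∈̇ 2F ∧̇ LClause 2F 1F 0F)) ∧̇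
     ⟨ 2 ↑ʳ α , 2 ↑ʳ X ⟩∈̇ 0F))

------------------------------------------------------------------------

GC everySetCountable V=L TMA : Sentence
GC                = ∃̇ (IsOrd 0F ∧̇ ∀̇ (0F ≼ 1F))
everySetCountable = ∀̇ (∃̇ (IsOmega 0F ∧̇ 1F ≼ 0F))
V=L               = ∀̇ (∃̇ (∃̇ (IsOrd 1F ∧̇ IsL 0F 1F ∧̇ 2F ∈̇ 0F)))
-- κ, α, δ, M are bound in this order
TMA               =
  ∀̇ (IsOrd 0F ⇒
  ∃̇ (IsOrd 0F ∧̇ 1F ∈̇ 0F ∧̇
  ∀̇ (IsOrd 0F ∧̇ (1F ∈̇ 0F ∨̇ 1F ≐ 0F) ⇒
  ∃̇ (IsModel 0F ∧̇ 1F ∈̇ 0F ∧̇ Holds₂ 0F (1F ≺ 0F) 3F 2F))))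

{-# OPTIONS --safe #-}
module Submission where

-- By a constructive completeness theorem (Krivine) it suffices to derive
-- absurdity in every classical structure, possibly with a true absurdity, that
-- satisfies the axioms and TMA.  There let κ have greatest cardinality, let
-- α > κ be given by TMA, and let f : α → κ be injective.  By V = L, f ∈ L_γ for
-- some γ.  Choose δ ≥ α, γ, ω and a model M ∋ δ of |κ| < |α|.  Satisfaction in
-- a set X ∈ M is absolute for M, because formation sequences and assignments
-- are finite and a satisfaction relation, restricted to one formation sequence,
-- can be rebuilt inside M.  Hence Def(X) and, by induction, L_γ are computed
-- correctly in M, so f ∈ M, and the Schröder–Bernstein construction in M yields
-- a bijection between κ and α in M, a contradiction.  Foundation is not needed:
-- the ordinals involved are at most δ, hence ordinals both in M and outside.

open import Defs
open import Data.Bool.Base using (Bool; true; false; if_then_else_; _∧_; T)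
open import Data.Empty using (⊥-elim)
open import Data.Unit.Base using (⊤; tt)
open import Data.Nat.Base using (ℕ; zero; suc; _+_; _∸_; _⊔_; _≤_; _<_; z≤n; s≤s; _≡ᵇ_; _≤′_; ≤′-refl; ≤′-step)
open import Data.Nat.Properties
open import Data.Fin.Base using (Fin; zero; suc; toℕ; opposite; _↑ʳ_)
open import Data.Fin.Properties using (toℕ-inject₁; toℕ-fromℕ; toℕ<n)
open import Data.Fin.Patterns
open import Data.List.Base using (List; []; _∷_; map; foldr; _++_; allFin; cartesianProductWith; length)
open import Data.List.Properties using (map-∘; map-cong)
open import Data.List.Membership.Propositional using () renaming (_∈_ to _∈ₗ_)
open import Data.List.Membership.Propositional.Properties
  using (∈-map⁺; ∈-map⁻; ∈-++⁺ˡ; ∈-++⁺ʳ; ∈-allFin; ∈-cartesianProductWith⁺)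
open import Data.List.Relation.Unary.Any using (here; there)
open import Data.List.Relation.Unary.All using (All; []; _∷_)
import Data.List.Relation.Unary.All as All
open import Data.List.Relation.Unary.All.Properties using (++⁺; map⁺)
open import Data.Product.Base using (Σ; Σ-syntax; _×_; _,_; proj₁; proj₂)
open import Data.Sum.Base using (_⊎_; inj₁; inj₂)
open import Function.Base using (_∘_; id; case_of_)
open import Relation.Nullary using (yes; no)
open import Relation.Binary.Definitions using (tri<; tri≈; tri>)
open import Relation.Binary.PropositionalEquality using (_≡_; _≢_; refl; sym; trans; cong; cong₂; subst; module ≡-Reasoning)

-- Formal derivations of this length are impracticable, hence the detour through structures. In
-- Agda's constructive logic completeness forces absurdity to be a mere type `R`, and the whole
-- argument runs in the double-negation monad `∥_∥` over `R`. Set-building in the universe rests on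
-- BST: without power sets, replacement or more than Δ₀-separation, induction along ordinals is
-- available for Δ₀ formulas alone. Inductive claims are therefore bounded by sets at hand, above
-- all by `M` itself, and constructions that need more are carried out in `M`. That `M` models ZFC
-- is a statement about codes, and `ω` may have nonstandard members; the axioms become usable for
-- formulas given in Agda, by building their formation sequences and comparing coded with actual
-- truth. The ordinal δ is taken above `ω` so that `ω ∈ M`: then coded formulas, formation sequences
-- and assignments, standard or not, all lie in `M`.

infixr 5 _▹_

_▹_ : ∀ {A : Set} {n} → A → (Fin n → A) → Fin (suc n) → A
(x ▹ e) zero    = x
(x ▹ e) (suc i) = e i

ε₀ : ∀ {A : Set} → Fin 0 → A
ε₀ ()

-- Renaming of variables

ext-cong : ∀ {m n} {ρ σ : Fin m → Fin n} → (∀ i → ρ i ≡ σ i) → ∀ i → ext ρ i ≡ ext σ i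
ext-cong h zero    = refl
ext-cong h (suc i) = cong suc (h i)

rename-cong : ∀ {m n} {ρ σ : Fin m → Fin n} → (∀ i → ρ i ≡ σ i) → ∀ φ → rename ρ φ ≡ rename σ φ
rename-cong h (x ∈̇ y) = cong₂ _∈̇_ (h x) (h y)
rename-cong h (x ≐ y) = cong₂ _≐_ (h x) (h y)
rename-cong h ⊥̇       = refl
rename-cong h (φ ⇒ ψ) = cong₂ _⇒_ (rename-cong h φ) (rename-cong h ψ)
rename-cong h (∀̇ φ)   = cong ∀̇ (rename-cong (ext-cong h) φ)

ext-∘ : ∀ {l m n} (ρ : Fin m → Fin n) (σ : Fin l → Fin m) → ∀ i → ext ρ (ext σ i) ≡ ext (ρ ∘ σ) i
ext-∘ ρ σ zero    = refl
ext-∘ ρ σ (suc i) = refl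

rename-∘ : ∀ {l m n} (ρ : Fin m → Fin n) (σ : Fin l → Fin m) φ →
           rename ρ (rename σ φ) ≡ rename (ρ ∘ σ) φ
rename-∘ ρ σ (x ∈̇ y) = refl
rename-∘ ρ σ (x ≐ y) = refl
rename-∘ ρ σ ⊥̇       = refl
rename-∘ ρ σ (φ ⇒ ψ) = cong₂ _⇒_ (rename-∘ ρ σ φ) (rename-∘ ρ σ ψ)
rename-∘ ρ σ (∀̇ φ)   =
  cong ∀̇ (trans (rename-∘ (ext ρ) (ext σ) φ) (rename-cong (ext-∘ ρ σ) φ))

rename-[] : ∀ {m n} (ρ : Fin m → Fin n) φ i → rename ρ (φ [ i ]) ≡ rename (ext ρ) φ [ ρ i ]
rename-[] ρ φ i = trans (rename-∘ ρ _ φ)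
  (trans (rename-cong (λ { zero → refl ; (suc j) → refl }) φ) (sym (rename-∘ _ (ext ρ) φ)))

rename-ext-[] : ∀ {m n} (ρ : Fin m → Fin n) φ i → rename (ext ρ) φ [ i ] ≡ rename (i ▹ ρ) φ
rename-ext-[] ρ φ i =
  trans (rename-∘ _ (ext ρ) φ) (rename-cong (λ { zero → refl ; (suc j) → refl }) φ)

-- Tarski semantics with a type for absurdity

module Truth {D : Set} (_∈_ _≗_ : D → D → Set) (R : Set) where

  ⟦_⟧ : ∀ {n} → Formula n → (Fin n → D) → Set
  ⟦ x ∈̇ y ⟧ e = e x ∈ e y
  ⟦ x ≐ y ⟧ e = e x ≗ e y
  ⟦ ⊥̇ ⟧     e = R
  ⟦ φ ⇒ ψ ⟧ e = ⟦ φ ⟧ e → ⟦ ψ ⟧ e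
  ⟦ ∀̇ φ ⟧   e = ∀ d → ⟦ φ ⟧ (d ▹ e)

-- Classical Tarski structures in which absurdity may hold ("exploding
-- models") and existential statements have witnesses.
record Structure : Set₁ where
  infix 4 _∈_ _≗_
  field
    Carrier : Set
    _∈_ _≗_ : Carrier → Carrier → Set
    R       : Set
  open Truth _∈_ _≗_ R public
  field
    dne-∈ : ∀ {x y} → ((x ∈ y → R) → R) → x ∈ y
    dne-≗ : ∀ {x y} → ((x ≗ y → R) → R) → x ≗ y
    ≗-refl  : ∀ {x} → x ≗ x
    ≗-subst : ∀ {n} (φ : Formula (suc n)) (e : Fin n → Carrier) {x y} →
              x ≗ y → ⟦ φ ⟧ (x ▹ e) → ⟦ φ ⟧ (y ▹ e)
    witness : ∀ {n} (φ : Formula (suc n)) (e : Fin n → Carrier) →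
              ⟦ ∃̇ φ ⟧ e → Σ Carrier λ d → ⟦ φ ⟧ (d ▹ e)

-- Derivations

module _ {T : Theory} where

  weaken : ∀ {n} {Γ Δ : List (Formula n)} {φ} →
           (∀ {ψ} → ψ ∈ₗ Γ → ψ ∈ₗ Δ) → Derivation T Γ φ → Derivation T Δ φ
  weaken s (axiom t)       = axiom t
  weaken s (assume i)      = assume (s i)
  weaken s (⇒-intro d)     = ⇒-intro (weaken (λ { (here p) → here p ; (there i) → there (s i) }) d)
  weaken s (⇒-elim d d′)   = ⇒-elim (weaken s d) (weaken s d′)
  weaken s (raa d)         = raa (weaken (λ { (here p) → here p ; (there i) → there (s i) }) d)
  weaken {Δ = Δ} s (∀-intro d) = ∀-intro (weaken
    (λ i → let _ , j , p = ∈-map⁻ (rename suc) i in subst (_∈ₗ map (rename suc) Δ) (sym p) (∈-map⁺ (rename suc) (s j))) d)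
  weaken s (∀-elim d i)    = ∀-elim (weaken s d) i
  weaken s (≐-refl i)      = ≐-refl i
  weaken s (≐-subst φ d d′) = ≐-subst φ (weaken s d) (weaken s d′)

  rename-derivation : ∀ {m n} (ρ : Fin m → Fin n) {Γ φ} →
                      Derivation T Γ φ → Derivation T (map (rename ρ) Γ) (rename ρ φ)
  rename-derivation ρ (axiom {σ = σ} t) = subst (Derivation T _)
    (trans (rename-cong (λ ()) σ) (sym (rename-∘ ρ (λ ()) σ))) (axiom t)
  rename-derivation ρ (assume i)    = assume (∈-map⁺ (rename ρ) i)
  rename-derivation ρ (⇒-intro d)   = ⇒-intro (rename-derivation ρ d)
  rename-derivation ρ (⇒-elim d d′) = ⇒-elim (rename-derivation ρ d) (rename-derivation ρ d′)
  rename-derivation ρ (raa d)       = raa (rename-derivation ρ d)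
  rename-derivation ρ {Γ} (∀-intro d) = ∀-intro (subst (λ Δ → Derivation T Δ _)
    (trans (sym (map-∘ Γ)) (trans (map-cong (λ φ → trans (rename-∘ (ext ρ) suc φ) (sym (rename-∘ suc ρ φ))) Γ) (map-∘ Γ)))
    (rename-derivation (ext ρ) d))
  rename-derivation ρ (∀-elim {φ = φ} d i) = subst (Derivation T _)
    (sym (rename-[] ρ φ i)) (∀-elim (rename-derivation ρ d) (ρ i))
  rename-derivation ρ (≐-refl i) = ≐-refl (ρ i)
  rename-derivation ρ (≐-subst φ {i} {j} d d′) = subst (Derivation T _) (sym (rename-[] ρ φ j))
    (≐-subst (rename (ext ρ) φ) (rename-derivation ρ d)
      (subst (Derivation T _) (rename-[] ρ φ i) (rename-derivation ρ d′)))

-- Enumeration of formulas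

-- Cantor's walk: along an antidiagonal by lowering the first component, then from (0, b) to the
-- start of the next antidiagonal.
diagonal : ℕ × ℕ → ℕ × ℕ
diagonal (zero  , b) = suc b , zero
diagonal (suc a , b) = a , suc b

unpair : ℕ → ℕ × ℕ
unpair zero    = zero , zero
unpair (suc n) = diagonal (unpair n)

-- The bound `s ≤ n` is what `enum-complete` needs: a formula must be enumerated at a stage where
-- its parameters already exist.
unpair-surjective : ∀ s a b → a + b ≡ s → Σ ℕ λ n → unpair n ≡ (a , b) × s ≤ n
unpair-surjective zero zero zero _ = 0 , refl , z≤n
unpair-surjective (suc s) a zero p
  with refl ← trans (sym (+-identityʳ a)) p
  = let n , q , l = column s zero (+-identityʳ s) (unpair-surjective s s zero (+-identityʳ s)) in suc n , cong diagonal q , s≤s l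
  where
  column : ∀ a b → a + b ≡ s → Σ ℕ (λ n → unpair n ≡ (s , 0) × s ≤ n) → Σ ℕ λ n → unpair n ≡ (0 , s) × s ≤ n
  column a b p h = go s 0 (+-identityʳ s) h
    where
    go : ∀ a b → a + b ≡ s → Σ ℕ (λ n → unpair n ≡ (a , b) × s ≤ n) → Σ ℕ λ n → unpair n ≡ (0 , s) × s ≤ n
    go zero b refl h = h
    go (suc a) b p (n , q , l) = go a (suc b) (trans (+-suc a b) p) (suc n , cong diagonal q , m≤n⇒m≤1+n l)
unpair-surjective s@(suc _) a (suc b) p =
  let n , q , l = unpair-surjective s (suc a) b (trans (sym (+-suc a b)) p) in suc n , cong diagonal q , m≤n⇒m≤1+n l

depth : ∀ {n} → Formula n → ℕ
depth (φ ⇒ ψ) = suc (depth φ ⊔ depth ψ)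
depth (∀̇ φ)   = suc (depth φ)
depth _       = 0

atoms : ∀ n → List (Formula n)
atoms n = ⊥̇ ∷ cartesianProductWith _∈̇_ (allFin n) (allFin n) ++ cartesianProductWith _≐_ (allFin n) (allFin n)

formulas : ℕ → ∀ n → List (Formula n)
formulas zero    n = atoms n
formulas (suc d) n =
  atoms n ++ cartesianProductWith _⇒_ (formulas d n) (formulas d n) ++ map ∀̇ (formulas d (suc n))

formulas-complete : ∀ d {n} (φ : Formula n) → depth φ ≤ d → φ ∈ₗ formulas d n
formulas-complete d (x ∈̇ y) _ = atomic d
  where
  atomic : ∀ d → (x ∈̇ y) ∈ₗ formulas d _
  atomic zero    = there (∈-++⁺ˡ (∈-cartesianProductWith⁺ _∈̇_ (∈-allFin x) (∈-allFin y)))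
  atomic (suc d) = ∈-++⁺ˡ (atomic zero)
formulas-complete d (x ≐ y) _ = atomic d
  where
  atomic : ∀ d → (x ≐ y) ∈ₗ formulas d _
  atomic zero    = there (∈-++⁺ʳ _ (∈-cartesianProductWith⁺ _≐_ (∈-allFin x) (∈-allFin y)))
  atomic (suc d) = ∈-++⁺ˡ (atomic zero)
formulas-complete zero    ⊥̇ _ = here refl
formulas-complete (suc d) ⊥̇ _ = here refl
formulas-complete (suc d) {n} (φ ⇒ ψ) (s≤s l) = ∈-++⁺ʳ (atoms n) (∈-++⁺ˡ (∈-cartesianProductWith⁺ _⇒_
  (formulas-complete d φ (m⊔n≤o⇒m≤o _ _ l)) (formulas-complete d ψ (m⊔n≤o⇒n≤o _ _ l))))
formulas-complete (suc d) {n} (∀̇ φ) (s≤s l) =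
  ∈-++⁺ʳ (atoms n) (∈-++⁺ʳ _ (∈-map⁺ ∀̇ (formulas-complete d φ l)))

depth-rename : ∀ {m n} (ρ : Fin m → Fin n) φ → depth (rename ρ φ) ≡ depth φ
depth-rename ρ (x ∈̇ y) = refl
depth-rename ρ (x ≐ y) = refl
depth-rename ρ ⊥̇       = refl
depth-rename ρ (φ ⇒ ψ) = cong suc (cong₂ _⊔_ (depth-rename ρ φ) (depth-rename ρ ψ))
depth-rename ρ (∀̇ φ)   = cong suc (depth-rename (ext ρ) φ)

nth : ∀ {n} → List (Formula n) → ℕ → Formula n
nth []       _       = ⊥̇
nth (φ ∷ l) zero    = φ
nth (φ ∷ l) (suc i) = nth l i

nth-complete : ∀ {n φ} {l : List (Formula n)} → φ ∈ₗ l → Σ ℕ λ i → nth l i ≡ φ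
nth-complete (here p)  = zero , sym p
nth-complete (there h) = let i , p = nth-complete h in suc i , p

-- The element d of the Henkin model is the variable introduced at stage d;
-- in the context of stage n it is the de Bruijn index n - d.
pos : ∀ n → ℕ → Fin (suc n)
pos zero    d = zero
pos (suc n) d = if d ≡ᵇ suc n then zero else suc (pos n d)

level : ∀ {n} → Fin (suc n) → ℕ
level {n}     zero    = n
level {suc n} (suc i) = level i

≡ᵇ-refl : ∀ n → (n ≡ᵇ n) ≡ true
≡ᵇ-refl zero    = refl
≡ᵇ-refl (suc n) = ≡ᵇ-refl n

≤⇒≢ᵇ : ∀ {d n} → d ≤ n → (d ≡ᵇ suc n) ≡ false
≤⇒≢ᵇ z≤n     = refl
≤⇒≢ᵇ (s≤s l) = ≤⇒≢ᵇ l

pos-new : ∀ n → pos (suc n) (suc n) ≡ zero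
pos-new n rewrite ≡ᵇ-refl n = refl

pos-old : ∀ n {d} → d ≤ n → pos (suc n) d ≡ suc (pos n d)
pos-old n l rewrite ≤⇒≢ᵇ l = refl

level-pos : ∀ n d → d ≤ n → level (pos n d) ≡ d
level-pos zero    .zero z≤n = refl
level-pos (suc n) d l with m≤n⇒m<n∨m≡n l
... | inj₁ (s≤s k) rewrite ≤⇒≢ᵇ k = level-pos n d k
... | inj₂ refl    rewrite ≡ᵇ-refl n = refl

-- The list selected by (i, j) consists of formulas about the elements 0, ..., i; `level` turns
-- their variables into element numbers, and `pos n` reads these in the context of stage `n`.
enum : ∀ n → Formula (suc n)
enum n = let i , j = unpair n in rename (pos n ∘ level) (nth (formulas i (suc i)) j)

bound : ∀ {m} → (Fin m → ℕ) → ℕ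
bound {zero}  e = 0
bound {suc m} e = e zero ⊔ bound (e ∘ suc)

≤bound : ∀ {m} (e : Fin m → ℕ) i → e i ≤ bound e
≤bound e zero    = m≤m⊔n _ _
≤bound e (suc i) = ≤-trans (≤bound (e ∘ suc) i) (m≤n⊔m _ _)

enum-complete : ∀ {m} (φ : Formula m) (e : Fin m → ℕ) →
                Σ ℕ λ n → bound e ≤ n × enum n ≡ rename (pos n ∘ e) φ
enum-complete φ e =
  -- Large enough for the parameters to be variables in the context of stage `i` and for φ to occur
  -- among the formulas of depth at most `i`.
  let i         = bound e ⊔ depth φ
      φ′        = rename (pos i ∘ e) φ
      j , p     = nth-complete (formulas-complete i φ′ (≤-trans (≤-reflexive (depth-rename _ φ)) (m≤n⊔m _ _)))
      n , q , l = unpair-surjective (i + j) i j refl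
      be≤i      = m≤m⊔n (bound e) (depth φ)
  in n , ≤-trans be≤i (≤-trans (m≤m+n i j) l) ,
     (begin
       enum n                                    ≡⟨ cong (λ (i , j) → rename (pos n ∘ level) (nth (formulas i (suc i)) j)) q ⟩
       rename (pos n ∘ level) (nth (formulas i (suc i)) j) ≡⟨ cong (rename _) p ⟩
       rename (pos n ∘ level) (rename (pos i ∘ e) φ) ≡⟨ rename-∘ _ _ φ ⟩
       rename (pos n ∘ level ∘ pos i ∘ e) φ ≡⟨ rename-cong (λ x → cong (pos n) (level-pos i (e x) (≤-trans (≤bound e x) be≤i))) φ ⟩
       rename (pos n ∘ e) φ ∎)
  where open ≡-Reasoning

-- The Henkin construction

module Construction (T : Theory) (Γ₀ : List Sentence) where

  Provable : ∀ {n} → (Formula n → Set) → Formula n → Set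
  Provable A φ = Σ (List _) λ Γ → All A Γ × Derivation T Γ φ

  -- The new element is a counterexample to `∀̇ φ` if there is one. Formulas of any other shape get
  -- a trivial axiom, so that each stage adds exactly one element.
  henkin : ∀ {n} → Formula n → Formula (suc n)
  henkin (∀̇ φ) = φ ⇒ rename suc (∀̇ φ)
  henkin _     = ⊥̇ ⇒ ⊥̇

  -- Krivine's trick: the formula enumerated at a stage is added under the
  -- hypothesis that this is conservative for ⊥, which needs no decision.
  Stage : ∀ n → Formula (suc n) → Set
  Conservative : ∀ n → Set
  Stage zero    φ = Σ Sentence λ σ → σ ∈ₗ Γ₀ × φ ≡ rename suc σ
  Stage (suc n) φ =
    (Σ (Formula (suc n)) λ ψ → Stage n ψ × φ ≡ rename suc ψ) ⊎
    φ ≡ henkin (enum n) ⊎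
    φ ≡ rename suc (enum n) × Conservative n
  Conservative n =
    ∀ Δ → All (Stage n) Δ → Derivation T (enum n ∷ Δ) ⊥̇ → Provable (Stage n) ⊥̇

  Prov : ∀ n → Formula (suc n) → Set
  Prov n = Provable (Stage n)

  prov-assume : ∀ {n φ} → Stage n φ → Prov n φ
  prov-assume h = _ ∷ [] , h ∷ [] , assume (here refl)

  prov-map : ∀ {n φ ψ} → (∀ {Γ} → Derivation T Γ φ → Derivation T Γ ψ) → Prov n φ → Prov n ψ
  prov-map f (Γ , a , d) = Γ , a , f d

  prov-map₂ : ∀ {n φ ψ χ} → (∀ {Γ} → Derivation T Γ φ → Derivation T Γ ψ → Derivation T Γ χ) →
              Prov n φ → Prov n ψ → Prov n χ
  prov-map₂ f (Γ , a , d) (Δ , b , d′) =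
    Γ ++ Δ , ++⁺ a b , f (weaken ∈-++⁺ˡ d) (weaken (∈-++⁺ʳ Γ) d′)

  prov-suc : ∀ {n φ} → Prov n φ → Prov (suc n) (rename suc φ)
  prov-suc (Γ , a , d) =
    _ , map⁺ (All.map (λ s → inj₁ (_ , s , refl)) a) , rename-derivation suc d

  -- A refutation of φ ⇒ ∀φ proves φ of the fresh variable and refutes ∀φ, while generalising the
  -- former gives ∀φ. The fresh variable is discharged by instantiating it with variable zero: the
  -- context of a stage is never empty.
  henkin-conservative : ∀ {n} (φ : Formula (suc n)) {Δ} →
    Derivation T (henkin φ ∷ map (rename suc) Δ) ⊥̇ → Derivation T Δ ⊥̇
  henkin-conservative {n} φ {Δ} d = ∀-elim (∀-intro (refute φ d)) zero
    where
    trivial : Derivation T ((⊥̇ ⇒ ⊥̇) ∷ map (rename suc) Δ) ⊥̇ → Derivation T (map (rename suc) Δ) ⊥̇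
    trivial d = ⇒-elim (⇒-intro d) (⇒-intro (assume (here refl)))
    refute : ∀ φ → Derivation T (henkin φ ∷ map (rename suc) Δ) ⊥̇ → Derivation T (map (rename suc) Δ) ⊥̇
    refute (_ ∈̇ _) d = trivial d
    refute (_ ≐ _) d = trivial d
    refute ⊥̇ d = trivial d
    refute (_ ⇒ _) d = trivial d
    refute (∀̇ χ) d = ⇒-elim refuted (rename-derivation suc (∀-intro instance-holds))
      where
      refuted : Derivation T (map (rename suc) Δ) (¬̇ rename suc (∀̇ χ))
      refuted = ⇒-intro (⇒-elim (⇒-intro (weaken (λ { (here p) → here p ; (there i) → there (there i) }) d))
                                (⇒-intro (assume (there (here refl)))))
      instance-holds : Derivation T (map (rename suc) Δ) χ
      instance-holds = raa (⇒-elim (⇒-intro (weaken (λ { (here p) → here p ; (there i) → there (there i) }) d))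
        (⇒-intro (raa (⇒-elim (assume (there (there (here refl)))) (assume (there (here refl)))))))

  -- Sorts the hypotheses of a derivation at stage n + 1. Whether the enumerated formula is among
  -- them can be read off from the proofs of membership, and if it is, such a proof carries
  -- `Conservative n`.
  split : ∀ {n Γ} → All (Stage (suc n)) Γ → Σ (List (Formula (suc n))) λ Δ → All (Stage n) Δ ×
          ((∀ {ψ} → ψ ∈ₗ Γ → ψ ∈ₗ (henkin (enum n) ∷ map (rename suc) Δ)) ⊎
           (∀ {ψ} → ψ ∈ₗ Γ → ψ ∈ₗ (henkin (enum n) ∷ map (rename suc) (enum n ∷ Δ))) × Conservative n)
  split [] = [] , [] , inj₁ λ ()
  split (s ∷ a) with s | split a
  ... | inj₁ (ψ , h , refl) | Δ , b , inj₁ r = ψ ∷ Δ , h ∷ b , inj₁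
    λ { (here refl) → there (here refl) ; (there i) → insert (r i) }
    where
    insert : ∀ {x : Formula _} {y z l} → x ∈ₗ (y ∷ l) → x ∈ₗ (y ∷ z ∷ l)
    insert (here p)  = here p
    insert (there i) = there (there i)
  ... | inj₁ (ψ , h , refl) | Δ , b , inj₂ (r , c) = ψ ∷ Δ , h ∷ b , inj₂
    ((λ { (here refl) → there (there (here refl)) ; (there i) → insert (r i) }) , c)
    where
    insert : ∀ {x : Formula _} {y z w l} → x ∈ₗ (y ∷ w ∷ l) → x ∈ₗ (y ∷ w ∷ z ∷ l)
    insert (here p)          = here p
    insert (there (here p))  = there (here p)
    insert (there (there i)) = there (there (there i))
  ... | inj₂ (inj₁ refl) | Δ , b , inj₁ r = Δ , b , inj₁
    λ { (here refl) → here refl ; (there i) → r i }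
  ... | inj₂ (inj₁ refl) | Δ , b , inj₂ (r , c) = Δ , b , inj₂
    ((λ { (here refl) → here refl ; (there i) → r i }) , c)
  ... | inj₂ (inj₂ (refl , c)) | Δ , b , inj₁ r = Δ , b , inj₂
    ((λ { (here refl) → there (here refl) ; (there i) → insert (r i) }) , c)
    where
    insert : ∀ {x : Formula _} {y z l} → x ∈ₗ (y ∷ l) → x ∈ₗ (y ∷ z ∷ l)
    insert (here p)  = here p
    insert (there i) = there (there i)
  ... | inj₂ (inj₂ (refl , c)) | Δ , b , inj₂ (r , _) = Δ , b , inj₂
    ((λ { (here refl) → there (here refl) ; (there i) → r i }) , c)

  -- No stage adds an inconsistency: the Henkin axiom is removed together with its fresh variable,
  -- and then `Conservative n` removes the enumerated formula if it was used.
  prov-⊥-pred : ∀ n → Prov (suc n) ⊥̇ → Prov n ⊥̇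
  prov-⊥-pred n (Γ , a , d) with split a
  ... | Δ , b , inj₁ r       = Δ , b , henkin-conservative (enum n) (weaken r d)
  ... | Δ , b , inj₂ (r , c) = c Δ b (henkin-conservative (enum n) (weaken r d))

  prov-⊥-down : ∀ k n → Prov (k + n) ⊥̇ → Prov n ⊥̇
  prov-⊥-down zero    n p = p
  prov-⊥-down (suc k) n p = prov-⊥-down k n (prov-⊥-pred (k + n) p)

  prov-up : ∀ {m} (φ : Formula m) (e : Fin m → ℕ) {n} → bound e ≤ n →
            Prov n (rename (pos n ∘ e) φ) → ∀ {k} → n ≤ k → Prov k (rename (pos k ∘ e) φ)
  prov-up φ e {n} l p h = go (≤⇒≤′ h)
    where
    go : ∀ {k} → n ≤′ k → Prov k (rename (pos k ∘ e) φ)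
    go ≤′-refl = p
    go (≤′-step {k} h) = subst (Prov (suc k))
      (trans (rename-∘ suc _ φ) (rename-cong (λ i → sym (pos-old k (≤-trans (≤bound e i) (≤-trans l (≤′⇒≤ h))))) φ))
      (prov-suc (go h))

  -- Provability from some stage on, rather than at one stage, so that two facts can be combined at
  -- the maximum of their stages.
  Holds : ∀ {m} → Formula m → (Fin m → ℕ) → Set
  Holds φ e = Σ ℕ λ N → ∀ n → N ≤ n → Prov n (rename (pos n ∘ e) φ)

  holds : ∀ {m} (φ : Formula m) (e : Fin m → ℕ) {n} → bound e ≤ n → Prov n (rename (pos n ∘ e) φ) → Holds φ e
  holds φ e {n} l p = n , λ k h → prov-up φ e l p h

  holds-map : ∀ {m} {φ ψ : Formula m} {e : Fin m → ℕ} →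
    (∀ {n Γ} {ρ : Fin m → Fin n} → Derivation T Γ (rename ρ φ) → Derivation T Γ (rename ρ ψ)) → Holds φ e → Holds ψ e
  holds-map f (N , h) = N , λ n l → prov-map f (h n l)

  holds-map₂ : ∀ {m} {φ ψ χ : Formula m} {e : Fin m → ℕ} →
    (∀ {n Γ} {ρ : Fin m → Fin n} → Derivation T Γ (rename ρ φ) → Derivation T Γ (rename ρ ψ) → Derivation T Γ (rename ρ χ)) →
    Holds φ e → Holds ψ e → Holds χ e
  holds-map₂ f (N , h) (M , k) = N ⊔ M , λ n l →
    prov-map₂ f (h n (≤-trans (m≤m⊔n N M) l)) (k n (≤-trans (m≤n⊔m N M) l))

  Absurd : Set
  Absurd = Holds {0} ⊥̇ ε₀

  efq : ∀ {m} {φ : Formula m} {e} → Absurd → Holds φ e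
  efq (N , h) = N , λ n l → prov-map (λ d → raa (weaken there d)) (h n l)

  -- The constructive substitute for maximal consistency: the hypothesis says just what is needed
  -- for adding φ at its own stage to be conservative, so φ has been added there.
  maximal : ∀ {m} (φ : Formula m) (e : Fin m → ℕ) → (Holds (¬̇ φ) e → Absurd) → Holds φ e
  maximal φ e h =
    let n , l , q = enum-complete φ e
        conservative : Conservative n
        -- Refuting φ at stage `n` proves its negation, which by hypothesis makes absurdity provable
        -- at a later stage; from there it is pulled down to `n`.
        conservative Δ a d =
          let N , p = h (holds (¬̇ φ) e l (subst (λ ψ → Prov n (ψ ⇒ ⊥̇)) q (Δ , a , ⇒-intro d)))
              k     = N ⊔ n
          in prov-⊥-down (k ∸ n) n (subst (λ k → Prov k ⊥̇) (sym (m∸n+n≡m (m≤n⊔m N n))) (p k (m≤m⊔n N n)))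
        added : Prov (suc n) (rename suc (enum n))
        added = prov-assume (inj₂ (inj₂ (refl , conservative)))
    in holds φ e (m≤n⇒m≤1+n l) (subst (Prov (suc n))
         (trans (cong (rename suc) q) (trans (rename-∘ suc _ φ)
           (rename-cong (λ i → sym (pos-old n (≤-trans (≤bound e i) l))) φ))) added)

  -- The stage that enumerates `∀̇ φ` introduces the element `suc n` together with the Henkin axiom
  -- about it.
  henkin-witness : ∀ {m} (φ : Formula (suc m)) (e : Fin m → ℕ) →
    Σ ℕ λ d → Holds φ (d ▹ e) → Holds (∀̇ φ) e
  henkin-witness {m} φ e =
    let n , l , q = enum-complete (∀̇ φ) e
        le : ∀ i → e i ≤ n
        le i = ≤-trans (≤bound e i) l
        axiom′ : Prov (suc n) (rename (pos (suc n) ∘ (suc n ▹ e)) φ ⇒ rename (pos (suc n) ∘ e) (∀̇ φ))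
        axiom′ = subst (Prov (suc n)) (cong₂ _⇒_
          (rename-cong (λ { zero → sym (pos-new n) ; (suc i) → sym (pos-old n (le i)) }) φ)
          (trans (rename-∘ suc (pos n ∘ e) (∀̇ φ)) (rename-cong (λ i → sym (pos-old n (le i))) (∀̇ φ))))
          (subst (λ ψ → Prov (suc n) ψ) (cong henkin q) (prov-assume (inj₂ (inj₁ refl))))
        ax : Holds (φ ⇒ rename suc (∀̇ φ)) (suc n ▹ e)
        ax = holds _ _ (⊔-lub ≤-refl (m≤n⇒m≤1+n l)) (subst (λ ψ → Prov (suc n) (rename (pos (suc n) ∘ (suc n ▹ e)) φ ⇒ ψ)) (sym (rename-∘ _ suc (∀̇ φ))) axiom′)
    in suc n , λ h →
      let N , k = holds-map₂ ⇒-elim ax h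
      in N , λ j o → subst (Prov j) (rename-∘ _ suc (∀̇ φ)) (k j o)

  holds-∀-elim : ∀ {m} {φ : Formula (suc m)} {e : Fin m → ℕ} → Holds (∀̇ φ) e → ∀ d → Holds φ (d ▹ e)
  holds-∀-elim {φ = φ} {e} (N , h) d = N , λ n l → subst (Prov n)
    (trans (rename-ext-[] _ φ (pos n d)) (rename-cong (λ { zero → refl ; (suc i) → refl }) φ))
    (prov-map (λ p → ∀-elim p (pos n d)) (h n l))

  _∈ᴴ_ _≗ᴴ_ : ℕ → ℕ → Set
  x ∈ᴴ y = Holds {2} (0F ∈̇ 1F) (x ▹ y ▹ ε₀)
  x ≗ᴴ y = Holds {2} (0F ≐ 1F) (x ▹ y ▹ ε₀)

  open Truth _∈ᴴ_ _≗ᴴ_ Absurd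

  -- The truth lemma; implication makes the two directions depend on each other. Here `maximal`
  -- handles implication and `henkin-witness` the quantifier.
  truth⇒ : ∀ {m} (φ : Formula m) e → ⟦ φ ⟧ e → Holds φ e
  truth⇐ : ∀ {m} (φ : Formula m) e → Holds φ e → ⟦ φ ⟧ e
  truth⇒ (x ∈̇ y) e h = h
  truth⇒ (x ≐ y) e h = h
  truth⇒ ⊥̇       e h = h
  truth⇒ (φ ⇒ ψ) e h = maximal (φ ⇒ ψ) e λ n →
    let φ-holds : Holds φ e
        φ-holds = holds-map {φ = ¬̇ (φ ⇒ ψ)} {φ}
          (λ d → raa (⇒-elim (weaken there d) (⇒-intro (raa (⇒-elim (assume (there (there (here refl)))) (assume (there (here refl)))))))) n
        ψ-refuted : Holds (¬̇ ψ) e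
        ψ-refuted = holds-map {φ = ¬̇ (φ ⇒ ψ)} {¬̇ ψ}
          (λ d → ⇒-intro (⇒-elim (weaken there d) (⇒-intro (assume (there (here refl)))))) n
    in holds-map₂ {φ = ¬̇ ψ} {ψ} {⊥̇} ⇒-elim ψ-refuted (truth⇒ ψ e (h (truth⇐ φ e φ-holds)))
  truth⇒ (∀̇ φ)   e h = let d , k = henkin-witness φ e in k (truth⇒ φ (d ▹ e) (h d))
  truth⇐ (x ∈̇ y) e h = h
  truth⇐ (x ≐ y) e h = h
  truth⇐ ⊥̇       e h = h
  truth⇐ (φ ⇒ ψ) e h k = truth⇐ ψ e (holds-map₂ {φ = φ ⇒ ψ} {φ} {ψ} ⇒-elim h (truth⇒ φ e k))
  truth⇐ (∀̇ φ)   e h d = truth⇐ φ (d ▹ e) (holds-∀-elim {φ = φ} h d)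

  henkinModel : Structure
  henkinModel = record
    { Carrier = ℕ
    ; _∈_     = _∈ᴴ_
    ; _≗_     = _≗ᴴ_
    ; R       = Absurd
    ; dne-∈   = λ {x} {y} → dne (0F ∈̇ 1F) (x ▹ y ▹ ε₀)
    ; dne-≗   = λ {x} {y} → dne (0F ≐ 1F) (x ▹ y ▹ ε₀)
    ; ≗-refl  = 0 , λ n _ → [] , [] , ≐-refl _
    ; ≗-subst = λ φ e {x} {y} (N , p) q → truth⇐ φ (y ▹ e)
        (let M , r = truth⇒ φ (x ▹ e) q
         in N ⊔ M , λ n l → subst (Prov n) (substituted φ e n y)
              (prov-map₂ (≐-subst (rename (ext (pos n ∘ e)) φ))
                (p n (≤-trans (m≤m⊔n N M) l))
                (subst (Prov n) (sym (substituted φ e n x)) (r n (≤-trans (m≤n⊔m N M) l)))))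
    ; witness = λ φ e h →
        let d , k = henkin-witness (¬̇ φ) e
        in d , truth⇐ φ (d ▹ e) (maximal φ (d ▹ e) λ n →
             holds-map₂ {φ = ¬̇ (∀̇ (¬̇ φ))} {∀̇ (¬̇ φ)} {⊥̇} ⇒-elim (truth⇒ (∃̇ φ) e h) (k n))
    }
    where
    dne : ∀ {m} (φ : Formula m) e → ((Holds φ e → Absurd) → Absurd) → Holds φ e
    dne φ e h = maximal φ e λ n → h λ p → holds-map₂ {φ = ¬̇ φ} {φ} {⊥̇} ⇒-elim n p
    substituted : ∀ {m} (φ : Formula (suc m)) e n x →
                  rename (ext (pos n ∘ e)) φ [ pos n x ] ≡ rename (pos n ∘ (x ▹ e)) φ
    substituted φ e n x = trans (rename-ext-[] _ φ (pos n x)) (rename-cong (λ { zero → refl ; (suc i) → refl }) φ)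

  henkin-axioms : ∀ {σ} → T σ → ⟦ σ ⟧ ε₀
  henkin-axioms {σ} t = truth⇐ σ ε₀ (0 , λ n _ → [] , [] ,
    subst (Derivation T []) (rename-cong (λ ()) σ) (axiom t))

  henkin-hypotheses : ∀ {σ} → σ ∈ₗ Γ₀ → ⟦ σ ⟧ ε₀
  henkin-hypotheses {σ} i = truth⇐ σ ε₀ (holds σ ε₀ {0} z≤n
    (prov-assume (σ , i , rename-cong (λ ()) σ)))

  -- At stage 0 absurdity is derived from `Γ₀` in a context with one variable, and `ne` supplies an
  -- element for that variable.
  absurd-derivable : T ⊢ ∃̇ (¬̇ ⊥̇) → Absurd → Derivation T Γ₀ ⊥̇
  absurd-derivable ne (N , h) =
    let Γ , a , d = prov-⊥-down N 0 (subst (λ k → Prov k ⊥̇) (sym (+-identityʳ N)) (h N ≤-refl))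
        d′ : Derivation T (map (rename suc) Γ₀) ⊥̇
        d′ = weaken (λ i → let σ , j , p = All.lookup a i in subst (_∈ₗ _) (sym p) (∈-map⁺ (rename suc) j)) d
    in ⇒-elim (weaken (λ ()) ne) (∀-intro (⇒-intro (weaken there d′)))

-- Only derivations of `⊥̇` are covered; this suffices for a negated goal, whose body becomes a
-- hypothesis in `Γ`.
complete : ∀ {T : Theory} {Γ} → T ⊢ ∃̇ (¬̇ ⊥̇) →
  (∀ S → (∀ {σ} → T σ → Structure.⟦_⟧ S σ ε₀) → (∀ {σ} → σ ∈ₗ Γ → Structure.⟦_⟧ S σ ε₀) → Structure.R S) →
  Derivation T Γ ⊥̇
complete {T} {Γ} ne h = absurd-derivable ne (h henkinModel henkin-axioms henkin-hypotheses)
  where open Construction T Γ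

-- A Boolean test: for concrete formulas the side conditions of separation and absoluteness are
-- solved by evaluation, as implicit arguments of type `T (isΔ₀ φ)`.
isΔ₀ : ∀ {n} → Formula n → Bool
isΔ₀ (x ∈̇ y) = true
isΔ₀ (x ≐ y) = true
isΔ₀ ⊥̇       = true
isΔ₀ (φ ⇒ ψ) = isΔ₀ φ ∧ isΔ₀ ψ
isΔ₀ (∀̇ ((0F ∈̇ suc x) ⇒ φ)) = isΔ₀ φ
isΔ₀ (∀̇ _)   = false

isΔ₀-sound : ∀ {n} (φ : Formula n) → T (isΔ₀ φ) → Δ₀ φ
isΔ₀-sound (x ∈̇ y) _ = Δ₀-∈ x y
isΔ₀-sound (x ≐ y) _ = Δ₀-≐ x y
isΔ₀-sound ⊥̇       _ = Δ₀-⊥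
isΔ₀-sound (φ ⇒ ψ) t with isΔ₀ φ in p | isΔ₀ ψ in q
... | true | true =
  Δ₀-⇒ (isΔ₀-sound φ (subst T (sym p) tt)) (isΔ₀-sound ψ (subst T (sym q) tt))
isΔ₀-sound (∀̇ ((0F ∈̇ suc x) ⇒ φ)) t = Δ₀-∀ x (isΔ₀-sound φ t)

-- Named formulas

-- `name` with the names of the free variables and the first bound name left open: in instances of
-- the schemas, parameters and bound variables must stay clear of the variables of the schema.
assignName : ∀ {n} → (Fin n → ℕ) → ℕ → Formula n → Named 0
assignName ρ m (x ∈̇ y) = mem (ρ x) (ρ y)
assignName ρ m (x ≐ y) = eq (ρ x) (ρ y)
assignName ρ m ⊥̇       = bot
assignName ρ m (φ ⇒ ψ) = assignName ρ m φ imp assignName ρ m ψ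
assignName ρ m (∀̇ φ)   = all m (assignName (m ▹ ρ) (suc m) φ)

name-assignName : ∀ {n} (ρ : Fin n → ℕ) → (∀ i → ρ i ≡ toℕ (opposite i)) →
                  ∀ φ → assignName ρ n φ ≡ name φ
name-assignName ρ h (x ∈̇ y) = cong₂ mem (h x) (h y)
name-assignName ρ h (x ≐ y) = cong₂ eq (h x) (h y)
name-assignName ρ h ⊥̇       = refl
name-assignName ρ h (φ ⇒ ψ) = cong₂ _imp_ (name-assignName ρ h φ) (name-assignName ρ h ψ)
name-assignName {n} ρ h (∀̇ φ) = cong (all n) (name-assignName (n ▹ ρ) shifted φ)
  where
  shifted : ∀ i → (n ▹ ρ) i ≡ toℕ (opposite i)
  shifted zero    = sym (toℕ-fromℕ n)
  shifted (suc i) = trans (h i) (sym (toℕ-inject₁ (opposite i)))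

Vars : (ℕ → Set) → Named 0 → Set
Vars P (mem i j)  = P i × P j
Vars P (eq i j)   = P i × P j
Vars P bot        = ⊤
Vars P (φ imp ψ)  = Vars P φ × Vars P ψ
Vars P (all i φ)  = P i × Vars P φ

vars-map : ∀ {P Q : ℕ → Set} → (∀ {i} → P i → Q i) → ∀ φ → Vars P φ → Vars Q φ
vars-map f (mem i j) (p , q) = f p , f q
vars-map f (eq i j)  (p , q) = f p , f q
vars-map f bot       _       = tt
vars-map f (φ imp ψ) (p , q) = vars-map f φ p , vars-map f ψ q
vars-map f (all i φ) (p , q) = f p , vars-map f φ q

vars-zip : ∀ {P Q : ℕ → Set} φ → Vars P φ → Vars Q φ → Vars (λ i → P i × Q i) φ
vars-zip (mem i j) (p , q) (r , s) = (p , r) , (q , s)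
vars-zip (eq i j)  (p , q) (r , s) = (p , r) , (q , s)
vars-zip bot       _       _       = tt
vars-zip (φ imp ψ) (p , q) (r , s) = vars-zip φ p r , vars-zip ψ q s
vars-zip (all i φ) (p , q) (r , s) = (p , r) , vars-zip φ q s

maxVar : Named 0 → ℕ
maxVar (mem i j)  = i ⊔ j
maxVar (eq i j)   = i ⊔ j
maxVar bot        = 0
maxVar (φ imp ψ)  = maxVar φ ⊔ maxVar ψ
maxVar (all i φ)  = i ⊔ maxVar φ

vars-bounded : ∀ φ {k} → maxVar φ < k → Vars (_< k) φ
vars-bounded (mem i j) l = ≤-<-trans (m≤m⊔n i j) l , ≤-<-trans (m≤n⊔m i j) l
vars-bounded (eq i j)  l = ≤-<-trans (m≤m⊔n i j) l , ≤-<-trans (m≤n⊔m i j) l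
vars-bounded bot       l = tt
vars-bounded (φ imp ψ) l = vars-bounded φ (≤-<-trans (m≤m⊔n _ _) l) , vars-bounded ψ (≤-<-trans (m≤n⊔m _ _) l)
vars-bounded (all i φ) l = ≤-<-trans (m≤m⊔n _ _) l , vars-bounded φ (≤-<-trans (m≤n⊔m _ _) l)

vars-assignName : ∀ {P : ℕ → Set} {n} (ρ : Fin n → ℕ) m → (∀ i → P (ρ i)) → (∀ {i} → m ≤ i → P i) →
                  ∀ φ → Vars P (assignName ρ m φ)
vars-assignName ρ m p q (x ∈̇ y) = p x , p y
vars-assignName ρ m p q (x ≐ y) = p x , p y
vars-assignName ρ m p q ⊥̇       = tt
vars-assignName ρ m p q (φ ⇒ ψ) = vars-assignName ρ m p q φ , vars-assignName ρ m p q ψ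
vars-assignName ρ m p q (∀̇ φ)   = q ≤-refl ,
  vars-assignName (m ▹ ρ) (suc m) (λ { zero → q ≤-refl ; (suc i) → p i }) (q ∘ ≤-trans (n≤1+n m)) φ

-- Capture is intended: the quantifiers of a schema are meant to bind variables of the formula put
-- for its letter.
plug : Named 1 → Named 0 → Named 0
plug (mem i j)  χ = mem i j
plug (eq i j)   χ = eq i j
plug bot        χ = bot
plug (φ imp ψ)  χ = plug φ χ imp plug ψ χ
plug (all i φ)  χ = all i (plug φ χ)
plug (letter _) χ = χ

-- Set theory inside a structure satisfying BST

module Universe (S : Structure) (bst : ∀ {σ} → BST σ → Structure.⟦_⟧ S σ ε₀) where

  open Structure S public

  Env : ℕ → Set
  Env n = Fin n → Carrier

  -- Double negation into `R`: a monad in which `em` holds and from which `run` extracts stable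
  -- statements. Existence and disjunction in the structure appear as Σ and ⊎ under it.
  ∥_∥ : Set → Set
  ∥ A ∥ = (A → R) → R

  infixl 1 _>>=_

  _>>=_ : ∀ {A B : Set} → ∥ A ∥ → (A → ∥ B ∥) → ∥ B ∥
  (m >>= f) k = m (λ a → f a k)

  return : ∀ {A : Set} → A → ∥ A ∥
  return a k = k a

  record Stable (A : Set) : Set where
    constructor mkStable
    field dne : ∥ A ∥ → A

  run : ∀ {A : Set} ⦃ _ : Stable A ⦄ → ∥ A ∥ → A
  run ⦃ s ⦄ = Stable.dne s

  instance
    stable-∈ : ∀ {x y} → Stable (x ∈ y)
    stable-∈ = mkStable dne-∈

    stable-≗ : ∀ {x y} → Stable (x ≗ y)
    stable-≗ = mkStable dne-≗

    stable-R : Stable R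
    stable-R = mkStable λ h → h id

    stable-Π : ∀ {A : Set} {B : A → Set} ⦃ _ : ∀ {x} → Stable (B x) ⦄ → Stable ((x : A) → B x)
    stable-Π ⦃ s ⦄ = mkStable λ h x → Stable.dne s (λ k → h λ f → k (f x))

    stable-× : ∀ {A B : Set} ⦃ _ : Stable A ⦄ ⦃ _ : Stable B ⦄ → Stable (A × B)
    stable-× = mkStable λ h → run (λ k → h λ (a , _) → k a) , run (λ k → h λ (_ , b) → k b)

  -- Atoms are stable by assumption on the structure, and the primitive connectives `⊥̇`, `⇒`, `∀̇`
  -- preserve stability.
  stable : ∀ {n} (φ : Formula n) {e} → Stable (⟦ φ ⟧ e)
  stable (x ∈̇ y) = stable-∈
  stable (x ≐ y) = stable-≗
  stable ⊥̇       = stable-R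
  stable (φ ⇒ ψ) = stable-Π ⦃ stable ψ ⦄
  stable (∀̇ φ)   = stable-Π ⦃ stable φ ⦄

  efq : ∀ {A : Set} ⦃ _ : Stable A ⦄ → R → A
  efq r = run λ _ → r

  em : ∀ {A : Set} → ∥ A ⊎ (A → R) ∥
  em k = k (inj₂ λ a → k (inj₁ a))

  infix 1 _↔_
  _↔_ : Set → Set → Set
  A ↔ B = (A → B) × (B → A)

  -- Conversions between the negative encodings of Defs and Agda's Σ, × and ⊎
  -- under double negation.

  ∃⁻ : ∀ {P : Carrier → Set} → ((∀ d → P d → R) → R) → ∥ Σ Carrier P ∥
  ∃⁻ h k = h λ d p → k (d , p)

  ∃⁺ : ∀ {P : Carrier → Set} d → P d → (∀ d → P d → R) → R
  ∃⁺ d p k = k d p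

  ∃∈⁻ : ∀ {x} {P : Carrier → Set} → ((∀ d → d ∈ x → P d → R) → R) → ∥ Σ[ d ∈ Carrier ] d ∈ x × P d ∥
  ∃∈⁻ h k = h λ d i p → k (d , i , p)

  ∃∈⁺ : ∀ {x} {P : Carrier → Set} d → d ∈ x → P d → (∀ d → d ∈ x → P d → R) → R
  ∃∈⁺ d i p k = k d i p

  ∧⁻ : ∀ {A B : Set} → ((A → B → R) → R) → ∥ A × B ∥
  ∧⁻ h k = h λ a b → k (a , b)

  ∧⁺ : ∀ {A B : Set} → A → B → (A → B → R) → R
  ∧⁺ a b k = k a b

  ∨⁻ : ∀ {A B : Set} → ((A → R) → B) → ∥ A ⊎ B ∥
  ∨⁻ h k = k (inj₂ (h (k ∘ inj₁)))

  ∨⁺ : ∀ {A B : Set} ⦃ _ : Stable B ⦄ → ∥ A ⊎ B ∥ → (A → R) → B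
  ∨⁺ h n = run (h >>= λ { (inj₁ a) → λ _ → n a ; (inj₂ b) → return b })

  ∨ˡ : ∀ {A B : Set} ⦃ _ : Stable B ⦄ → A → (A → R) → B
  ∨ˡ a n = efq (n a)

  ∨ʳ : ∀ {A B : Set} → B → (A → R) → B
  ∨ʳ b _ = b

  ⇔⁻ : ∀ {A B : Set} ⦃ _ : Stable A ⦄ ⦃ _ : Stable B ⦄ → (((A → B) → (B → A) → R) → R) → A ↔ B
  ⇔⁻ h = run (∧⁻ h)

  -- Besides substituting equals, this replaces function extensionality: environments that agree
  -- pointwise are exchanged by it.
  ⟦⟧-≗ : ∀ {n} (φ : Formula n) {e e′ : Env n} → (∀ i → e i ≗ e′ i) → ⟦ φ ⟧ e → ⟦ φ ⟧ e′

  ≗-sym : ∀ {x y} → x ≗ y → y ≗ x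
  ≗-sym {x} p = ≗-subst (0F ≐ 1F) (x ▹ ε₀) p ≗-refl

  ≗-trans : ∀ {x y z} → x ≗ y → y ≗ z → x ≗ z
  ≗-trans {x} p q = ≗-subst (1F ≐ 0F) (x ▹ ε₀) q p

  ∈-≗ˡ : ∀ {x y z} → x ≗ y → x ∈ z → y ∈ z
  ∈-≗ˡ {z = z} = ≗-subst (0F ∈̇ 1F) (z ▹ ε₀)

  ∈-≗ʳ : ∀ {x y z} → y ≗ z → x ∈ y → x ∈ z
  ∈-≗ʳ {x} = ≗-subst (1F ∈̇ 0F) (x ▹ ε₀)

  ▹-≗ : ∀ {n} {x y} {e e′ : Env n} → x ≗ y → (∀ i → e i ≗ e′ i) → ∀ i → (x ▹ e) i ≗ (y ▹ e′) i
  ▹-≗ p h zero    = p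
  ▹-≗ p h (suc i) = h i

  ⟦⟧-≗ (x ∈̇ y) h p = ∈-≗ˡ (h x) (∈-≗ʳ (h y) p)
  ⟦⟧-≗ (x ≐ y) h p = ≗-trans (≗-sym (h x)) (≗-trans p (h y))
  ⟦⟧-≗ ⊥̇       h p = p
  ⟦⟧-≗ (φ ⇒ ψ) h p q = ⟦⟧-≗ ψ h (p (⟦⟧-≗ φ (≗-sym ∘ h) q))
  ⟦⟧-≗ (∀̇ φ)   h p d = ⟦⟧-≗ φ (▹-≗ ≗-refl h) (p d)

  ≡⇒≗ : ∀ {x y} → x ≡ y → x ≗ y
  ≡⇒≗ refl = ≗-refl

  ⟦rename⟧⁻ : ∀ {m n} (ρ : Fin m → Fin n) φ {e} → ⟦ rename ρ φ ⟧ e → ⟦ φ ⟧ (e ∘ ρ)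
  ⟦rename⟧⁺ : ∀ {m n} (ρ : Fin m → Fin n) φ {e} → ⟦ φ ⟧ (e ∘ ρ) → ⟦ rename ρ φ ⟧ e
  ext-▹ : ∀ {m n} (ρ : Fin m → Fin n) {d} {e : Env n} i → (d ▹ e) (ext ρ i) ≗ (d ▹ (e ∘ ρ)) i
  ext-▹ ρ zero    = ≗-refl
  ext-▹ ρ (suc i) = ≗-refl
  ⟦rename⟧⁻ ρ (x ∈̇ y) p = p
  ⟦rename⟧⁻ ρ (x ≐ y) p = p
  ⟦rename⟧⁻ ρ ⊥̇ p = p
  ⟦rename⟧⁻ ρ (φ ⇒ ψ) p q = ⟦rename⟧⁻ ρ ψ (p (⟦rename⟧⁺ ρ φ q))
  ⟦rename⟧⁻ ρ (∀̇ φ) p d = ⟦⟧-≗ φ (ext-▹ ρ) (⟦rename⟧⁻ (ext ρ) φ (p d))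
  ⟦rename⟧⁺ ρ (x ∈̇ y) p = p
  ⟦rename⟧⁺ ρ (x ≐ y) p = p
  ⟦rename⟧⁺ ρ ⊥̇ p = p
  ⟦rename⟧⁺ ρ (φ ⇒ ψ) p q = ⟦rename⟧⁺ ρ ψ (p (⟦rename⟧⁻ ρ φ q))
  ⟦rename⟧⁺ ρ (∀̇ φ) p d = ⟦rename⟧⁺ (ext ρ) φ (⟦⟧-≗ φ (≗-sym ∘ ext-▹ ρ) (p d))

  close-elim : ∀ {n} (φ : Formula n) → ⟦ close φ ⟧ ε₀ → ∀ e → ⟦ φ ⟧ e
  close-elim {zero}  φ h e = ⟦⟧-≗ φ (λ ()) h
  close-elim {suc n} φ h e =
    ⟦⟧-≗ φ (λ { zero → ≗-refl ; (suc i) → ≗-refl }) (close-elim (∀̇ φ) h (e ∘ suc) (e zero))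



  -- Extensionality, the empty set and Δ₀-separation

  infix 4 _⊆_
  _⊆_ : Carrier → Carrier → Set
  x ⊆ y = ∀ z → z ∈ x → z ∈ y

  extensional : ∀ {x y} → x ⊆ y → y ⊆ x → x ≗ y
  extensional {x} {y} p q = bst bst-ext x y λ z → ∧⁺ (p z) (q z)

  opaque
    ∅ : Carrier
    ∅ = proj₁ (witness (Empty 0F) ε₀ (bst bst-empty))

    ∉∅ : ∀ {x} → x ∈ ∅ → R
    ∉∅ {x} = proj₂ (witness (Empty 0F) ε₀ (bst bst-empty)) x

  empty≗∅ : ∀ {x} → (∀ y → y ∈ x → R) → x ≗ ∅
  empty≗∅ h = extensional (λ y i → efq (h y i)) (λ y i → efq (∉∅ i))

  opaque
    separated : ∀ {n} (φ : Formula (suc n)) {_ : T (isΔ₀ φ)} (e : Env n) a →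
                Σ[ b ∈ Carrier ] ⟦ ∀̇ (0F ∈̇ 1F ⇔ 0F ∈̇ 2F ∧̇ rename (ext (2 ↑ʳ_)) φ) ⟧ (b ▹ a ▹ e)
    separated φ {δ} e a = witness (∀̇ (0F ∈̇ 1F ⇔ 0F ∈̇ 2F ∧̇ rename (ext (2 ↑ʳ_)) φ)) (a ▹ e) (close-elim _ (bst (bst-sep (isΔ₀-sound φ δ))) e a)

    sep : ∀ {n} (φ : Formula (suc n)) {δ : T (isΔ₀ φ)} → Env n → Carrier → Carrier
    sep φ {δ} e a = proj₁ (separated φ {δ} e a)

    ∈sep⁻ : ∀ {n} (φ : Formula (suc n)) {δ : T (isΔ₀ φ)} {e : Env n} {a x} →
            x ∈ sep φ {δ} e a → x ∈ a × ⟦ φ ⟧ (x ▹ e)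
    ∈sep⁻ φ {δ} {e} {a} {x} i = run ⦃ stable-× ⦃ stable-∈ ⦄ ⦃ stable φ ⦄ ⦄ do
      f , _ ← ∧⁻ (proj₂ (separated φ {δ} e a) x)
      j , p ← ∧⁻ (f i)
      return (j , ⟦⟧-≗ φ (λ { zero → ≗-refl ; (suc _) → ≗-refl }) (⟦rename⟧⁻ (ext (2 ↑ʳ_)) φ p))

    ∈sep⁺ : ∀ {n} (φ : Formula (suc n)) {δ : T (isΔ₀ φ)} {e : Env n} {a x} →
            x ∈ a → ⟦ φ ⟧ (x ▹ e) → x ∈ sep φ {δ} e a
    ∈sep⁺ φ {δ} {e} {a} {x} i p = run do
      _ , g ← ∧⁻ (proj₂ (separated φ {δ} e a) x)
      return (g (∧⁺ i (⟦rename⟧⁺ (ext (2 ↑ʳ_)) φ (⟦⟧-≗ φ (λ { zero → ≗-refl ; (suc _) → ≗-refl }) p))))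

  -- Unions, unordered and ordered pairs

  opaque
    ⋃ : Carrier → Carrier
    ⋃ x = proj₁ (witness (∀̇ (0F ∈̇ 1F ⇔ ∃∈ 2F (1F ∈̇ 0F))) (x ▹ ε₀) (bst bst-union x))

    ∈⋃⁻ : ∀ {x z} → z ∈ ⋃ x → ∥ Σ[ y ∈ Carrier ] y ∈ x × z ∈ y ∥
    ∈⋃⁻ {x} {z} i = do
      f , _ ← ∧⁻ (proj₂ (witness (∀̇ (0F ∈̇ 1F ⇔ ∃∈ 2F (1F ∈̇ 0F))) (x ▹ ε₀) (bst bst-union x)) z)
      ∃∈⁻ (f i)

    ∈⋃⁺ : ∀ {x y z} → y ∈ x → z ∈ y → z ∈ ⋃ x
    ∈⋃⁺ {x} {y} {z} i j = run do
      _ , g ← ∧⁻ (proj₂ (witness (∀̇ (0F ∈̇ 1F ⇔ ∃∈ 2F (1F ∈̇ 0F))) (x ▹ ε₀) (bst bst-union x)) z)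
      return (g (∃∈⁺ y i j))

  opaque
    ⁅_,_⁆ : Carrier → Carrier → Carrier
    ⁅ x , y ⁆ = proj₁ (witness (IsUPair 0F 2F 1F) (y ▹ x ▹ ε₀) (bst bst-pair x y))

    upair-spec : ∀ {z x y} → ⟦ IsUPair 0F 1F 2F ⟧ (z ▹ x ▹ y ▹ ε₀) →
                 x ∈ z × y ∈ z × (∀ w → w ∈ z → ∥ w ≗ x ⊎ w ≗ y ∥)
    upair-spec h = run do
      i , h ← ∧⁻ h
      j , h ← ∧⁻ h
      return (i , j , λ w k → ∨⁻ (h w k))

    ∈⁅⁆₁ : ∀ {x y} → x ∈ ⁅ x , y ⁆
    ∈⁅⁆₁ {x} {y} = proj₁ (upair-spec (proj₂ (witness (IsUPair 0F 2F 1F) (y ▹ x ▹ ε₀) (bst bst-pair x y))))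

    ∈⁅⁆₂ : ∀ {x y} → y ∈ ⁅ x , y ⁆
    ∈⁅⁆₂ {x} {y} = proj₁ (proj₂ (upair-spec (proj₂ (witness (IsUPair 0F 2F 1F) (y ▹ x ▹ ε₀) (bst bst-pair x y)))))

    ∈⁅⁆⁻ : ∀ {x y w} → w ∈ ⁅ x , y ⁆ → ∥ w ≗ x ⊎ w ≗ y ∥
    ∈⁅⁆⁻ {x} {y} = proj₂ (proj₂ (upair-spec (proj₂ (witness (IsUPair 0F 2F 1F) (y ▹ x ▹ ε₀) (bst bst-pair x y))))) _

  upair⁻ : ∀ {z x y} → ⟦ IsUPair 0F 1F 2F ⟧ (z ▹ x ▹ y ▹ ε₀) → z ≗ ⁅ x , y ⁆
  upair⁻ h = let i , j , k = upair-spec h in extensional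
    (λ w l → run (k w l >>= λ { (inj₁ p) → return (∈-≗ˡ (≗-sym p) ∈⁅⁆₁) ; (inj₂ p) → return (∈-≗ˡ (≗-sym p) ∈⁅⁆₂) }))
    (λ w l → run (∈⁅⁆⁻ l >>= λ { (inj₁ p) → return (∈-≗ˡ (≗-sym p) i) ; (inj₂ p) → return (∈-≗ˡ (≗-sym p) j) }))

  upair⁺ : ∀ {z x y} → z ≗ ⁅ x , y ⁆ → ⟦ IsUPair 0F 1F 2F ⟧ (z ▹ x ▹ y ▹ ε₀)
  upair⁺ p = ∧⁺ (∈-≗ʳ (≗-sym p) ∈⁅⁆₁) (∧⁺ (∈-≗ʳ (≗-sym p) ∈⁅⁆₂) λ w i → ∨⁺ (∈⁅⁆⁻ (∈-≗ʳ p i)))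

  ⁅⁆-cong : ∀ {x y x′ y′} → x ≗ x′ → y ≗ y′ → ⁅ x , y ⁆ ≗ ⁅ x′ , y′ ⁆
  ⁅⁆-cong {x} {y} {x′} {y′} p q = upair⁻ (⟦⟧-≗ (IsUPair 0F 1F 2F) {⁅ x , y ⁆ ▹ x ▹ y ▹ ε₀} {⁅ x , y ⁆ ▹ x′ ▹ y′ ▹ ε₀}
    (λ { 0F → ≗-refl ; 1F → p ; 2F → q }) (upair⁺ ≗-refl))

  opaque
    pair : Carrier → Carrier → Carrier
    pair x y = ⁅ ⁅ x , x ⁆ , ⁅ x , y ⁆ ⁆

    pair-cong : ∀ {x y x′ y′} → x ≗ x′ → y ≗ y′ → pair x y ≗ pair x′ y′
    pair-cong p q = ⁅⁆-cong (⁅⁆-cong p p) (⁅⁆-cong p q)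

    opair⁻ : ∀ {p x y} → ⟦ IsOPair 0F 1F 2F ⟧ (p ▹ x ▹ y ▹ ε₀) → p ≗ pair x y
    opair⁻ h = run do
      a , _ , h ← ∃∈⁻ h
      b , _ , h ← ∃∈⁻ h
      u , h ← ∧⁻ h
      v , w ← ∧⁻ h
      return (≗-trans (upair⁻ w) (⁅⁆-cong (upair⁻ u) (upair⁻ v)))

    opair⁺ : ∀ {p x y} → p ≗ pair x y → ⟦ IsOPair 0F 1F 2F ⟧ (p ▹ x ▹ y ▹ ε₀)
    opair⁺ {p} {x} {y} h =
      ∃∈⁺ ⁅ x , x ⁆ (∈-≗ʳ (≗-sym h) ∈⁅⁆₁) (∃∈⁺ ⁅ x , y ⁆ (∈-≗ʳ (≗-sym h) ∈⁅⁆₂)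
        (∧⁺ (upair⁺ ≗-refl) (∧⁺ (upair⁺ ≗-refl) (upair⁺ h))))

  ⁅⁆-injective : ∀ {x y z} → ⁅ x , y ⁆ ≗ ⁅ x , z ⁆ → y ≗ z
  ⁅⁆-injective {x} {y} {z} p = run do
    c ← ∈⁅⁆⁻ (∈-≗ʳ p ∈⁅⁆₂)
    case c of λ where
      (inj₂ q) → return q
      (inj₁ q) → do
        d ← ∈⁅⁆⁻ (∈-≗ʳ (≗-sym p) ∈⁅⁆₂)
        case d of λ where
          (inj₁ r) → return (≗-trans q (≗-sym r))
          (inj₂ r) → return (≗-sym r)

  opaque
    unfolding pair
    pair-injective : ∀ {x y x′ y′} → pair x y ≗ pair x′ y′ → x ≗ x′ × y ≗ y′
    pair-injective {x} {y} {x′} {y′} p = x≗x′ , ⁅⁆-injective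
        (≗-trans (⁅⁆-injective {⁅ x , x ⁆} (≗-trans p (⁅⁆-cong (⁅⁆-cong (≗-sym x≗x′) (≗-sym x≗x′)) ≗-refl)))
                 (⁅⁆-cong (≗-sym x≗x′) ≗-refl))
      where
      x≗x′ : x ≗ x′
      x≗x′ = run do
        c ← ∈⁅⁆⁻ (∈-≗ʳ p ∈⁅⁆₁)
        d ← ∈⁅⁆⁻ (case c of λ { (inj₁ q) → ∈-≗ʳ (≗-sym q) ∈⁅⁆₁ ; (inj₂ q) → ∈-≗ʳ (≗-sym q) ∈⁅⁆₁ })
        case d of λ { (inj₁ q) → return (≗-sym q) ; (inj₂ q) → return (≗-sym q) }

  at⁻ : ∀ {f x y} → ⟦ ⟨ 1F , 2F ⟩∈̇ 0F ⟧ (f ▹ x ▹ y ▹ ε₀) → pair x y ∈ f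
  at⁻ h = run do
    p , i , h ← ∃∈⁻ h
    return (∈-≗ˡ (opair⁻ h) i)

  at⁺ : ∀ {f x y} → pair x y ∈ f → ⟦ ⟨ 1F , 2F ⟩∈̇ 0F ⟧ (f ▹ x ▹ y ▹ ε₀)
  at⁺ i = ∃∈⁺ _ i (opair⁺ ≗-refl)

  pair∈-cong : ∀ {f x y x′ y′} → x ≗ x′ → y ≗ y′ → pair x y ∈ f → pair x′ y′ ∈ f
  pair∈-cong p q = ∈-≗ˡ (pair-cong p q)

  -- Adjunction of an element, successors, numerals and nodes of codes

  opaque
    adj : Carrier → Carrier → Carrier
    adj a x = ⋃ ⁅ a , ⁅ x , x ⁆ ⁆

    ∈adj⁻ : ∀ {a x y} → y ∈ adj a x → ∥ y ∈ a ⊎ y ≗ x ∥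
    ∈adj⁻ i = do
      z , j , k ← ∈⋃⁻ i
      c ← ∈⁅⁆⁻ j
      case c of λ where
        (inj₁ p) → return (inj₁ (∈-≗ʳ p k))
        (inj₂ p) → do
          d ← ∈⁅⁆⁻ (∈-≗ʳ p k)
          case d of λ { (inj₁ q) → return (inj₂ q) ; (inj₂ q) → return (inj₂ q) }

    ∈adj⁺ˡ : ∀ {a x y} → y ∈ a → y ∈ adj a x
    ∈adj⁺ˡ i = ∈⋃⁺ ∈⁅⁆₁ i

    ∈adj⁺ʳ : ∀ {a x} → x ∈ adj a x
    ∈adj⁺ʳ = ∈⋃⁺ ∈⁅⁆₂ ∈⁅⁆₁

  adj-cong : ∀ {a b x y} → a ≗ b → x ≗ y → adj a x ≗ adj b y
  adj-cong p q = extensional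
    (λ z i → run (∈adj⁻ i >>= λ { (inj₁ j) → return (∈adj⁺ˡ (∈-≗ʳ p j))
                                 ; (inj₂ r) → return (∈-≗ˡ (≗-sym (≗-trans r q)) ∈adj⁺ʳ) }))
    (λ z i → run (∈adj⁻ i >>= λ { (inj₁ j) → return (∈adj⁺ˡ (∈-≗ʳ (≗-sym p) j))
                                 ; (inj₂ r) → return (∈-≗ˡ (≗-sym (≗-trans r (≗-sym q))) ∈adj⁺ʳ) }))

  succ : Carrier → Carrier
  succ x = adj x x

  suc⁻ : ∀ {z x} → ⟦ IsSuc 0F 1F ⟧ (z ▹ x ▹ ε₀) → z ≗ succ x
  suc⁻ {z} {x} h = run do
    i , h ← ∧⁻ h
    s , h ← ∧⁻ h
    return (extensional
      (λ w j → run (∨⁻ (h w j) >>= λ { (inj₁ k) → return (∈adj⁺ˡ k) ; (inj₂ p) → return (∈-≗ˡ (≗-sym p) ∈adj⁺ʳ) }))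
      (λ w j → run (∈adj⁻ j >>= λ { (inj₁ k) → return (s w k) ; (inj₂ p) → return (∈-≗ˡ (≗-sym p) i) })))

  suc⁺ : ∀ {z x} → z ≗ succ x → ⟦ IsSuc 0F 1F ⟧ (z ▹ x ▹ ε₀)
  suc⁺ p = ∧⁺ (∈-≗ʳ (≗-sym p) ∈adj⁺ʳ) (∧⁺ (λ w i → ∈-≗ʳ (≗-sym p) (∈adj⁺ˡ i))
    λ w i → ∨⁺ (∈adj⁻ (∈-≗ʳ p i)))

  num : ℕ → Carrier
  num zero    = ∅
  num (suc k) = succ (num k)

  numeral⁻ : ∀ {n} {e : Env n} k (i : Fin n) → ⟦ IsNumeral k i ⟧ e → e i ≗ num k
  numeral⁻ zero    i h = empty≗∅ h
  numeral⁻ {e = e} (suc k) i h = run do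
    d , h ← ∃⁻ h
    p , q ← ∧⁻ h
    return (≗-trans (suc⁻ q) (adj-cong (numeral⁻ {e = d ▹ e} k 0F p) (numeral⁻ {e = d ▹ e} k 0F p)))

  numeral⁺ : ∀ {n} {e : Env n} k (i : Fin n) → e i ≗ num k → ⟦ IsNumeral k i ⟧ e
  numeral⁺ zero    i p = λ d j → ∉∅ (∈-≗ʳ p j)
  numeral⁺ {e = e} (suc k) i p = ∃⁺ (num k) (∧⁺ (numeral⁺ {e = num k ▹ e} k 0F ≗-refl) (suc⁺ p))

  opaque
    node : ℕ → Carrier → Carrier → Carrier
    node k a b = pair (num k) (pair a b)

    node-cong : ∀ k {a b a′ b′} → a ≗ a′ → b ≗ b′ → node k a b ≗ node k a′ b′
    node-cong k p q = pair-cong ≗-refl (pair-cong p q)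

    node⁻ : ∀ {n} {e : Env n} k (c a b : Fin n) → ⟦ IsNode k c a b ⟧ e → e c ≗ node k (e a) (e b)
    node⁻ {e = e} k c a b h = run do
      x , h ← ∃⁻ h
      y , h ← ∃⁻ h
      p , h ← ∧⁻ h
      q , r ← ∧⁻ h
      return (≗-trans (opair⁻ r) (pair-cong (numeral⁻ {e = y ▹ x ▹ e} k 1F p) (opair⁻ q)))

    node⁺ : ∀ {n} {e : Env n} k (c a b : Fin n) → e c ≗ node k (e a) (e b) → ⟦ IsNode k c a b ⟧ e
    node⁺ {e = e} k c a b p = ∃⁺ (num k) (∃⁺ (pair (e a) (e b))
      (∧⁺ (numeral⁺ {e = pair (e a) (e b) ▹ num k ▹ e} k 1F ≗-refl) (∧⁺ (opair⁺ ≗-refl) (opair⁺ p))))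

  botCode⁻ : ∀ {n} {e : Env n} (c : Fin n) → ⟦ IsBotCode c ⟧ e → e c ≗ node 2 ∅ ∅
  botCode⁻ {e = e} c h = run do
    x , h ← ∃⁻ h
    p , q ← ∧⁻ h
    return (≗-trans (node⁻ {e = x ▹ e} 2 (suc c) 0F 0F q) (node-cong 2 (empty≗∅ p) (empty≗∅ p)))

  botCode⁺ : ∀ {n} {e : Env n} (c : Fin n) → e c ≗ node 2 ∅ ∅ → ⟦ IsBotCode c ⟧ e
  botCode⁺ {e = e} c p = ∃⁺ ∅ (∧⁺ (λ _ → ∉∅) (node⁺ {e = ∅ ▹ e} 2 (suc c) 0F 0F p))

  -- Ordinals, relative to a class K over which well-foundedness is tested

  Transitive : Carrier → Set
  Transitive α = ∀ x → x ∈ α → x ⊆ α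

  Linear : Carrier → Set
  Linear α = ∀ x → x ∈ α → ∀ y → y ∈ α → ∥ x ∈ y ⊎ x ≗ y ⊎ y ∈ x ∥

  Inhabited : Carrier → Set
  Inhabited u = ∥ Σ[ z ∈ Carrier ] z ∈ u ∥

  Minimum : Carrier → Set
  Minimum u = ∥ Σ[ m ∈ Carrier ] m ∈ u × (∀ x → x ∈ u → x ∈ m → R) ∥

  WellFounded : (Carrier → Set) → Carrier → Set
  WellFounded K α = ∀ u → K u → u ⊆ α → Inhabited u → Minimum u

  Ord : (Carrier → Set) → Carrier → Set
  Ord K α = Transitive α × Linear α × WellFounded K α

  Limit : (Carrier → Set) → Carrier → Set
  Limit K β = Ord K β × Inhabited β × (∀ x → x ∈ β → ∥ Σ[ y ∈ Carrier ] y ∈ β × x ∈ y ∥)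

  Omega : (Carrier → Set) → Carrier → Set
  Omega K w = Limit K w × (∀ n → n ∈ w → Limit K n → R)

  V : Carrier → Set
  V _ = ⊤

  ord⁻ : ∀ {α} → ⟦ IsOrd 0F ⟧ (α ▹ ε₀) → Ord V α
  ord⁻ h = run do
    t , h ← ∧⁻ h
    l , w ← ∧⁻ h
    return (t , (λ x i y j → do
                   c ← ∨⁻ (l x i y j)
                   case c of λ { (inj₁ a) → return (inj₁ a) ; (inj₂ b) → ∨⁻ b >>= return ∘ inj₂ })
              , λ u _ s n → ∃∈⁻ (w u (∧⁺ s λ k → n λ (z , i) → k z i)))

  ord⁺ : ∀ {α} → Ord V α → ⟦ IsOrd 0F ⟧ (α ▹ ε₀)
  ord⁺ (t , l , w) = ∧⁺ t (∧⁺ (λ x i y j → ∨⁺ (l x i y j >>= λ { (inj₁ a) → return (inj₁ a) ; (inj₂ b) → return (inj₂ (∨⁺ (return b))) }))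
    λ u h k → run do
      s , n ← ∧⁻ h
      m , i , p ← w u tt s (∃⁻ n)
      return (k m i p))

  limit⁻ : ∀ {α} → ⟦ IsLimit 0F ⟧ (α ▹ ε₀) → Limit V α
  limit⁻ h = run do
    o , h ← ∧⁻ h
    n , m ← ∧⁻ h
    return (ord⁻ o , ∃⁻ n , λ x i → ∃∈⁻ (m x i))

  limit⁺ : ∀ {α} → Limit V α → ⟦ IsLimit 0F ⟧ (α ▹ ε₀)
  limit⁺ (o , n , m) = ∧⁺ (ord⁺ o) (∧⁺ (λ k → n λ (z , i) → k z i) λ x i k → m x i λ (y , j , l) → k y j l)

  omega⁻ : ∀ {α} → ⟦ IsOmega 0F ⟧ (α ▹ ε₀) → Omega V α
  omega⁻ h = run do
    l , n ← ∧⁻ h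
    return (limit⁻ l , λ x i m → n x i (limit⁺ m))

  Ord-V : ∀ {K α} → Ord V α → Ord K α
  Ord-V (t , l , w) = t , l , λ u _ → w u tt

  -- Applied to the class of all sets and to the members of a model `M`. The sets whose minima the
  -- proofs take arise from members of `K` by Δ₀-separation, so that `K-sep` keeps them in `K`.
  module OrdinalsIn (K : Carrier → Set) (K-trans : ∀ {x y} → x ∈ y → K y → K x)
    (K-sep : ∀ {n} (φ : Formula (suc n)) {δ : T (isΔ₀ φ)} (e : Env n) a →
             (∀ i → K (e i)) → K a → K (sep φ {δ} e a)) where

    ord-irrefl : ∀ {α x} → K α → Ord K α → x ∈ α → x ∈ x → R
    ord-irrefl {α} {x} kα (t , l , w) i j = run do
      let u = sep (0F ≐ 1F) (x ▹ ε₀) α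
      m , k , min ← w u (K-sep (0F ≐ 1F) (x ▹ ε₀) α (λ { 0F → K-trans i kα }) kα)
                     (λ z k → proj₁ (∈sep⁻ (0F ≐ 1F) k)) (return (x , ∈sep⁺ (0F ≐ 1F) i ≗-refl))
      let p = proj₂ (∈sep⁻ (0F ≐ 1F) k)
      return (min x (∈sep⁺ (0F ≐ 1F) i ≗-refl) (∈-≗ʳ (≗-sym p) j))

    -- If α minus z is nonempty, its minimum m equals z: members of m lie in z by minimality, and
    -- members of z lie in m by linearity, as z is transitive and omits m.
    transitive-subset : ∀ {α z} → K α → K z → Ord K α → z ⊆ α → Transitive z → ∥ z ∈ α ⊎ z ≗ α ∥
    transitive-subset {α} {z} kα kz (t , l , w) s tz = do
      let φ = ¬̇ (0F ∈̇ 1F)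
          u = sep φ (z ▹ ε₀) α
      c ← em {Inhabited u}
      case c of λ where
        (inj₂ n) → return (inj₂ (extensional s λ x i → run λ k → n (return (x , ∈sep⁺ φ i k))))
        (inj₁ n) → do
          m , i , min ← w u (K-sep φ (z ▹ ε₀) α (λ { 0F → kz }) kα) (λ x k → proj₁ (∈sep⁻ φ k)) n
          let m∈α , m∉z = ∈sep⁻ φ i
          return (inj₁ (∈-≗ˡ (extensional
            (λ x j → run λ k → min x (∈sep⁺ φ (t m m∈α x j) k) j)
            (λ x j → run do
              c ← l x (s x j) m m∈α
              case c of λ where
                (inj₁ p) → return p
                (inj₂ (inj₁ p)) → λ _ → m∉z (∈-≗ˡ p j)
                (inj₂ (inj₂ p)) → λ _ → m∉z (tz x j m p))) m∈α))

    -- The intersection is a transitive subset of both ordinals; were it a member of both, it would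
    -- be a member of itself.
    comparable : ∀ {α β} → K α → K β → Ord K α → Ord K β → ∥ α ∈ β ⊎ α ≗ β ⊎ β ∈ α ∥
    comparable {α} {β} kα kβ oα oβ = do
      let z   = sep (0F ∈̇ 1F) (β ▹ ε₀) α
          kz  = K-sep (0F ∈̇ 1F) (β ▹ ε₀) α (λ { 0F → kβ }) kα
          z⁻  = λ {x} → ∈sep⁻ (0F ∈̇ 1F) {e = β ▹ ε₀} {α} {x}
          tz : Transitive z
          tz  = λ x i y j → let a , b = z⁻ i in
                ∈sep⁺ (0F ∈̇ 1F) (proj₁ oα x a y j) (proj₁ oβ x b y j)
      c ← transitive-subset kα kz oα (λ x i → proj₁ (z⁻ i)) tz
      d ← transitive-subset kβ kz oβ (λ x i → proj₂ (z⁻ i)) tz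
      case c , d of λ where
        (inj₁ p , inj₁ q) → λ _ → ord-irrefl kα oα p (∈sep⁺ (0F ∈̇ 1F) p q)
        (inj₁ p , inj₂ q) → return (inj₂ (inj₂ (∈-≗ˡ q p)))
        (inj₂ p , inj₁ q) → return (inj₁ (∈-≗ˡ p q))
        (inj₂ p , inj₂ q) → return (inj₂ (inj₁ (≗-trans (≗-sym p) q)))

    -- The issue is that `x` is transitive. For a ∈ b ∈ x, linearity leaves besides a ∈ x only the
    -- cycles with a = x or x ∈ a, and then the set of x, a, b has no minimum.
    ord-∈ : ∀ {α x} → K α → Ord K α → x ∈ α → Ord K x
    ord-∈ {α} {x} kα (t , l , w) i =
        (λ b j a k → run (l a (t b (t x i b j) a k) x i >>= λ where
          (inj₁ p) → return p
          (inj₂ c) → λ _ → no-cycle b a j k c))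
      , (λ y j z k → l y (t x i y j) z (t x i z k))
      , (λ u ku s → w u ku (λ y j → t x i y (s y j)))
      where
      no-cycle : ∀ b a → b ∈ x → a ∈ b → a ≗ x ⊎ x ∈ a → R
      no-cycle b a j k c = run do
        let φ   = 0F ≐ 1F ∨̇ 0F ≐ 2F ∨̇ 0F ≐ 3F
            b∈α = t x i b j
            a∈α = t b b∈α a k
            e   = x ▹ a ▹ b ▹ ε₀
            x∈u = ∈sep⁺ φ {e = e} i (∨ˡ ≗-refl)
            a∈u = ∈sep⁺ φ {e = e} a∈α (∨ʳ (∨ˡ ≗-refl))
            b∈u = ∈sep⁺ φ {e = e} b∈α (∨ʳ (∨ʳ ≗-refl))
        m , m∈u , min ← w (sep φ e α)
          (K-sep φ e α (λ { 0F → K-trans i kα ; 1F → K-trans a∈α kα ; 2F → K-trans b∈α kα }) kα)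
          (λ y j → proj₁ (∈sep⁻ φ j)) (return (x , x∈u))
        d ← ∨⁻ (proj₂ (∈sep⁻ φ {e = e} m∈u))
        case d of λ where
          (inj₁ p) → return (min b b∈u (∈-≗ʳ (≗-sym p) j))
          (inj₂ d) → ∨⁻ d >>= λ where
            (inj₂ p) → return (min a a∈u (∈-≗ʳ (≗-sym p) k))
            (inj₁ p) → case c of λ where
              (inj₁ q) → return (min b b∈u (∈-≗ʳ (≗-sym (≗-trans p q)) j))
              (inj₂ q) → return (min x x∈u (∈-≗ʳ (≗-sym p) q))

    omega-unique : ∀ {v w} → K v → K w → Omega K v → Omega K w → v ≗ w
    omega-unique {v} {w} kv kw (lv , nv) (lw , nw) = run do
      c ← comparable kv kw (proj₁ lv) (proj₁ lw)
      case c of λ where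
        (inj₁ p)        → λ _ → nw v p lv
        (inj₂ (inj₁ p)) → return p
        (inj₂ (inj₂ p)) → λ _ → nv w p lw

    -- `succ x` is a transitive subset of the limit. It is not all of it, because the limit has a
    -- member above `x`, which cannot lie in `succ x`.
    limit-succ : ∀ {λ̂ x} → K λ̂ → K (succ x) → Limit K λ̂ → x ∈ λ̂ → succ x ∈ λ̂
    limit-succ {w} {x} kw kx (o , _ , m) i = run do
      c ← transitive-subset kw kx o
        (λ y j → run (∈adj⁻ j >>= λ { (inj₁ k) → return (proj₁ o x i y k) ; (inj₂ p) → return (∈-≗ˡ (≗-sym p) i) }))
        (λ y j z k → run (∈adj⁻ j >>= λ { (inj₁ l) → return (∈adj⁺ˡ (proj₁ (ord-∈ kw o i) y l z k))
                                          ; (inj₂ p) → return (∈adj⁺ˡ (∈-≗ʳ p k)) }))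
      case c of λ where
        (inj₁ p) → return p
        (inj₂ p) → do
          y , j , k ← m x i
          d ← ∈adj⁻ (∈-≗ʳ (≗-sym p) j)
          case d of λ where
            (inj₁ l) → λ _ → ord-irrefl kw o i (proj₁ (ord-∈ kw o i) y l x k)
            (inj₂ q) → λ _ → ord-irrefl kw o i (∈-≗ʳ q k)

  module VO = OrdinalsIn V (λ _ _ → tt) (λ _ _ _ _ _ → tt)

  -- A minimal counterexample is cut out by Δ₀-separation. The later inductions put their claims
  -- into this form by bounding each quantifier by a parameter.
  ord-induction : ∀ {n} {α} (φ : Formula (suc n)) {δ : T (isΔ₀ φ)} (e : Env n) → Ord V α →
    (∀ β → β ∈ α → (∀ γ → γ ∈ β → ⟦ φ ⟧ (γ ▹ e)) → ⟦ φ ⟧ (β ▹ e)) → ∀ β → β ∈ α → ⟦ φ ⟧ (β ▹ e)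
  ord-induction {α = α} φ {δ} e (t , l , w) step β i = run ⦃ stable φ ⦄ λ k →
    w (sep (¬̇ φ) {subst T (sym (∧-true (isΔ₀ φ))) δ} e α) tt (λ x j → proj₁ (∈sep⁻ (¬̇ φ) j)) (return (β , ∈sep⁺ (¬̇ φ) i k))
      λ (m , j , min) → let a , b = ∈sep⁻ (¬̇ φ) j in
        b (step m a λ γ h → run ⦃ stable φ ⦄ λ n → min γ (∈sep⁺ (¬̇ φ) (t m a γ h) n) h)
    where
    ∧-true : ∀ b → (b ∧ true) ≡ b
    ∧-true true  = refl
    ∧-true false = refl

  data OrdCase (β : Carrier) : Set where
    is-empty : β ≗ ∅ → OrdCase β
    is-succ  : ∀ η → η ∈ β → β ≗ succ η → OrdCase β
    is-limit : Limit V β → OrdCase β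

  ord-case : ∀ {β} → Ord V β → ∥ OrdCase β ∥
  -- If β is neither empty nor a limit, some x in β has no member of β above it, and linearity then
  -- makes β the successor of x.
  ord-case {β} o@(t , l , _) k = k (is-empty (empty≗∅ λ y i → k (is-limit (o , return (y , i) , λ x j n →
    k (is-succ x j (extensional
      (λ z h → run (l z h x j >>= λ where
        (inj₁ p) → return (∈adj⁺ˡ p)
        (inj₂ (inj₁ p)) → return (∈-≗ˡ (≗-sym p) ∈adj⁺ʳ)
        (inj₂ (inj₂ p)) → λ _ → n (z , h , p)))
      (λ z h → run (∈adj⁻ h >>= λ { (inj₁ p) → return (t x j z p) ; (inj₂ p) → return (∈-≗ˡ (≗-sym p) j) }))))))))

  -- The set ω and its standard members

  opaque
    ω : Carrier
    ω = proj₁ (witness (IsOmega 0F) ε₀ (bst bst-ω))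

    ω-spec : ⟦ IsOmega 0F ⟧ (ω ▹ ε₀)
    ω-spec = proj₂ (witness (IsOmega 0F) ε₀ (bst bst-ω))

  ω-omega : Omega V ω
  ω-omega = omega⁻ ω-spec

  ω-ord : Ord V ω
  ω-ord = proj₁ (proj₁ ω-omega)

  ω-trans : ∀ {x y} → x ∈ ω → y ∈ x → y ∈ ω
  ω-trans i j = proj₁ ω-ord _ i _ j

  nat-ord : ∀ {x} → x ∈ ω → Ord V x
  nat-ord = VO.ord-∈ tt ω-ord

  succ∈ω : ∀ {x} → x ∈ ω → succ x ∈ ω
  succ∈ω = VO.limit-succ tt tt (proj₁ ω-omega)

  nat-case : ∀ {x} → x ∈ ω → ∥ x ≗ ∅ ⊎ (Σ[ y ∈ Carrier ] y ∈ x × x ≗ succ y) ∥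
  nat-case i = do
    c ← ord-case (nat-ord i)
    case c of λ where
      (is-empty p)    → return (inj₁ p)
      (is-succ y j p) → return (inj₂ (y , j , p))
      (is-limit l)    → λ _ → proj₂ ω-omega _ i l

  ∅∈ω : ∅ ∈ ω
  ∅∈ω = run do
    z , i ← proj₁ (proj₂ (proj₁ ω-omega))
    m , j , min ← proj₂ (proj₂ ω-ord) ω tt (λ _ i → i) (return (z , i))
    return (∈-≗ˡ (empty≗∅ λ y k → min y (ω-trans j k) k) j)

  num∈ω : ∀ k → num k ∈ ω
  num∈ω zero    = ∅∈ω
  num∈ω (suc k) = succ∈ω (num∈ω k)

  num-< : ∀ {i j} → i < j → num i ∈ num j
  num-< {j = suc j} (s≤s l) with m≤n⇒m<n∨m≡n l
  ... | inj₁ h    = ∈adj⁺ˡ (num-< h)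
  ... | inj₂ refl = ∈adj⁺ʳ

  num-≢ : ∀ {i j} → i ≢ j → num i ≗ num j → R
  num-≢ {i} {j} n p with <-cmp i j
  ... | tri< l _ _ = VO.ord-irrefl tt ω-ord (num∈ω i) (∈-≗ʳ (≗-sym p) (num-< l))
  ... | tri> _ _ l = VO.ord-irrefl tt ω-ord (num∈ω j) (∈-≗ʳ p (num-< l))
  ... | tri≈ _ q _ = ⊥-elim (n q)

  -- Members of `ω` may be nonstandard, but below a standard numeral there are only standard ones,
  -- so a case distinction in Agda is possible.
  ∈num⁻ : ∀ k {x} → x ∈ num k → ∥ Σ[ i ∈ ℕ ] i < k × x ≗ num i ∥
  ∈num⁻ zero    i = λ _ → ∉∅ i
  ∈num⁻ (suc k) i = do
    c ← ∈adj⁻ i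
    case c of λ where
      (inj₁ j) → ∈num⁻ k j >>= λ (l , h , p) → return (l , m≤n⇒m≤1+n h , p)
      (inj₂ p) → return (k , ≤-refl , p)

  omega⁺-unique : ∀ {w} → ⟦ IsOmega 0F ⟧ (w ▹ ε₀) → w ≗ ω
  omega⁺-unique h = VO.omega-unique tt tt (omega⁻ h) ω-omega

  isNat⁻ : ∀ {k} → ⟦ IsNat 0F ⟧ (k ▹ ε₀) → k ∈ ω
  isNat⁻ h = run do
    w , h ← ∃⁻ h
    o , i ← ∧⁻ h
    return (∈-≗ʳ (omega⁺-unique o) i)

  isNat⁺ : ∀ {k} → k ∈ ω → ⟦ IsNat 0F ⟧ (k ▹ ε₀)
  isNat⁺ i = ∃⁺ ω (∧⁺ ω-spec i)

  opaque
    unfolding node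

    node-injective : ∀ {k l a b a′ b′} → node k a b ≗ node l a′ b′ → num k ≗ num l × a ≗ a′ × b ≗ b′
    node-injective p = let q , r = pair-injective p in q , pair-injective r

  -- Functions

  Fun : Carrier → Carrier → Carrier → Set
  Fun f d y =
    (∀ p → p ∈ f → ∥ Σ[ x ∈ Carrier ] Σ[ v ∈ Carrier ] x ∈ d × v ∈ y × p ≗ pair x v ∥) ×
    (∀ x → x ∈ d → ∥ Σ[ v ∈ Carrier ] v ∈ y × pair x v ∈ f × (∀ v′ → pair x v′ ∈ f → v′ ≗ v) ∥)

  FunOn : Carrier → Carrier → Set
  FunOn f d =
    (∀ p → p ∈ f → ∥ Σ[ x ∈ Carrier ] Σ[ v ∈ Carrier ] x ∈ d × p ≗ pair x v ∥) ×
    (∀ x → x ∈ d → ∥ Σ[ v ∈ Carrier ] pair x v ∈ f × (∀ v′ → pair x v′ ∈ f → v′ ≗ v) ∥)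

  fun⇒funOn : ∀ {f d y} → Fun f d y → FunOn f d
  fun⇒funOn (a , b) =
    (λ p i → a p i >>= λ (x , v , j , _ , q) → return (x , v , j , q)) ,
    (λ x i → b x i >>= λ (v , _ , j , u) → return (v , j , u))

  funOn-domain : ∀ {f d x v} → FunOn f d → pair x v ∈ f → x ∈ d
  funOn-domain (a , _) i = run do
    x′ , v′ , j , p ← a _ i
    return (∈-≗ˡ (≗-sym (proj₁ (pair-injective p))) j)

  funOn-unique : ∀ {f d x v w} → FunOn f d → pair x v ∈ f → pair x w ∈ f → v ≗ w
  funOn-unique F@(_ , b) i j = run do
    u , _ , h ← b _ (funOn-domain F i)
    return (≗-trans (h _ i) (≗-sym (h _ j)))

  fun-codomain : ∀ {f d y x v} → Fun f d y → pair x v ∈ f → v ∈ y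
  fun-codomain (a , _) i = run do
    x′ , v′ , _ , j , p ← a _ i
    return (∈-≗ˡ (≗-sym (proj₂ (pair-injective p))) j)

  fun⁻ : ∀ {f d y} → ⟦ IsFun 0F 1F 2F ⟧ (f ▹ d ▹ y ▹ ε₀) → Fun f d y
  fun⁻ {f} {d} {y} h = run do
    a , b ← ∧⁻ h
    let A = λ p i → do
          x , j , h ← ∃∈⁻ (a p i)
          v , k , h ← ∃∈⁻ h
          return (x , v , j , k , opair⁻ h)
    return (A , λ x i → do
      v , j , h ← ∃∈⁻ (b x i)
      return (v , j , at⁻ (run (∧⁻ (h v j) >>= λ (_ , g) → return (g ≗-refl))) , λ v′ k → run do
        x″ , v″ , _ , l , p ← A _ k
        let v′∈y = ∈-≗ˡ (≗-sym (proj₂ (pair-injective p))) l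
        g , _ ← ∧⁻ (h v′ v′∈y)
        return (g (at⁺ k))))

  fun⁺ : ∀ {f d y} → Fun f d y → ⟦ IsFun 0F 1F 2F ⟧ (f ▹ d ▹ y ▹ ε₀)
  fun⁺ (a , b) = ∧⁺
    (λ p i k → a p i λ (x , v , j , l , q) → k x j λ n → n v l (opair⁺ q))
    (λ x i k → b x i λ (v , j , l , u) → k v j λ v′ m →
      ∧⁺ (λ h → u v′ (at⁻ h)) (λ q → at⁺ (pair∈-cong ≗-refl (≗-sym q) l)))

  funOn⁻ : ∀ {f d} → ⟦ IsFunOn 0F 1F ⟧ (f ▹ d ▹ ε₀) → FunOn f d
  funOn⁻ h = run do
    a , b ← ∧⁻ h
    return ((λ p i → do
        x , j , h ← ∃∈⁻ (a p i)
        v , h ← ∃⁻ h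
        return (x , v , j , opair⁻ h)) , λ x i → do
      v , h ← ∃⁻ (b x i)
      return (v , at⁻ (run (∧⁻ (h v) >>= λ (_ , g) → return (g ≗-refl))) , λ v′ k → run do
        g , _ ← ∧⁻ (h v′)
        return (g (at⁺ k))))

  funOn⁺ : ∀ {f d} → FunOn f d → ⟦ IsFunOn 0F 1F ⟧ (f ▹ d ▹ ε₀)
  funOn⁺ (a , b) = ∧⁺
    (λ p i k → a p i λ (x , v , j , q) → k x j λ n → n v (opair⁺ q))
    (λ x i k → b x i λ (v , l , u) → k v λ v′ →
      ∧⁺ (λ h → u v′ (at⁻ h)) (λ q → at⁺ (pair∈-cong ≗-refl (≗-sym q) l)))

  Update : (k y t′ t i x : Carrier) → Set
  Update k y t′ t i x = Fun t′ k y × pair i x ∈ t′ ×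
    (∀ a → a ∈ k → (a ≗ i → R) → ∀ v → v ∈ y → pair a v ∈ t → pair a v ∈ t′)

  update⁻ : ∀ {k y t′ t i x} → ⟦ IsUpdate 0F 1F 2F 3F 4F 5F ⟧ (k ▹ y ▹ t′ ▹ t ▹ i ▹ x ▹ ε₀) → Update k y t′ t i x
  update⁻ h = run do
    f , h ← ∧⁻ h
    p , h ← ∧⁻ h
    return (fun⁻ f , at⁻ p , λ a j n v l m → at⁻ (h a j n v l (at⁺ m)))

  update⁺ : ∀ {k y t′ t i x} → Update k y t′ t i x → ⟦ IsUpdate 0F 1F 2F 3F 4F 5F ⟧ (k ▹ y ▹ t′ ▹ t ▹ i ▹ x ▹ ε₀)
  update⁺ (f , p , h) = ∧⁺ (fun⁺ f) (∧⁺ (at⁺ p) λ a j n v l m → at⁺ (h a j n v l (at⁻ m)))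

  update-exists : ∀ {k y t i x} → Fun t k y → i ∈ k → x ∈ y → ∥ Σ[ t′ ∈ Carrier ] Update k y t′ t i x ∥
  update-exists {k} {y} {t} {i} {x} (a , b) i∈k x∈y = return (t′ , (A , B) , ∈adj⁺ʳ ,
      λ c j n v l m → ∈adj⁺ˡ (∈sep⁺ φ m (λ w w∈y q → n (proj₁ (pair-injective (opair⁻ q))))))
    where
    φ : Formula 3
    -- Keeps the entries of `t` at places other than `i`; bounding the second component by `y` makes
    -- the formula Δ₀.
    φ = ∀∈ 2F (¬̇ (IsOPair 1F 2F 0F))
    t₀ t′ : Carrier
    t₀ = sep φ (i ▹ y ▹ ε₀) t
    t′ = adj t₀ (pair i x)
    A : ∀ p → p ∈ t′ → _
    A p j = do
      c ← ∈adj⁻ j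
      case c of λ where
        (inj₁ j) → a p (proj₁ (∈sep⁻ φ j))
        (inj₂ q) → return (i , x , i∈k , x∈y , q)
    other : ∀ c v → pair c v ∈ t′ → ∥ (pair c v ∈ t × (c ≗ i → R)) ⊎ (c ≗ i × v ≗ x) ∥
    other c v j = do
      d ← ∈adj⁻ j
      case d of λ where
        (inj₁ j) → do
          let l , n = ∈sep⁻ φ {e = i ▹ y ▹ ε₀} j
          _ , v′ , _ , v′∈y , r ← a _ l
          let v∈y = ∈-≗ˡ (≗-sym (proj₂ (pair-injective r))) v′∈y
          return (inj₁ (l , λ q → n v v∈y (opair⁺ (pair-cong q ≗-refl))))
        (inj₂ q) → return (inj₂ (pair-injective q))
    B : ∀ c → c ∈ k → _
    B c c∈k = em {c ≗ i} >>= λ where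
      (inj₁ p) → return (x , x∈y , pair∈-cong (≗-sym p) ≗-refl ∈adj⁺ʳ , λ v′ j → run (other c v′ j >>= λ where
        (inj₁ (_ , n)) → λ _ → n p
        (inj₂ (_ , q)) → return q))
      (inj₂ n) → do
        v , v∈y , j , u ← b c c∈k
        return (v , v∈y , ∈adj⁺ˡ (∈sep⁺ φ j (λ w _ q → n (proj₁ (pair-injective (opair⁻ q))))) ,
          λ v′ j → run (other c v′ j >>= λ where
            (inj₁ (l , _)) → return (u v′ l)
            (inj₂ (q , _)) → λ _ → n q))

  -- Formation sequences

  data Step (N g m c : Carrier) : Set where
    step-mem : ∀ i j → i ∈ N → j ∈ N → c ≗ node 0 i j → Step N g m c
    step-eq  : ∀ i j → i ∈ N → j ∈ N → c ≗ node 1 i j → Step N g m c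
    step-bot : c ≗ node 2 ∅ ∅ → Step N g m c
    step-imp : ∀ a b l l′ → l ∈ m → pair l a ∈ g → l′ ∈ m → pair l′ b ∈ g → c ≗ node 3 a b → Step N g m c
    step-all : ∀ i b l → i ∈ N → l ∈ m → pair l b ∈ g → c ≗ node 4 i b → Step N g m c

  step-cong : ∀ {N g m c c′} → c ≗ c′ → Step N g m c′ → Step N g m c
  step-cong p (step-mem i j x y q) = step-mem i j x y (≗-trans p q)
  step-cong p (step-eq i j x y q)  = step-eq i j x y (≗-trans p q)
  step-cong p (step-bot q)         = step-bot (≗-trans p q)
  step-cong p (step-imp a b l l′ x y z w q) = step-imp a b l l′ x y z w (≗-trans p q)
  step-cong p (step-all i b l x y z q)      = step-all i b l x y z (≗-trans p q)

  step⁻ : ∀ {n} {e : Env n} (N g m c : Fin n) → ⟦ FormationStep N g m c ⟧ e → ∥ Step (e N) (e g) (e m) (e c) ∥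
  step⁻ {e = e} N g m c h = ∨⁻ h >>= λ where
    (inj₁ h) → do
      i , x , h ← ∃∈⁻ h
      j , y , h ← ∃∈⁻ h
      return (step-mem i j x y (node⁻ {e = j ▹ i ▹ e} 0 (2 ↑ʳ c) 1F 0F h))
    (inj₂ h) → ∨⁻ h >>= λ where
      (inj₁ h) → do
        i , x , h ← ∃∈⁻ h
        j , y , h ← ∃∈⁻ h
        return (step-eq i j x y (node⁻ {e = j ▹ i ▹ e} 1 (2 ↑ʳ c) 1F 0F h))
      (inj₂ h) → ∨⁻ h >>= λ where
        (inj₁ h) → return (step-bot (botCode⁻ {e = e} c h))
        (inj₂ h) → ∨⁻ h >>= λ where
          (inj₁ h) → do
            a , h ← ∃⁻ h
            b , h ← ∃⁻ h
            x , h ← ∧⁻ h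
            y , h ← ∧⁻ h
            l , u , x ← ∃∈⁻ x
            l′ , v , y ← ∃∈⁻ y
            return (step-imp a b l l′ u (at⁻ x) v (at⁻ y) (node⁻ {e = b ▹ a ▹ e} 3 (2 ↑ʳ c) 1F 0F h))
          (inj₂ h) → do
            i , x , h ← ∃∈⁻ h
            b , h ← ∃⁻ h
            y , h ← ∧⁻ h
            l , v , y ← ∃∈⁻ y
            return (step-all i b l x v (at⁻ y) (node⁻ {e = b ▹ i ▹ e} 4 (2 ↑ʳ c) 1F 0F h))

  private
    inj : ∀ {n} {φ ψ : Formula n} {e : Env n} → ∥ ⟦ φ ⟧ e ⊎ ⟦ ψ ⟧ e ∥ → ⟦ φ ∨̇ ψ ⟧ e
    inj {ψ = ψ} h = ∨⁺ ⦃ stable ψ ⦄ h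

  step⁺ : ∀ {n} {e : Env n} (N g m c : Fin n) → Step (e N) (e g) (e m) (e c) → ⟦ FormationStep N g m c ⟧ e
  step⁺ {n} {e} N g m c = λ where
      (step-mem i j x y p) → inj {n} {φ₀} {φ₁ ∨̇ φ₂ ∨̇ φ₃ ∨̇ φ₄} {e} (return (inj₁
        (∃∈⁺ i x (∃∈⁺ j y (node⁺ {e = j ▹ i ▹ e} 0 (2 ↑ʳ c) 1F 0F p)))))
      (step-eq i j x y p) → ∨ʳ (inj {n} {φ₁} {φ₂ ∨̇ φ₃ ∨̇ φ₄} {e} (return (inj₁
        (∃∈⁺ i x (∃∈⁺ j y (node⁺ {e = j ▹ i ▹ e} 1 (2 ↑ʳ c) 1F 0F p))))))
      (step-bot p) → ∨ʳ (∨ʳ (inj {n} {φ₂} {φ₃ ∨̇ φ₄} {e} (return (inj₁ (botCode⁺ {e = e} c p)))))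
      (step-imp a b l l′ u x v y p) → ∨ʳ (∨ʳ (∨ʳ (inj {n} {φ₃} {φ₄} {e} (return (inj₁
        (∃⁺ a (∃⁺ b (∧⁺ (∃∈⁺ l u (at⁺ x)) (∧⁺ (∃∈⁺ l′ v (at⁺ y)) (node⁺ {e = b ▹ a ▹ e} 3 (2 ↑ʳ c) 1F 0F p))))))))))
      (step-all i b l x v y p) → ∨ʳ (∨ʳ (∨ʳ (∨ʳ
        (∃∈⁺ i x (∃⁺ b (∧⁺ (∃∈⁺ l v (at⁺ y)) (node⁺ {e = b ▹ i ▹ e} 4 (2 ↑ʳ c) 1F 0F p)))))))
    where
    φ₀ φ₁ φ₂ φ₃ φ₄ : Formula n
    φ₀ = ∃∈ N (∃∈ (suc N) (IsMemCode (2 ↑ʳ c) 1F 0F))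
    φ₁ = ∃∈ N (∃∈ (suc N) (IsEqCode (2 ↑ʳ c) 1F 0F))
    φ₂ = IsBotCode c
    φ₃ = ∃̇ (∃̇ (Earlier (2 ↑ʳ g) (2 ↑ʳ m) 1F ∧̇ Earlier (2 ↑ʳ g) (2 ↑ʳ m) 0F ∧̇ IsImpCode (2 ↑ʳ c) 1F 0F))
    φ₄ = ∃∈ N (∃̇ (Earlier (2 ↑ʳ g) (2 ↑ʳ m) 0F ∧̇ IsAllCode (2 ↑ʳ c) 1F 0F))

  Formation : (N g n : Carrier) → Set
  Formation N g n = n ∈ ω × FunOn g n × (∀ m → m ∈ n → ∥ Σ[ c ∈ Carrier ] pair m c ∈ g × Step N g m c ∥)

  formation⁻ : ∀ {n} {e : Env n} (N g : Fin n) → ⟦ IsFormation N g ⟧ e → ∥ Σ Carrier (Formation (e N) (e g)) ∥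
  formation⁻ {e = e} N g h = do
      n , h ← ∃⁻ h
      o , h ← ∧⁻ h
      f , h ← ∧⁻ h
      return {Σ Carrier (Formation (e N) (e g))} (n , isNat⁻ {n} o , funOn⁻ {e g} {n} f , steps n h)
    where
    steps : ∀ n → ⟦ ∀∈ 0F (∃̇ (⟨ 1F , 0F ⟩∈̇ (3 ↑ʳ g) ∧̇ FormationStep (3 ↑ʳ N) (3 ↑ʳ g) 1F 0F)) ⟧ (n ▹ e) →
            ∀ m → m ∈ n → ∥ Σ[ c ∈ Carrier ] pair m c ∈ e g × Step (e N) (e g) m c ∥
    steps n h m i = do
      c , h ← ∃⁻ (h m i)
      x , h ← ∧⁻ h
      s ← step⁻ {e = c ▹ m ▹ n ▹ e} (3 ↑ʳ N) (3 ↑ʳ g) 1F 0F h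
      return (c , at⁻ {e g} {m} {c} x , s)

  formation⁺ : ∀ {n} {e : Env n} (N g : Fin n) {l} → Formation (e N) (e g) l → ⟦ IsFormation N g ⟧ e
  formation⁺ {e = e} N g {n} (o , f , h) = ∃⁺ n (∧⁺ (isNat⁺ o) (∧⁺ (funOn⁺ f)
    (λ m i k → h m i λ (c , x , s) → k c (∧⁺ (at⁺ x) (step⁺ {e = c ▹ m ▹ n ▹ e} (3 ↑ʳ N) (3 ↑ʳ g) 1F 0F s)))))

  Range : Carrier → Carrier → Set
  Range g c = ∥ Σ[ m ∈ Carrier ] pair m c ∈ g ∥

  range⁻ : ∀ {g c} → ⟦ InRange 0F 1F ⟧ (g ▹ c ▹ ε₀) → Range g c
  range⁻ h = ∃⁻ h >>= λ (m , h) → return (m , at⁻ h)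

  range⁺ : ∀ {g c} → Range g c → ⟦ InRange 0F 1F ⟧ (g ▹ c ▹ ε₀)
  range⁺ h k = h λ (m , i) → k m (at⁺ i)

  formation-step : ∀ {N g n m c} → Formation N g n → pair m c ∈ g → ∥ Step N g m c ∥
  formation-step (_ , f , h) i = do
    c′ , j , s ← h _ (funOn-domain f i)
    return (step-cong (funOn-unique f i j) s)

  tag-clash : ∀ {A : Set} {c k l a b a′ b′} → k ≢ l → c ≗ node k a b → c ≗ node l a′ b′ → ∥ A ∥
  tag-clash n p q _ = num-≢ n (proj₁ (node-injective (≗-trans (≗-sym p) q)))

  -- Unique readability: the tag of the code excludes the other formation steps. The inversions of
  -- this kind show that the range of a formation sequence is closed under immediate subformulas.
  range-mem : ∀ {N g n c i j} → Formation N g n → Range g c → c ≗ node 0 i j → i ∈ N × j ∈ N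
  range-mem F r p = run do
    m , k ← r
    s ← formation-step F k
    case s of λ where
      (step-mem i j x y q) → let _ , r , s = node-injective (≗-trans (≗-sym q) p) in return (∈-≗ˡ r x , ∈-≗ˡ s y)
      (step-eq _ _ _ _ q) → tag-clash (λ ()) p q
      (step-bot q) → tag-clash (λ ()) p q
      (step-imp _ _ _ _ _ _ _ _ q) → tag-clash (λ ()) p q
      (step-all _ _ _ _ _ _ q) → tag-clash (λ ()) p q

  range-eq : ∀ {N g n c i j} → Formation N g n → Range g c → c ≗ node 1 i j → i ∈ N × j ∈ N
  range-eq F r p = run do
    m , k ← r
    s ← formation-step F k
    case s of λ where
      (step-eq i j x y q) → let _ , r , s = node-injective (≗-trans (≗-sym q) p) in return (∈-≗ˡ r x , ∈-≗ˡ s y)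
      (step-mem _ _ _ _ q) → tag-clash (λ ()) p q
      (step-bot q) → tag-clash (λ ()) p q
      (step-imp _ _ _ _ _ _ _ _ q) → tag-clash (λ ()) p q
      (step-all _ _ _ _ _ _ q) → tag-clash (λ ()) p q

  range-imp : ∀ {N g n c a b} → Formation N g n → Range g c → c ≗ node 3 a b → Range g a × Range g b
  range-imp F r p = run do
    m , k ← r
    s ← formation-step F k
    case s of λ where
      (step-imp a b l l′ _ x _ y q) → let _ , r , s = node-injective (≗-trans (≗-sym q) p) in
        return (return (l , pair∈-cong ≗-refl r x) , return (l′ , pair∈-cong ≗-refl s y))
      (step-mem _ _ _ _ q) → tag-clash (λ ()) p q
      (step-eq _ _ _ _ q) → tag-clash (λ ()) p q
      (step-bot q) → tag-clash (λ ()) p q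
      (step-all _ _ _ _ _ _ q) → tag-clash (λ ()) p q

  range-all : ∀ {N g n c i b} → Formation N g n → Range g c → c ≗ node 4 i b → i ∈ N × Range g b
  range-all F r p = run do
    m , k ← r
    s ← formation-step F k
    case s of λ where
      (step-all i b l x _ y q) → let _ , r , s = node-injective (≗-trans (≗-sym q) p) in
        return (∈-≗ˡ r x , return (l , pair∈-cong ≗-refl s y))
      (step-mem _ _ _ _ q) → tag-clash (λ ()) p q
      (step-eq _ _ _ _ q) → tag-clash (λ ()) p q
      (step-bot q) → tag-clash (λ ()) p q
      (step-imp _ _ _ _ _ _ _ _ q) → tag-clash (λ ()) p q

  -- Satisfaction

  Tarski : (k y S c t : Carrier) → Set
  Tarski k y S c t =
    (∀ i j → c ≗ node 0 i j →
      pair c t ∈ S ↔ ∥ Σ[ u ∈ Carrier ] Σ[ v ∈ Carrier ] pair i u ∈ t × pair j v ∈ t × u ∈ v ∥) ×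
    (∀ i j → c ≗ node 1 i j →
      pair c t ∈ S ↔ ∥ Σ[ u ∈ Carrier ] Σ[ v ∈ Carrier ] pair i u ∈ t × pair j v ∈ t × u ≗ v ∥) ×
    (c ≗ node 2 ∅ ∅ → pair c t ∈ S → R) ×
    (∀ a b → c ≗ node 3 a b → pair c t ∈ S ↔ (pair a t ∈ S → pair b t ∈ S)) ×
    (∀ i b → c ≗ node 4 i b →
      pair c t ∈ S ↔ (∀ x → x ∈ y → ∀ t′ → Update k y t′ t i x → pair b t′ ∈ S))

  tarski⁻ : ∀ {n} {e : Env n} (k y S c t : Fin n) → ⟦ TarskiAt k y S c t ⟧ e → Tarski (e k) (e y) (e S) (e c) (e t)
  tarski⁻ {e = e} k y S c t h = run do
    h₀ , h ← ∧⁻ h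
    h₁ , h ← ∧⁻ h
    h₂ , h ← ∧⁻ h
    h₃ , h₄ ← ∧⁻ h
    return {Tarski (e k) (e y) (e S) (e c) (e t)} (
      (λ i j p → let f , g = ⇔⁻ (h₀ i j (node⁺ {e = j ▹ i ▹ e} 0 (2 ↑ʳ c) 1F 0F p)) in
        (λ x → do
          u , q ← ∃⁻ (f (at⁺ x))
          v , q ← ∃⁻ q
          a , q ← ∧⁻ q
          b , q ← ∧⁻ q
          return (u , v , at⁻ a , at⁻ b , q)) ,
        (λ x → at⁻ (g λ n → x λ (u , v , a , b , q) → n u λ n → n v (∧⁺ (at⁺ a) (∧⁺ (at⁺ b) q))))) ,
      (λ i j p → let f , g = ⇔⁻ (h₁ i j (node⁺ {e = j ▹ i ▹ e} 1 (2 ↑ʳ c) 1F 0F p)) in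
        (λ x → do
          u , q ← ∃⁻ (f (at⁺ x))
          v , q ← ∃⁻ q
          a , q ← ∧⁻ q
          b , q ← ∧⁻ q
          return (u , v , at⁻ a , at⁻ b , q)) ,
        (λ x → at⁻ (g λ n → x λ (u , v , a , b , q) → n u λ n → n v (∧⁺ (at⁺ a) (∧⁺ (at⁺ b) q))))) ,
      (λ p x → h₂ (botCode⁺ {e = e} c p) (at⁺ x)) ,
      (λ a b p → let f , g = ⇔⁻ (h₃ a b (node⁺ {e = b ▹ a ▹ e} 3 (2 ↑ʳ c) 1F 0F p)) in
        (λ x y → at⁻ (f (at⁺ x) (at⁺ y))) , (λ x → at⁻ (g λ z → at⁺ (x (at⁻ z))))) ,
      (λ i b p → let f , g = ⇔⁻ (h₄ i b (node⁺ {e = b ▹ i ▹ e} 4 (2 ↑ʳ c) 1F 0F p)) in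
        (λ x z j t′ u → at⁻ (f (at⁺ x) z j t′ (update⁺ u))) ,
        (λ x → at⁻ (g λ z j t′ u → at⁺ (x z j t′ (update⁻ u))))))

  tarski⁺ : ∀ {n} {e : Env n} (k y S c t : Fin n) → Tarski (e k) (e y) (e S) (e c) (e t) → ⟦ TarskiAt k y S c t ⟧ e
  tarski⁺ {e = e} k y S c t (h₀ , h₁ , h₂ , h₃ , h₄) =
    ∧⁺ (λ i j p → let f , g = h₀ i j (node⁻ {e = j ▹ i ▹ e} 0 (2 ↑ʳ c) 1F 0F p) in
         ∧⁺ (λ x n → f (at⁻ x) λ (u , v , a , b , q) → n u λ n → n v (∧⁺ (at⁺ a) (∧⁺ (at⁺ b) q)))
            (λ x → at⁺ (g (do
              u , q ← ∃⁻ x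
              v , q ← ∃⁻ q
              a , q ← ∧⁻ q
              b , q ← ∧⁻ q
              return (u , v , at⁻ a , at⁻ b , q)))))
    (∧⁺ (λ i j p → let f , g = h₁ i j (node⁻ {e = j ▹ i ▹ e} 1 (2 ↑ʳ c) 1F 0F p) in
         ∧⁺ (λ x n → f (at⁻ x) λ (u , v , a , b , q) → n u λ n → n v (∧⁺ (at⁺ a) (∧⁺ (at⁺ b) q)))
            (λ x → at⁺ (g (do
              u , q ← ∃⁻ x
              v , q ← ∃⁻ q
              a , q ← ∧⁻ q
              b , q ← ∧⁻ q
              return (u , v , at⁻ a , at⁻ b , q)))))
    (∧⁺ (λ p x → h₂ (botCode⁻ {e = e} c p) (at⁻ x))
    (∧⁺ (λ a b p → let f , g = h₃ a b (node⁻ {e = b ▹ a ▹ e} 3 (2 ↑ʳ c) 1F 0F p) in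
         ∧⁺ (λ x y → at⁺ (f (at⁻ x) (at⁻ y))) (λ x → at⁺ (g λ z → at⁻ (x (at⁺ z)))))
        (λ i b p → let f , g = h₄ i b (node⁻ {e = b ▹ i ▹ e} 4 (2 ↑ʳ c) 1F 0F p) in
         ∧⁺ (λ x z j t′ u → at⁺ (f (at⁻ x) z j t′ (update⁻ u)))
            (λ x → at⁺ (g λ z j t′ u → at⁻ (x z j t′ (update⁺ u))))))))

  Satisfaction : (k y g S : Carrier) → Set
  Satisfaction k y g S = ∀ c → Range g c → ∀ t → Fun t k y → Tarski k y S c t

  SatWitness : (k y s c : Carrier) → Set
  SatWitness k y s c = Σ[ g ∈ Carrier ] Σ[ n ∈ Carrier ] Σ[ S ∈ Carrier ]
    Formation k g n × Range g c × Satisfaction k y g S × pair c s ∈ S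

  Satisfied : (k y s c : Carrier) → Set
  Satisfied k y s c = k ∈ ω × Fun s k y × ∥ SatWitness k y s c ∥

  satisfaction⁻ : ∀ {n} {e : Env n} (k y g S : Fin n) →
    ⟦ ∀̇ (InRange (suc g) 0F ⇒ ∀̇ (IsFun 0F (2 ↑ʳ k) (2 ↑ʳ y) ⇒ TarskiAt (2 ↑ʳ k) (2 ↑ʳ y) (2 ↑ʳ S) 1F 0F)) ⟧ e →
    Satisfaction (e k) (e y) (e g) (e S)
  satisfaction⁻ {e = e} k y g S T c j t f = tarski⁻ {e = t ▹ c ▹ e} (2 ↑ʳ k) (2 ↑ʳ y) (2 ↑ʳ S) 1F 0F
    (T c (range⁺ {e g} {c} j) t (fun⁺ {t} {e k} {e y} f))

  satisfaction⁺ : ∀ {n} {e : Env n} (k y g S : Fin n) → Satisfaction (e k) (e y) (e g) (e S) →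
    ⟦ ∀̇ (InRange (suc g) 0F ⇒ ∀̇ (IsFun 0F (2 ↑ʳ k) (2 ↑ʳ y) ⇒ TarskiAt (2 ↑ʳ k) (2 ↑ʳ y) (2 ↑ʳ S) 1F 0F)) ⟧ e
  satisfaction⁺ {e = e} k y g S T c j t f = tarski⁺ {e = t ▹ c ▹ e} (2 ↑ʳ k) (2 ↑ʳ y) (2 ↑ʳ S) 1F 0F
    (T c (range⁻ {e g} {c} j) t (fun⁻ {t} {e k} {e y} f))

  sat⁻ : ∀ {n} {e : Env n} (k y s c : Fin n) → ⟦ Sat k y s c ⟧ e → Satisfied (e k) (e y) (e s) (e c)
  sat⁻ {e = e} k y s c h = run do
      o , h ← ∧⁻ h
      f , h ← ∧⁻ h
      return {Satisfied (e k) (e y) (e s) (e c)} (isNat⁻ {e k} o , fun⁻ {e s} {e k} {e y} f , witnesses h)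
    where
    witnesses : ⟦ ∃̇ (IsFormation (suc k) 0F ∧̇ InRange 0F (suc c) ∧̇
       ∃̇ (∀̇ (InRange 2F 0F ⇒ ∀̇ (IsFun 0F (4 ↑ʳ k) (4 ↑ʳ y) ⇒ TarskiAt (4 ↑ʳ k) (4 ↑ʳ y) 2F 1F 0F)) ∧̇
          ⟨ 2 ↑ʳ c , 2 ↑ʳ s ⟩∈̇ 0F)) ⟧ e → ∥ SatWitness (e k) (e y) (e s) (e c) ∥
    witnesses h = do
      g , h ← ∃⁻ h
      F , h ← ∧⁻ h
      r , h ← ∧⁻ h
      S , h ← ∃⁻ h
      T , i ← ∧⁻ h
      n , F ← formation⁻ {e = g ▹ e} (suc k) 0F F
      return {SatWitness (e k) (e y) (e s) (e c)} (g , n , S , F , range⁻ {g} {e c} r , satisfaction⁻ {e = S ▹ g ▹ e} (2 ↑ʳ k) (2 ↑ʳ y) 1F 0F T , at⁻ {S} {e c} {e s} i)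

  sat⁺ : ∀ {n} {e : Env n} (k y s c : Fin n) → Satisfied (e k) (e y) (e s) (e c) → ⟦ Sat k y s c ⟧ e
  sat⁺ {e = e} k y s c (o , f , h) = ∧⁺ (isNat⁺ {e k} o) (∧⁺ (fun⁺ {e s} {e k} {e y} f) λ k′ → h λ (g , n , S , F , r , T , i) →
    k′ g (∧⁺ (formation⁺ {e = g ▹ e} (suc k) 0F F) (∧⁺ (range⁺ {g} {e c} r) (∃⁺ S
      (∧⁺ (satisfaction⁺ {e = S ▹ g ▹ e} (2 ↑ʳ k) (2 ↑ʳ y) 1F 0F T) (at⁺ {S} {e c} {e s} i))))))

  IsForm′ : Carrier → Carrier → Set
  IsForm′ N c = Σ[ g ∈ Carrier ] Σ[ n ∈ Carrier ] Formation N g n × Range g c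

  form⁻ : ∀ {n} {e : Env n} (N c : Fin n) → ⟦ IsForm N c ⟧ e → ∥ IsForm′ (e N) (e c) ∥
  form⁻ {e = e} N c h = do
    g , h ← ∃⁻ h
    F , r ← ∧⁻ h
    n , F ← formation⁻ {e = g ▹ e} (suc N) 0F F
    return (g , n , F , range⁻ r)

  form⁺ : ∀ {n} {e : Env n} (N c : Fin n) → IsForm′ (e N) (e c) → ⟦ IsForm N c ⟧ e
  form⁺ {e = e} N c (g , n , F , r) = ∃⁺ g (∧⁺ (formation⁺ {e = g ▹ e} (suc N) 0F F) (range⁺ r))

  -- Codes of concrete formulas as sets

  code : ∀ {h} → (Fin h → Carrier) → Named h → Carrier
  code χ (mem i j)  = node 0 (num i) (num j)
  code χ (eq i j)   = node 1 (num i) (num j)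
  code χ bot        = node 2 ∅ ∅
  code χ (φ imp ψ)  = node 3 (code χ φ) (code χ ψ)
  code χ (all i φ)  = node 4 (num i) (code χ φ)
  code χ (letter l) = χ l

  code₀ : Named 0 → Carrier
  code₀ = code ε₀

  code-cong : ∀ {h} {χ χ′ : Fin h → Carrier} → (∀ l → χ l ≗ χ′ l) → ∀ φ → code χ φ ≗ code χ′ φ
  code-cong h (mem i j)  = ≗-refl
  code-cong h (eq i j)   = ≗-refl
  code-cong h bot        = ≗-refl
  code-cong h (φ imp ψ)  = node-cong 3 (code-cong h φ) (code-cong h ψ)
  code-cong h (all i φ)  = node-cong 4 ≗-refl (code-cong h φ)
  code-cong h (letter l) = h l

  code-plug : ∀ χ φ → code (λ _ → code₀ χ) φ ≡ code₀ (plug φ χ)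
  code-plug χ (mem i j)  = refl
  code-plug χ (eq i j)   = refl
  code-plug χ bot        = refl
  code-plug χ (φ imp ψ)  = cong₂ (node 3) (code-plug χ φ) (code-plug χ ψ)
  code-plug χ (all i φ)  = cong (node 4 (num i)) (code-plug χ φ)
  code-plug χ (letter _) = refl

  isCode⁻ : ∀ {h n} {e : Env n} (φ : Named h) (χ : Fin h → Fin n) c → ⟦ IsCode φ χ c ⟧ e → e c ≗ code (e ∘ χ) φ
  isCode⁻ {e = e} (mem i j) χ c h = run do
    a , h ← ∃⁻ h
    b , h ← ∃⁻ h
    p , h ← ∧⁻ h
    q , h ← ∧⁻ h
    return (≗-trans (node⁻ {e = b ▹ a ▹ e} 0 (2 ↑ʳ c) 1F 0F h)
      (node-cong 0 (numeral⁻ {e = b ▹ a ▹ e} i 1F p) (numeral⁻ {e = b ▹ a ▹ e} j 0F q)))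
  isCode⁻ {e = e} (eq i j) χ c h = run do
    a , h ← ∃⁻ h
    b , h ← ∃⁻ h
    p , h ← ∧⁻ h
    q , h ← ∧⁻ h
    return (≗-trans (node⁻ {e = b ▹ a ▹ e} 1 (2 ↑ʳ c) 1F 0F h)
      (node-cong 1 (numeral⁻ {e = b ▹ a ▹ e} i 1F p) (numeral⁻ {e = b ▹ a ▹ e} j 0F q)))
  isCode⁻ {e = e} bot χ c h = botCode⁻ {e = e} c h
  isCode⁻ {e = e} (φ imp ψ) χ c h = run do
    a , h ← ∃⁻ h
    b , h ← ∃⁻ h
    p , h ← ∧⁻ h
    q , h ← ∧⁻ h
    return (≗-trans (node⁻ {e = b ▹ a ▹ e} 3 (2 ↑ʳ c) 1F 0F h)
      (node-cong 3 (isCode⁻ {e = b ▹ a ▹ e} φ (λ l → 2 ↑ʳ χ l) 1F p) (isCode⁻ {e = b ▹ a ▹ e} ψ (λ l → 2 ↑ʳ χ l) 0F q)))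
  isCode⁻ {e = e} (all i φ) χ c h = run do
    a , h ← ∃⁻ h
    b , h ← ∃⁻ h
    p , h ← ∧⁻ h
    q , h ← ∧⁻ h
    return (≗-trans (node⁻ {e = b ▹ a ▹ e} 4 (2 ↑ʳ c) 1F 0F h)
      (node-cong 4 (numeral⁻ {e = b ▹ a ▹ e} i 1F p) (isCode⁻ {e = b ▹ a ▹ e} φ (λ l → 2 ↑ʳ χ l) 0F q)))
  isCode⁻ (letter l) χ c h = h

  isCode⁺ : ∀ {h n} {e : Env n} (φ : Named h) (χ : Fin h → Fin n) c → e c ≗ code (e ∘ χ) φ → ⟦ IsCode φ χ c ⟧ e
  isCode⁺ {e = e} (mem i j) χ c h = ∃⁺ (num i) (∃⁺ (num j)
    (∧⁺ (numeral⁺ {e = num j ▹ num i ▹ e} i 1F ≗-refl) (∧⁺ (numeral⁺ {e = num j ▹ num i ▹ e} j 0F ≗-refl)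
      (node⁺ {e = num j ▹ num i ▹ e} 0 (2 ↑ʳ c) 1F 0F h))))
  isCode⁺ {e = e} (eq i j) χ c h = ∃⁺ (num i) (∃⁺ (num j)
    (∧⁺ (numeral⁺ {e = num j ▹ num i ▹ e} i 1F ≗-refl) (∧⁺ (numeral⁺ {e = num j ▹ num i ▹ e} j 0F ≗-refl)
      (node⁺ {e = num j ▹ num i ▹ e} 1 (2 ↑ʳ c) 1F 0F h))))
  isCode⁺ {e = e} bot χ c h = botCode⁺ {e = e} c h
  isCode⁺ {e = e} (φ imp ψ) χ c h = let a = code (e ∘ χ) φ ; b = code (e ∘ χ) ψ in ∃⁺ a (∃⁺ b
    (∧⁺ (isCode⁺ {e = b ▹ a ▹ e} φ (λ l → 2 ↑ʳ χ l) 1F ≗-refl) (∧⁺ (isCode⁺ {e = b ▹ a ▹ e} ψ (λ l → 2 ↑ʳ χ l) 0F ≗-refl)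
      (node⁺ {e = b ▹ a ▹ e} 3 (2 ↑ʳ c) 1F 0F h))))
  isCode⁺ {e = e} (all i φ) χ c h = let a = num i ; b = code (e ∘ χ) φ in ∃⁺ a (∃⁺ b
    (∧⁺ (numeral⁺ {e = b ▹ a ▹ e} i 1F ≗-refl) (∧⁺ (isCode⁺ {e = b ▹ a ▹ e} φ (λ l → 2 ↑ʳ χ l) 0F ≗-refl)
      (node⁺ {e = b ▹ a ▹ e} 4 (2 ↑ʳ c) 1F 0F h))))
  isCode⁺ (letter l) χ c h = h

  -- Finite sequences; lists are stored with the last entry first.

  opaque
    seq : List Carrier → Carrier
    seq []       = ∅
    seq (c ∷ l) = adj (seq l) (pair (num (length l)) c)

  data At : List Carrier → ℕ → Carrier → Set where
    last    : ∀ {c l} → At (c ∷ l) (length l) c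
    earlier : ∀ {c d l i} → At l i c → At (d ∷ l) i c

  at-< : ∀ {l i c} → At l i c → i < length l
  at-< last        = ≤-refl
  at-< (earlier a) = m≤n⇒m≤1+n (at-< a)

  at-unique : ∀ {l i c d} → At l i c → At l i d → c ≡ d
  at-unique last        last        = refl
  at-unique last        (earlier b) = ⊥-elim (<-irrefl refl (at-< b))
  at-unique (earlier a) last        = ⊥-elim (<-irrefl refl (at-< a))
  at-unique (earlier a) (earlier b) = at-unique a b

  at-exists : ∀ l {i} → i < length l → Σ[ c ∈ Carrier ] At l i c × c ∈ₗ l
  at-exists (c ∷ l) (s≤s h) with m≤n⇒m<n∨m≡n h
  ... | inj₂ refl = c , last , here refl
  ... | inj₁ h′   = let d , a , m = at-exists l h′ in d , earlier a , there m

  at-∈ : ∀ {l c} → c ∈ₗ l → Σ[ i ∈ ℕ ] At l i c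
  at-∈ (here refl) = _ , last
  at-∈ (there m)   = let i , a = at-∈ m in i , earlier a

  opaque
    unfolding seq

    seq⁻ : ∀ l {p} → p ∈ seq l → ∥ Σ[ i ∈ ℕ ] Σ[ c ∈ Carrier ] At l i c × p ≗ pair (num i) c ∥
    seq⁻ []       i = λ _ → ∉∅ i
    seq⁻ (c ∷ l) i = ∈adj⁻ i >>= λ where
      (inj₁ j) → seq⁻ l j >>= λ (k , d , a , q) → return (k , d , earlier a , q)
      (inj₂ q) → return (_ , c , last , q)

    seq⁺ : ∀ {l i c} → At l i c → pair (num i) c ∈ seq l
    seq⁺ last        = ∈adj⁺ʳ
    seq⁺ (earlier a) = ∈adj⁺ˡ (seq⁺ a)

    seq-⊆ : ∀ {c l} → seq l ⊆ seq (c ∷ l)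
    seq-⊆ _ = ∈adj⁺ˡ

  seq-unique : ∀ {l i c v} → At l i c → pair (num i) v ∈ seq l → v ≗ c
  seq-unique {l} {i} a h = run do
    j , d , b , p ← seq⁻ l h
    let q , r = pair-injective p
    case i ≟ j of λ where
      (yes refl) → return (≗-trans r (≡⇒≗ (at-unique b a)))
      (no n)     → λ _ → num-≢ n q

  seq-fun : ∀ l {y} → (∀ {c} → c ∈ₗ l → c ∈ y) → Fun (seq l) (num (length l)) y
  seq-fun l h =
    (λ p i → seq⁻ l i >>= λ (j , c , a , q) → return (num j , c , num-< (at-< a) , h (member a) , q)) ,
    (λ x i → ∈num⁻ (length l) i >>= λ (j , b , p) →
      let c , a , m = at-exists l b in
      return (c , h m , pair∈-cong (≗-sym p) ≗-refl (seq⁺ a) , λ v k → seq-unique a (pair∈-cong p ≗-refl k)))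
    where
    member : ∀ {l i c} → At l i c → c ∈ₗ l
    member last        = here refl
    member (earlier a) = there (member a)

  listSet : List Carrier → Carrier
  listSet []       = ∅
  listSet (c ∷ l) = adj (listSet l) c

  ∈listSet : ∀ {c l} → c ∈ₗ l → c ∈ listSet l
  ∈listSet (here refl) = ∈adj⁺ʳ
  ∈listSet (there m)   = ∈adj⁺ˡ (∈listSet m)

  -- Formation sequences of concrete formulas

  data ListStep (N : Carrier) (l : List Carrier) : Carrier → Set where
    list-mem : ∀ {i j} → i ∈ N → j ∈ N → ListStep N l (node 0 i j)
    list-eq  : ∀ {i j} → i ∈ N → j ∈ N → ListStep N l (node 1 i j)
    list-bot : ListStep N l (node 2 ∅ ∅)
    list-imp : ∀ {a b} → a ∈ₗ l → b ∈ₗ l → ListStep N l (node 3 a b)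
    list-all : ∀ {i b} → i ∈ N → b ∈ₗ l → ListStep N l (node 4 i b)

  FormationList : Carrier → List Carrier → Set
  FormationList N []       = ⊤
  FormationList N (c ∷ l) = ListStep N l c × FormationList N l

  step-mono : ∀ {N g g′ m c} → g ⊆ g′ → Step N g m c → Step N g′ m c
  step-mono s (step-mem i j x y q) = step-mem i j x y q
  step-mono s (step-eq i j x y q)  = step-eq i j x y q
  step-mono s (step-bot q)         = step-bot q
  step-mono s (step-imp a b l l′ x y z w q) = step-imp a b l l′ x (s _ y) z (s _ w) q
  step-mono s (step-all i b l x y z q)      = step-all i b l x y (s _ z) q

  list-step : ∀ {N l m c} → FormationList N l → At l m c → Step N (seq l) (num m) c
  list-step (s , F) (earlier a) = step-mono seq-⊆ (list-step F a)
  list-step {l = _ ∷ l} (s , F) last = go s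
    where
    previous : ∀ {b} → b ∈ₗ l → Σ[ x ∈ Carrier ] x ∈ num (length l) × pair x b ∈ seq (_ ∷ l)
    previous m = let i , a = at-∈ m in num i , num-< (at-< a) , seq-⊆ _ (seq⁺ a)
    go : ∀ {c} → ListStep _ l c → Step _ (seq (_ ∷ l)) (num (length l)) c
    go (list-mem x y) = step-mem _ _ x y ≗-refl
    go (list-eq x y)  = step-eq _ _ x y ≗-refl
    go list-bot       = step-bot ≗-refl
    go (list-imp m n) = let i , x , y = previous m ; j , z , w = previous n in
                        step-imp _ _ i j x y z w ≗-refl
    go (list-all x m) = let i , y , z = previous m in step-all _ _ i x y z ≗-refl

  -- The accumulator is the sequence so far. As the newest entry comes first, the parts of a
  -- compound formula are found in the tail behind its own code.
  subformulas : Named 0 → List Carrier → List Carrier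
  subformulas φ@(φ₁ imp φ₂) l = code₀ φ ∷ subformulas φ₂ (subformulas φ₁ l)
  subformulas φ@(all i φ₁)  l = code₀ φ ∷ subformulas φ₁ l
  subformulas φ             l = code₀ φ ∷ l

  subformulas-self : ∀ φ {l} → code₀ φ ∈ₗ subformulas φ l
  subformulas-self (mem i j)  = here refl
  subformulas-self (eq i j)   = here refl
  subformulas-self bot        = here refl
  subformulas-self (φ imp ψ)  = here refl
  subformulas-self (all i φ)  = here refl

  subformulas-⊆ : ∀ φ {l c} → c ∈ₗ l → c ∈ₗ subformulas φ l
  subformulas-⊆ (mem i j)  m = there m
  subformulas-⊆ (eq i j)   m = there m
  subformulas-⊆ bot        m = there m
  subformulas-⊆ (φ imp ψ)  m = there (subformulas-⊆ ψ (subformulas-⊆ φ m))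
  subformulas-⊆ (all i φ)  m = there (subformulas-⊆ φ m)

  subformulas-formation : ∀ {N} φ {l} → Vars (λ i → num i ∈ N) φ → FormationList N l → FormationList N (subformulas φ l)
  subformulas-formation (mem i j)  (x , y) F = list-mem x y , F
  subformulas-formation (eq i j)   (x , y) F = list-eq x y , F
  subformulas-formation bot        _       F = list-bot , F
  subformulas-formation (φ imp ψ)  (x , y) F =
    list-imp (subformulas-⊆ ψ (subformulas-self φ)) (subformulas-self ψ) ,
    subformulas-formation ψ y (subformulas-formation φ x F)
  subformulas-formation (all i φ)  (x , y) F =
    list-all x (subformulas-self φ) , subformulas-formation φ y F

  -- The definition of a model promises satisfaction of an axiom once its code has a formation
  -- sequence; the listing of subformulas supplies one.
  code-form : ∀ {N} φ → Vars (λ i → num i ∈ N) φ → Σ[ g ∈ Carrier ] Σ[ n ∈ Carrier ] Formation N g n × Range g (code₀ φ)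
  code-form {N} φ v = seq l , num (length l) , (num∈ω (length l) , fun⇒funOn (seq-fun l ∈listSet) , λ m i → do
      j , b , p ← ∈num⁻ (length l) i
      let c , a , _ = at-exists l b
      return (c , pair∈-cong (≗-sym p) ≗-refl (seq⁺ a) , step-at (≗-sym p) (list-step F a))) ,
      return (_ , seq⁺ (proj₂ (at-∈ (subformulas-self φ))))
    where
    l : List Carrier
    l = subformulas φ []
    F : FormationList N l
    F = subformulas-formation φ v tt
    step-at : ∀ {g m m′ c} → m ≗ m′ → Step N g m c → Step N g m′ c
    step-at p (step-mem i j x y q) = step-mem i j x y q
    step-at p (step-eq i j x y q)  = step-eq i j x y q
    step-at p (step-bot q)         = step-bot q
    step-at p (step-imp a b l l′ x y z w q) = step-imp a b l l′ (∈-≗ʳ p x) y (∈-≗ʳ p z) w q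
    step-at p (step-all i b l x y z q)      = step-all i b l x (∈-≗ʳ p y) z q

  envList : (ℕ → Carrier) → ℕ → List Carrier
  envList e zero    = []
  envList e (suc k) = e k ∷ envList e k

  envList-length : ∀ e k → length (envList e k) ≡ k
  envList-length e zero    = refl
  envList-length e (suc k) = cong suc (envList-length e k)

  envList-at : ∀ e k {i} → i < k → At (envList e k) i (e i)
  envList-at e (suc k) (s≤s h) with m≤n⇒m<n∨m≡n h
  ... | inj₁ h′   = earlier (envList-at e k h′)
  ... | inj₂ refl = subst (λ j → At (e k ∷ envList e k) j (e k)) (envList-length e k) last

  envList-∈ : ∀ {e y} → (∀ i → e i ∈ y) → ∀ k {c} → c ∈ₗ envList e k → c ∈ y
  envList-∈ m (suc k) (here refl) = m k
  envList-∈ m (suc k) (there i)   = envList-∈ m k i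

  -- Tarski truth of named formulas in a set y

  update : (ℕ → Carrier) → ℕ → Carrier → ℕ → Carrier
  update e i x j = if j ≡ᵇ i then x else e j

  module _ (y : Carrier) where

    Named⟦_⟧ : Named 0 → (ℕ → Carrier) → Set
    Named⟦ mem i j ⟧  e = e i ∈ e j
    Named⟦ eq i j ⟧   e = e i ≗ e j
    Named⟦ bot ⟧      e = R
    Named⟦ φ imp ψ ⟧  e = Named⟦ φ ⟧ e → Named⟦ ψ ⟧ e
    Named⟦ all i φ ⟧  e = ∀ x → x ∈ y → Named⟦ φ ⟧ (update e i x)

    Rel⟦_⟧ : ∀ {n} → Formula n → Env n → Set
    Rel⟦ u ∈̇ v ⟧ e = e u ∈ e v
    Rel⟦ u ≐ v ⟧ e = e u ≗ e v
    Rel⟦ ⊥̇ ⟧     e = R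
    Rel⟦ φ ⇒ ψ ⟧ e = Rel⟦ φ ⟧ e → Rel⟦ ψ ⟧ e
    Rel⟦ ∀̇ φ ⟧   e = ∀ x → x ∈ y → Rel⟦ φ ⟧ (x ▹ e)

    Agree : Carrier → Carrier → (ℕ → Carrier) → Set
    Agree k t e = ∀ i → num i ∈ k → pair (num i) (e i) ∈ t

    update-agree : ∀ {k t t′ e i x} → (∀ j → e j ∈ y) → Agree k t e → Update k y t′ t (num i) x → Agree k t′ (update e i x)
    update-agree {e = e} {i} {x} m a (_ , b , c) j h with j ≡ᵇ i in p
    ... | true  = pair∈-cong (≡⇒≗ (cong num (sym (≡ᵇ⇒≡ j i (subst T (sym p) tt))))) ≗-refl b
    ... | false = c (num j) h (num-≢ {j} {i} λ q → subst T (trans (sym (≡⇒≡ᵇ-true q)) p) tt) (e j) (m j) (a j h)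
      where
      ≡⇒≡ᵇ-true : ∀ {j i} → j ≡ i → (j ≡ᵇ i) ≡ true
      ≡⇒≡ᵇ-true {j} refl = T⇒≡true (j ≡ᵇ j) (≡⇒≡ᵇ j j refl)
        where
        T⇒≡true : ∀ b → T b → b ≡ true
        T⇒≡true true _ = refl

    update-∈ : ∀ {e i x} → (∀ j → e j ∈ y) → x ∈ y → ∀ j → update e i x j ∈ y
    update-∈ {i = i} m h j with j ≡ᵇ i
    ... | true  = h
    ... | false = m j

    -- The bridge from satisfaction of codes to truth in Agda, by induction on the concrete formula.
    -- Tarski's conditions stay applicable since the range of `g` is closed under subformulas;
    -- `update-agree` carries the assignment past a quantifier.
    satisfaction-truth : ∀ {k g n S} → Formation k g n → Satisfaction k y g S →
      ∀ φ {e t} → (∀ i → e i ∈ y) → Fun t k y → Agree k t e → Range g (code₀ φ) →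
      pair (code₀ φ) t ∈ S ↔ Named⟦ φ ⟧ e
    satisfaction-truth F T (mem i j) {e} {t} m f a r =
      let x , z = range-mem F r ≗-refl
          p , q = proj₁ (T _ r t f) _ _ ≗-refl
      in (λ h → run do
           u , v , h₁ , h₂ , h ← p h
           return (∈-≗ˡ (funOn-unique (fun⇒funOn f) h₁ (a i x)) (∈-≗ʳ (funOn-unique (fun⇒funOn f) h₂ (a j z)) h)))
       , λ h → q (return (_ , _ , a i x , a j z , h))
    satisfaction-truth F T (eq i j) {e} {t} m f a r =
      let x , z = range-eq F r ≗-refl
          p , q = proj₁ (proj₂ (T _ r t f)) _ _ ≗-refl
      in (λ h → run do
           u , v , h₁ , h₂ , h ← p h
           return (≗-trans (funOn-unique (fun⇒funOn f) (a i x) h₁) (≗-trans h (funOn-unique (fun⇒funOn f) h₂ (a j z)))))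
       , λ h → q (return (_ , _ , a i x , a j z , h))
    satisfaction-truth F T bot {t = t} m f a r = proj₁ (proj₂ (proj₂ (T _ r t f))) ≗-refl , λ b → efq b
    satisfaction-truth F T (φ imp ψ) {t = t} m f a r =
      let r₁ , r₂ = range-imp F r ≗-refl
          p , q   = proj₁ (proj₂ (proj₂ (proj₂ (T _ r t f)))) _ _ ≗-refl
          p₁ , q₁ = satisfaction-truth F T φ m f a r₁
          p₂ , q₂ = satisfaction-truth F T ψ m f a r₂
      in (λ h x → p₂ (p h (q₁ x))) , (λ h → q λ x → q₂ (h (p₁ x)))
    satisfaction-truth F T (all i φ) {e} {t} m f a r =
      let i∈k , r₁ = range-all F r ≗-refl
          p , q    = proj₂ (proj₂ (proj₂ (proj₂ (T _ r t f)))) _ _ ≗-refl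
          ih       = λ {x} x∈y {t′} (u : Update _ y t′ t (num i) x) →
                     satisfaction-truth F T φ (update-∈ {i = i} m x∈y) (proj₁ u) (update-agree {i = i} m a u) r₁
      in (λ h x x∈y → run ⦃ stable-named φ ⦄ do
           t′ , u ← update-exists f i∈k x∈y
           return (proj₁ (ih x∈y u) (p h x x∈y t′ u)))
       , λ h → q λ x x∈y t′ u → proj₂ (ih x∈y u) (h x x∈y)
      where
      stable-named : ∀ φ {e} → Stable (Named⟦ φ ⟧ e)
      stable-named (mem i j) = stable-∈
      stable-named (eq i j)  = stable-≗
      stable-named bot       = stable-R
      stable-named (φ imp ψ) = stable-Π ⦃ stable-named ψ ⦄
      stable-named (all i φ) = stable-Π ⦃ stable-Π ⦃ stable-named φ ⦄ ⦄

    satisfied-truth : ∀ {k t} φ {e} → (∀ i → e i ∈ y) → Agree k t e → Satisfied k y t (code₀ φ) → ∥ Named⟦ φ ⟧ e ∥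
    satisfied-truth φ m a (_ , f , h) = do
      g , n , S , F , r , T , i ← h
      return (proj₁ (satisfaction-truth F T φ m f a r) i)

    -- All names of free variables lie below `m`, so binding v_m overwrites none of them.
    assignName-truth : ∀ {n} (ρ : Fin n → ℕ) {m} → (∀ i → ρ i < m) → ∀ φ {e : ℕ → Carrier} {e′ : Env n} →
      (∀ i → e′ i ≗ e (ρ i)) → Named⟦ assignName ρ m φ ⟧ e ↔ Rel⟦ φ ⟧ e′
    assignName-truth ρ l (u ∈̇ v) h = (λ p → ∈-≗ˡ (≗-sym (h u)) (∈-≗ʳ (≗-sym (h v)) p)) , (λ p → ∈-≗ˡ (h u) (∈-≗ʳ (h v) p))
    assignName-truth ρ l (u ≐ v) h =
      (λ p → ≗-trans (h u) (≗-trans p (≗-sym (h v)))) , (λ p → ≗-trans (≗-sym (h u)) (≗-trans p (h v)))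
    assignName-truth ρ l ⊥̇ h = id , id
    assignName-truth ρ l (φ ⇒ ψ) h =
      let p , q = assignName-truth ρ l φ h ; r , s = assignName-truth ρ l ψ h in
      (λ f x → r (f (q x))) , (λ f x → s (f (p x)))
    assignName-truth {n} ρ {m} l (∀̇ φ) {e} {e′} h =
      (λ f x i → proj₁ (ih x) (f x i)) , (λ f x i → proj₂ (ih x) (f x i))
      where
      agree : ∀ x i → (x ▹ e′) i ≗ update e m x ((m ▹ ρ) i)
      agree x zero with m ≡ᵇ m | ≡⇒≡ᵇ m m refl
      ... | true | _ = ≗-refl
      agree x (suc i) with ρ i ≡ᵇ m in p
      ... | true  = ⊥-elim (<-irrefl (≡ᵇ⇒≡ (ρ i) m (subst T (sym p) tt)) (l i))
      ... | false = h i
      ih : ∀ x → Named⟦ assignName (m ▹ ρ) (suc m) φ ⟧ (update e m x) ↔ Rel⟦ φ ⟧ (x ▹ e′)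
      ih x = assignName-truth (m ▹ ρ) (λ { zero → ≤-refl ; (suc i) → m≤n⇒m≤1+n (l i) }) φ (agree x)

  -- Injections and bijections

  Injection : (f x y : Carrier) → Set
  Injection f x y = Fun f x y × (∀ a b v → pair a v ∈ f → pair b v ∈ f → a ≗ b)

  injection⁻ : ∀ {f x y} → ⟦ IsInjection 0F 1F 2F ⟧ (f ▹ x ▹ y ▹ ε₀) → ∥ Injection f x y ∥
  injection⁻ {f} {x} {y} h = do
    F , i ← ∧⁻ h
    let Ff = fun⁻ {f} {x} {y} F
    return {Injection f x y} (Ff , λ a b v p q → i a (funOn-domain (fun⇒funOn Ff) p) b (funOn-domain (fun⇒funOn Ff) q)
      v (fun-codomain Ff p) (∧⁺ (at⁺ {f} {a} {v} p) (at⁺ {f} {b} {v} q)))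

  injection⁺ : ∀ {f x y} → Injection f x y → ⟦ IsInjection 0F 1F 2F ⟧ (f ▹ x ▹ y ▹ ε₀)
  injection⁺ {f} {x} {y} (F , i) = ∧⁺ (fun⁺ {f} {x} {y} F) λ a _ b _ v _ h → run do
    p , q ← ∧⁻ h
    return (i a b v (at⁻ {f} {a} {v} p) (at⁻ {f} {b} {v} q))

  Bijection : (f x y : Carrier) → Set
  Bijection f x y = Injection f x y × (∀ v → v ∈ y → ∥ (Σ[ a ∈ Carrier ] pair a v ∈ f) ∥)

  bijection⁺ : ∀ {f x y} → Bijection f x y → ⟦ IsBijection 0F 1F 2F ⟧ (f ▹ x ▹ y ▹ ε₀)
  bijection⁺ {f} {x} {y} (i , s) = ∧⁺ (injection⁺ {f} {x} {y} i) λ v j k → s v j λ (a , p) →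
    k a (funOn-domain (fun⇒funOn (proj₁ i)) p) (at⁺ {f} {a} {v} p)


  -- Truth of concrete formulas with two free variables

  satisfied-cong : ∀ {k y s c c′} → c ≗ c′ → Satisfied k y s c → Satisfied k y s c′
  satisfied-cong {k} {y} {s} {c} {c′} p (o , f , h) = o , f , (h >>= λ (g , n , S , F , r , τ , i) →
    return {SatWitness k y s c′}
      (g , n , S , F , (r >>= λ (m , j) → return (m , pair∈-cong ≗-refl p j)) , τ , pair∈-cong p ≗-refl i))

  -- Values are wanted for all `i` at once, and choice over ℕ does not pass through `∥_∥`. Hence the
  -- case distinction is put inside one existential formula, whose `witness` is an actual function
  -- of `i`.
  assignment : ∀ {k t y} → Inhabited y → Fun t k y → ∀ i → Σ[ v ∈ Carrier ] v ∈ y × (num i ∈ k → pair (num i) v ∈ t)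
  assignment {k} {t} {y} inhabited (_ , b) i = let v , h = witness φ e exists in v , run (∧⁻ h >>= λ (j , h) →
      return (j , λ l → at⁻ {t} {num i} {v} (h l)))
    where
    φ : Formula 5
    φ = 0F ∈̇ 1F ∧̇ (2F ∈̇ 3F ⇒ ⟨ 2F , 0F ⟩∈̇ 4F)
    e : Env 4
    e = y ▹ num i ▹ k ▹ t ▹ ε₀
    exists : ⟦ ∃̇ φ ⟧ e
    exists k′ = em λ where
      (inj₁ l) → b (num i) l λ (v , j , a , _) → k′ v (∧⁺ j λ _ → at⁺ {t} {num i} {v} a)
      (inj₂ n) → inhabited λ (v , j) → k′ v (∧⁺ j λ l → efq (n l))

  satisfied-rel : ∀ {k y t a b} (φ : Formula 2) → Inhabited y → pair (num 0) a ∈ t → pair (num 1) b ∈ t →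
    Satisfied k y t (code₀ (name φ)) → ∥ Rel⟦_⟧ y φ (b ▹ a ▹ ε₀) ∥
  satisfied-rel {k} {y} {t} {a} {b} φ inhabited p q s@(_ , f , _) = do
      h ← satisfied-truth y (assignName ρ 2 φ) (λ i → proj₁ (proj₂ (val i))) (λ i → proj₂ (proj₂ (val i)))
            (subst (λ χ → Satisfied k y t (code₀ χ)) (sym (name-assignName ρ (λ { 0F → refl ; 1F → refl }) φ)) s)
      return (proj₁ (assignName-truth y ρ (λ { 0F → s≤s (s≤s z≤n) ; 1F → s≤s z≤n }) φ {λ i → proj₁ (val i)} {b ▹ a ▹ ε₀}
        (λ { 0F → agree 1 q ; 1F → agree 0 p })) h)
    where
    val : ∀ i → Σ[ v ∈ Carrier ] v ∈ y × (num i ∈ k → pair (num i) v ∈ t)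
    val = assignment inhabited f
    ρ : Fin 2 → ℕ
    ρ 0F = 1
    ρ 1F = 0
    agree : ∀ i {v} → pair (num i) v ∈ t → v ≗ proj₁ (val i)
    agree i h = funOn-unique (fun⇒funOn f) h (proj₂ (proj₂ (val i)) (funOn-domain (fun⇒funOn f) h))

  HoldsWitness : (y : Carrier) (φ : Formula 2) (a b : Carrier) → Set
  HoldsWitness y φ a b = Σ[ k ∈ Carrier ] Σ[ t ∈ Carrier ]
    pair (num 0) a ∈ t × pair (num 1) b ∈ t × Satisfied k y t (code₀ (name φ))

  holds⁻ : ∀ {n} {e : Env n} (y : Fin n) φ (a b : Fin n) → ⟦ Holds₂ y φ a b ⟧ e → ∥ HoldsWitness (e y) φ (e a) (e b) ∥
  holds⁻ {e = e} y φ a b h = do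
    k , h ← ∃⁻ h
    t , h ← ∃⁻ h
    c , h ← ∃⁻ h
    p , h ← ∧⁻ h
    u , h ← ∧⁻ h
    v , h ← ∧⁻ h
    i , u ← ∃⁻ u
    z , u ← ∧⁻ u
    j , v ← ∃⁻ v
    o , v ← ∧⁻ v
    return {HoldsWitness (e y) φ (e a) (e b)} (k , t ,
      pair∈-cong (numeral⁻ {e = i ▹ c ▹ t ▹ k ▹ e} 0 0F z) ≗-refl (at⁻ {t} {i} {e a} u) ,
      pair∈-cong (numeral⁻ {e = j ▹ c ▹ t ▹ k ▹ e} 1 0F o) ≗-refl (at⁻ {t} {j} {e b} v) ,
      satisfied-cong (≗-trans (isCode⁻ {e = c ▹ t ▹ k ▹ e} (name φ) (λ ()) 0F p) (code-cong (λ ()) (name φ)))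
        (sat⁻ {e = c ▹ t ▹ k ▹ e} 2F (3 ↑ʳ y) 1F 0F h))

  -- Relativisation to a transitive model M of ZFC with ω ∈ M

  module InModel {ℓ : ℕ} {ρᴹ : Env ℓ} (M : Carrier) (model : ⟦ IsModel 0F ⟧ (M ▹ ρᴹ)) (ω∈M : ω ∈ M) where

    M-trans : ∀ {x y} → x ∈ M → y ∈ x → y ∈ M
    M-trans i j = run (∧⁻ model >>= λ (t , _) → return (t _ i _ j))

    ⟦_⟧ᴹ : ∀ {n} → Formula n → Env n → Set
    ⟦ φ ⟧ᴹ = Rel⟦_⟧ M φ

    stableᴹ : ∀ {n} (φ : Formula n) {e} → Stable (⟦ φ ⟧ᴹ e)
    stableᴹ (x ∈̇ y) = stable-∈
    stableᴹ (x ≐ y) = stable-≗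
    stableᴹ ⊥̇       = stable-R
    stableᴹ (φ ⇒ ψ) = stable-Π ⦃ stableᴹ ψ ⦄
    stableᴹ (∀̇ φ)   = stable-Π ⦃ stable-Π ⦃ stableᴹ φ ⦄ ⦄

    InM : ∀ {n} → Env n → Set
    InM e = ∀ i → e i ∈ M

    infixr 5 _▹ᴹ_
    _▹ᴹ_ : ∀ {n x} {e : Env n} → x ∈ M → InM e → InM (x ▹ e)
    (h ▹ᴹ k) zero    = h
    (h ▹ᴹ k) (suc i) = k i

    εᴹ : InM ε₀
    εᴹ ()

    -- A record instead of a pair of functions, so that the formula and the environment can be
    -- inferred from the type.
    record Absolute {n} (φ : Formula n) (e : Env n) : Set where
      constructor _,ᴬ_
      field
        out : ⟦ φ ⟧ᴹ e → ⟦ φ ⟧ e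
        inn : ⟦ φ ⟧ e → ⟦ φ ⟧ᴹ e

    open Absolute public

    infixr 4 _,ᴬ_

    abs-⇒ : ∀ {n} {φ ψ : Formula n} {e} → Absolute φ e → Absolute ψ e → Absolute (φ ⇒ ψ) e
    abs-⇒ a b = (λ f x → out b (f (inn a x))) ,ᴬ (λ f x → inn b (f (out a x)))

    abs-⊥ : ∀ {n} {e : Env n} → Absolute ⊥̇ e
    abs-⊥ = id ,ᴬ id

    abs-¬ : ∀ {n} {φ : Formula n} {e} → Absolute φ e → Absolute (¬̇ φ) e
    abs-¬ a = abs-⇒ a abs-⊥

    -- The right conjunct may be treated under the left one, which often supplies the bound it
    -- needs, such as the naturalness of the length of an assignment.
    abs-∧′ : ∀ {n} {φ ψ : Formula n} {e} → Absolute φ e → (⟦ φ ⟧ e → Absolute ψ e) → Absolute (φ ∧̇ ψ) e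
    abs-∧′ a h = (λ f k → f λ x y → k (out a x) (out (h (out a x)) y)) ,ᴬ
                 (λ f k → f λ x y → k (inn a x) (inn (h x) y))

    abs-∧ : ∀ {n} {φ ψ : Formula n} {e} → Absolute φ e → Absolute ψ e → Absolute (φ ∧̇ ψ) e
    abs-∧ a b = abs-∧′ a λ _ → b

    abs-⇔ : ∀ {n} {φ ψ : Formula n} {e} → Absolute φ e → Absolute ψ e → Absolute (φ ⇔ ψ) e
    abs-⇔ a b = abs-∧ (abs-⇒ a b) (abs-⇒ b a)

    abs-∨ : ∀ {n} {φ ψ : Formula n} {e} → Absolute φ e → Absolute ψ e → Absolute (φ ∨̇ ψ) e
    abs-∨ a b = abs-⇒ (abs-¬ a) b

    abs-∀∈ : ∀ {n} {x : Fin n} {φ : Formula (suc n)} {e} → e x ∈ M →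
             (∀ d → d ∈ e x → Absolute φ (d ▹ e)) → Absolute (∀∈ x φ) e
    abs-∀∈ m h = (λ f d i → out (h d i) (f d (M-trans m i) i)) ,ᴬ (λ f d _ i → inn (h d i) (f d i))

    abs-∃∈ : ∀ {n} {x : Fin n} {φ : Formula (suc n)} {e} → e x ∈ M →
             (∀ d → d ∈ e x → Absolute φ (d ▹ e)) → Absolute (∃∈ x φ) e
    abs-∃∈ m h = abs-¬ (abs-∀∈ m λ d i → abs-¬ (h d i))

    -- An unbounded quantifier is harmless when its body forces the witness into `M`, as happens for
    -- components of a code, values of a function in `M`, and finite functions.
    abs-∃ : ∀ {n} {φ : Formula (suc n)} {e} → (∀ d → d ∈ M → Absolute φ (d ▹ e)) →
            (∀ d → ⟦ φ ⟧ (d ▹ e) → d ∈ M) → Absolute (∃̇ φ) e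
    abs-∃ h b = (λ f k → f λ d i p → k d (out (h d i) p)) ,ᴬ
                (λ f k → f λ d p → k d (b d p) (inn (h d (b d p)) p))

    abs-∃∃ : ∀ {n} {φ : Formula (suc (suc n))} {e} →
             (∀ x y → x ∈ M → y ∈ M → Absolute φ (y ▹ x ▹ e)) →
             (∀ x y → ⟦ φ ⟧ (y ▹ x ▹ e) → x ∈ M × y ∈ M) → Absolute (∃̇ (∃̇ φ)) e
    abs-∃∃ h b = abs-∃ (λ x i → abs-∃ (λ y j → h x y i j) (λ y p → proj₂ (b x y p)))
      (λ x p → run (∃⁻ p >>= λ (y , p) → return (proj₁ (b x y p))))

    -- Unbounded universal quantifiers are absolute when a guard puts the
    -- quantified object into M.
    abs-∀⇒ : ∀ {n} {φ ψ : Formula (suc n)} {e} → (∀ d → d ∈ M → Absolute φ (d ▹ e)) →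
             (∀ d → ⟦ φ ⟧ (d ▹ e) → d ∈ M) → (∀ d → d ∈ M → ⟦ φ ⟧ (d ▹ e) → Absolute ψ (d ▹ e)) →
             Absolute (∀̇ (φ ⇒ ψ)) e
    abs-∀⇒ a b c = (λ f d p → let i = b d p in out (c d i p) (f d i (inn (a d i) p))) ,ᴬ
                   (λ f d i p → let q = out (a d i) p in inn (c d i q) (f d q))

    abs-∀∀⇒ : ∀ {n} {φ ψ : Formula (suc (suc n))} {e} →
              (∀ x y → x ∈ M → y ∈ M → Absolute φ (y ▹ x ▹ e)) →
              (∀ x y → ⟦ φ ⟧ (y ▹ x ▹ e) → x ∈ M × y ∈ M) →
              (∀ x y → x ∈ M → y ∈ M → ⟦ φ ⟧ (y ▹ x ▹ e) → Absolute ψ (y ▹ x ▹ e)) →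
              Absolute (∀̇ (∀̇ (φ ⇒ ψ))) e
    abs-∀∀⇒ a b c =
      (λ f x y p → let i , j = b x y p in out (c x y i j p) (f x i y j (inn (a x y i j) p))) ,ᴬ
      (λ f x i y j p → let q = out (a x y i j) p in inn (c x y i j q) (f x y q))

    abs-Δ₀ : ∀ {n} {φ : Formula n} {e} → Δ₀ φ → InM e → Absolute φ e
    abs-Δ₀ (Δ₀-∈ x y) m = id ,ᴬ id
    abs-Δ₀ (Δ₀-≐ x y) m = id ,ᴬ id
    abs-Δ₀ Δ₀-⊥       m = id ,ᴬ id
    abs-Δ₀ (Δ₀-⇒ p q) m = abs-⇒ (abs-Δ₀ p m) (abs-Δ₀ q m)
    abs-Δ₀ (Δ₀-∀ x p) m = abs-∀∈ (m x) λ d i → abs-Δ₀ p (M-trans (m x) i ▹ᴹ m)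

    absΔ : ∀ {n} (φ : Formula n) {_ : T (isΔ₀ φ)} {e} → InM e → Absolute φ e
    absΔ φ {δ} = abs-Δ₀ (isΔ₀-sound φ δ)

    -- From coded axioms of ZFC to axioms true in M

    M-inhabited : Inhabited M
    M-inhabited = do
      _ , h ← ∧⁻ model
      n , _ ← ∧⁻ h
      ∃⁻ n

    private
      M-schema : ⟦ ∀̇ (IsZFCAxiom 0F ⇒ ∀̇ (∀̇ (IsNat 1F ∧̇ IsFun 0F 1F (3 ↑ʳ 0F) ∧̇ IsForm 1F 2F ⇒
                   Sat 1F (3 ↑ʳ 0F) 0F 2F))) ⟧ (M ▹ ρᴹ)
      M-schema = run ⦃ stable (∀̇ (IsZFCAxiom 0F ⇒ ∀̇ (∀̇ (IsNat 1F ∧̇ IsFun 0F 1F (3 ↑ʳ 0F) ∧̇ IsForm 1F 2F ⇒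
                   Sat 1F (3 ↑ʳ 0F) 0F 2F)))) {M ▹ ρᴹ} ⦄ do
        _ , h ← ∧⁻ model
        _ , h ← ∧⁻ h
        return h

      M-hypotheses : ∀ {c k s} → k ∈ ω → Fun s k M → IsForm′ k c →
        ⟦ IsNat 1F ∧̇ IsFun 0F 1F (3 ↑ʳ 0F) ∧̇ IsForm 1F 2F ⟧ (s ▹ k ▹ c ▹ M ▹ ρᴹ)
      M-hypotheses {c} {k} {s} o f F =
        ∧⁺ (isNat⁺ {k} o) (∧⁺ (fun⁺ {s} {k} {M} f) (form⁺ {e = s ▹ k ▹ c ▹ M ▹ ρᴹ} 1F 2F F))

      M-sat : ∀ {c k s} → ⟦ IsZFCAxiom 0F ⟧ (c ▹ M ▹ ρᴹ) → k ∈ ω → Fun s k M → IsForm′ k c →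
              ⟦ Sat 1F (3 ↑ʳ 0F) 0F 2F ⟧ (s ▹ k ▹ c ▹ M ▹ ρᴹ)
      M-sat {c} {k} {s} a o f F = M-schema c a k s (M-hypotheses o f F)

    private
      disjunction : ∀ {n} → Formula (suc n) → List Sentence → Formula (suc n)
      disjunction β = foldr (λ σ φ → IsCode {h = 0} (name σ) (λ ()) 0F ∨̇ φ) β

      disjunction-member : ∀ {n} β {σ} l {e : Env (suc n)} → σ ∈ₗ l → e 0F ≗ code₀ (name σ) → ⟦ disjunction β l ⟧ e
      disjunction-member β {σ} (_ ∷ l) {e} (here refl) p =
        ∨ˡ ⦃ stable (disjunction β l) ⦄ (isCode⁺ {e = e} (name σ) (λ ()) 0F (≗-trans p (code-cong (λ ()) (name σ))))
      disjunction-member β (_ ∷ l) (there i) p = λ _ → disjunction-member β l i p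

      disjunction-base : ∀ {n} β l {e : Env (suc n)} → ⟦ β ⟧ e → ⟦ disjunction β l ⟧ e
      disjunction-base β []      h = h
      disjunction-base β (σ ∷ l) h = λ _ → disjunction-base β l h

      left : ∀ {n} (φ ψ : Formula n) {e} → ⟦ φ ⟧ e → ⟦ φ ∨̇ ψ ⟧ e
      left φ ψ h = ∨ˡ ⦃ stable ψ ⦄ h

      right : ∀ {n} (φ ψ : Formula n) {e} → ⟦ ψ ⟧ e → ⟦ φ ∨̇ ψ ⟧ e
      right φ ψ h _ = h

      cast : ∀ {n} (φ ψ : Formula n) e → φ ≡ ψ → ⟦ φ ⟧ e → ⟦ ψ ⟧ e
      cast φ .φ e refl h = h

      zfc-member : ∀ {n σ} (e : Env (suc n)) → σ ∈ₗ singleAxioms → e 0F ≗ code₀ (name σ) → ⟦ IsZFCAxiom 0F ⟧ e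
      zfc-member e i p = cast _ (IsZFCAxiom 0F) e refl
        (disjunction-member (IsInstance separationSchema 0F ∨̇ IsInstance replacementSchema 0F) singleAxioms {e} i p)

      zfc-separation-instance : ∀ {n} (e : Env (suc n)) → ⟦ IsInstance separationSchema 0F ⟧ e → ⟦ IsZFCAxiom 0F ⟧ e
      zfc-separation-instance e h = cast _ (IsZFCAxiom 0F) e refl
        (disjunction-base (IsInstance separationSchema 0F ∨̇ IsInstance replacementSchema 0F) singleAxioms {e}
          (left (IsInstance separationSchema 0F) (IsInstance replacementSchema 0F) {e} h))

      zfc-replacement-instance : ∀ {n} (e : Env (suc n)) → ⟦ IsInstance replacementSchema 0F ⟧ e → ⟦ IsZFCAxiom 0F ⟧ e
      zfc-replacement-instance e h = cast _ (IsZFCAxiom 0F) e refl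
        (disjunction-base (IsInstance separationSchema 0F ∨̇ IsInstance replacementSchema 0F) singleAxioms {e}
          (right (IsInstance separationSchema 0F) (IsInstance replacementSchema 0F) {e} h))

    opaque
      -- Opacity keeps the expanded disjunction over all axioms out of later goals.
      ZFCAxiom : Carrier → Set
      ZFCAxiom c = ⟦ IsZFCAxiom 0F ⟧ (c ▹ M ▹ ρᴹ)

      zfc-single : ∀ {σ} → σ ∈ₗ singleAxioms → ZFCAxiom (code₀ (name σ))
      zfc-single {σ} i = zfc-member (code₀ (name σ) ▹ M ▹ ρᴹ) i ≗-refl

      zfc-separation : ∀ {c} → ⟦ IsInstance separationSchema 0F ⟧ (c ▹ M ▹ ρᴹ) → ZFCAxiom c
      zfc-separation {c} h = zfc-separation-instance (c ▹ M ▹ ρᴹ) h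

      zfc-replacement : ∀ {c} → ⟦ IsInstance replacementSchema 0F ⟧ (c ▹ M ▹ ρᴹ) → ZFCAxiom c
      zfc-replacement {c} h = zfc-replacement-instance (c ▹ M ▹ ρᴹ) h

      M-axioms : ∀ {c k s} → ZFCAxiom c → k ∈ ω → Fun s k M → IsForm′ k c → Satisfied k M s c
      M-axioms {c} {k} {s} a o f F = sat⁻ {e = s ▹ k ▹ c ▹ M ▹ ρᴹ} 1F (3 ↑ʳ 0F) 0F 2F (M-sat {c} {k} {s} a o f F)

    -- An axiom is satisfied under every assignment covering its variables; the one used here cuts
    -- `e` off just above the largest variable index.
    axiom-truth : ∀ φ → ZFCAxiom (code₀ φ) → ∀ {e} → (∀ i → e i ∈ M) → ∥ Named⟦_⟧ M φ e ∥
    axiom-truth φ a {e} m = satisfied-truth M φ m agree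
      (M-axioms a (num∈ω K) (subst (λ k → Fun s (num k) M) (envList-length e K) (seq-fun _ (envList-∈ m K)))
        (code-form φ (vars-map num-< φ (vars-bounded φ ≤-refl))))
      where
      K : ℕ
      K = suc (maxVar φ)
      s : Carrier
      s = seq (envList e K)
      agree : Agree M (num K) s e
      agree i h = run do
        j , l , p ← ∈num⁻ K h
        case i ≟ j of λ where
          (yes refl) → return (seq⁺ (envList-at e K l))
          (no n)     → λ _ → num-≢ n p

    single-truth : ∀ {σ} → σ ∈ₗ singleAxioms → ⟦ σ ⟧ᴹ ε₀
    single-truth {σ} i = run ⦃ stableᴹ σ ⦄ do
      z , z∈M ← M-inhabited
      h ← axiom-truth (name σ) (zfc-single i) {λ _ → z} (λ _ → z∈M)
      return (proj₁ (assignName-truth M ε₀ {0} (λ ()) σ {λ _ → z} (λ ()))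
        (subst (λ φ → Named⟦_⟧ M φ (λ _ → z)) (sym (name-assignName ε₀ (λ ()) σ)) h))

    private
      -- `IsInstance` asks for a set of variable indices without 3 and 4; it is a numeral above all
      -- variables of ψ with these two removed.
      instance-code : ∀ (σ : Named 1) ψ → Vars (λ i → i ≢ 3 × i ≢ 4) ψ → ⟦ IsInstance σ 0F ⟧ (code₀ (plug σ ψ) ▹ M ▹ ρᴹ)
      instance-code σ ψ v = ∃⁺ N (∃⁺ (code₀ ψ) (∧⁺
          (λ x i → let j , p = ∈sep⁻ φ i in ∧⁺ (isNat⁺ (run (∈num⁻ K j >>= λ (l , _ , q) → return (∈-≗ˡ (≗-sym q) (num∈ω l)))))
            λ k → p λ n n′ → k (λ h → n (numeral⁻ {e = x ▹ e} 3 0F h)) (λ h → n′ (numeral⁻ {e = x ▹ e} 4 0F h)))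
          (∧⁺ (form⁺ {e = e} 1F 0F (code-form ψ (vars-map (λ (l , n , n′) → ∈sep⁺ φ (num-< l) (∧⁺ (num-≢ n) (num-≢ n′))) ψ
                  (vars-zip ψ (vars-bounded ψ ≤-refl) v))))
              (isCode⁺ {e = e} σ (λ _ → 0F) 2F (≡⇒≗ (sym (code-plug ψ σ)))))))
        where
        K : ℕ
        K = suc (maxVar ψ)
        φ : Formula 3
        φ = ¬̇ (0F ≐ 1F) ∧̇ ¬̇ (0F ≐ 2F)
        N : Carrier
        N = sep φ (num 3 ▹ num 4 ▹ ε₀) (num K)
        e : Env (4 + ℓ)
        e = code₀ ψ ▹ N ▹ code₀ (plug σ ψ) ▹ M ▹ ρᴹ

      extend : ∀ {n} → Env n → Carrier → ℕ → Carrier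
      extend {zero}  e d i       = d
      extend {suc n} e d zero    = e zero
      extend {suc n} e d (suc i) = extend (e ∘ suc) d i

      extend-toℕ : ∀ {n} (e : Env n) d i → extend e d (toℕ i) ≡ e i
      extend-toℕ e d zero    = refl
      extend-toℕ e d (suc i) = extend-toℕ (e ∘ suc) d i

      extend-∈ : ∀ {n} {e : Env n} {d} → InM e → d ∈ M → ∀ i → extend e d i ∈ M
      extend-∈ {zero}  m h i       = h
      extend-∈ {suc n} m h zero    = m zero
      extend-∈ {suc n} m h (suc i) = extend-∈ (m ∘ suc) h i

      -- The schemas use v₀, …, v₄ themselves, so the parameters are named v₅, v₆, ….
      offset : ∀ {n} → Env n → Carrier → ℕ → Carrier
      offset e d (suc (suc (suc (suc (suc i))))) = extend e d i
      offset e d _                               = d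

      offset-∈ : ∀ {n} {e : Env n} {d} → InM e → d ∈ M → ∀ i → offset e d i ∈ M
      offset-∈ m h 0 = h
      offset-∈ m h 1 = h
      offset-∈ m h 2 = h
      offset-∈ m h 3 = h
      offset-∈ m h 4 = h
      offset-∈ m h (suc (suc (suc (suc (suc i))))) = extend-∈ m h i

      5≤⇒≢ : ∀ {i} → 5 ≤ i → i ≢ 3 × i ≢ 4
      5≤⇒≢ (s≤s (s≤s (s≤s (s≤s (s≤s _))))) = (λ ()) , (λ ())

    Separated : ∀ {n} → Formula (suc n) → Env n → Carrier → Set
    Separated φ e a = Σ[ b ∈ Carrier ] b ∈ M × (∀ x → x ∈ b ↔ x ∈ a × ⟦ φ ⟧ᴹ (x ▹ e))

    -- Separation in `M` for arbitrary formulas. The variable x gets the name v_0 that the schema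
    -- expects, the parameters start at v_5, and bound variables are named after them.
    M-separation : ∀ {n} (φ : Formula (suc n)) {e a} → InM e → a ∈ M → ∥ Separated φ e a ∥
    M-separation {n} φ {e} {a} m a∈M = do
      h ← axiom-truth (plug separationSchema ψ)
            (zfc-separation {code₀ (plug separationSchema ψ)} (instance-code separationSchema ψ vars))
            (offset-∈ m a∈M)
      b , b∈M , h ← ∃∈⁻ (h a a∈M)
      return {Separated φ e a} (b , b∈M , λ x →
        let truth : x ∈ M → Named⟦_⟧ M ψ _ ↔ ⟦ φ ⟧ᴹ (x ▹ e)
            truth = λ _ → assignName-truth M ρ bounded φ {update (update (update (offset e a) 2 a) 3 b) 0 x}
                      (λ { zero → ≗-refl ; (suc i) → ≡⇒≗ (sym (extend-toℕ e a i)) })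
        in (λ i → let x∈M = M-trans b∈M i in run ⦃ stable-× ⦃ stable-∈ ⦄ ⦃ stableᴹ φ ⦄ ⦄ do
              f , _ ← ∧⁻ (h x x∈M)
              j , p ← ∧⁻ (f i)
              return (j , proj₁ (truth x∈M) p))
         , λ (i , p) → let x∈M = M-trans a∈M i in run do
              _ , g ← ∧⁻ (h x x∈M)
              return (g (∧⁺ i (proj₂ (truth x∈M) p))))
      where
      ρ : Fin (suc n) → ℕ
      ρ zero    = 0
      ρ (suc i) = 5 + toℕ i
      ψ : Named 0
      ψ = assignName ρ (5 + n) φ
      bounded : ∀ i → ρ i < 5 + n
      bounded zero    = s≤s z≤n
      bounded (suc i) = +-monoʳ-< 5 (toℕ<n i)
      vars : Vars (λ i → i ≢ 3 × i ≢ 4) ψ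
      vars = vars-assignName ρ (5 + n) (λ { zero → (λ ()) , (λ ()) ; (suc i) → 5≤⇒≢ (m≤m+n 5 (toℕ i)) })
               (λ l → 5≤⇒≢ (≤-trans (m≤m+n 5 n) l)) φ

    Replaced : ∀ {n} → Formula (suc (suc n)) → Env n → Carrier → Set
    Replaced φ e a = Σ[ b ∈ Carrier ] b ∈ M ×
      (∀ z → z ∈ M → z ∈ b ↔ ∥ Σ[ x ∈ Carrier ] x ∈ a × ⟦ φ ⟧ᴹ (z ▹ x ▹ e) ∥)

    -- The argument x and the value z are named v_0 and v_1; in the schema v_4 holds the unique
    -- value and v_3 the set of values.
    M-replacement : ∀ {n} (φ : Formula (suc (suc n))) {e a} → InM e → a ∈ M →
      (∀ x → x ∈ a → ∥ Σ[ w ∈ Carrier ] w ∈ M × (∀ z → z ∈ M → ⟦ φ ⟧ᴹ (z ▹ x ▹ e) ↔ z ≗ w) ∥) →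
      ∥ Replaced φ e a ∥
    M-replacement {n} φ {e} {a} m a∈M functional = do
      h ← axiom-truth (plug replacementSchema ψ)
            (zfc-replacement {code₀ (plug replacementSchema ψ)} (instance-code replacementSchema ψ vars))
            (offset-∈ m a∈M)
      b , b∈M , h ← ∃∈⁻ (h a a∈M λ x x∈M x∈a k → functional x x∈a λ (w , w∈M , f) → k w w∈M λ z z∈M →
        let truth = assignName-truth M ρ bounded φ {update (update (update (update (offset e a) 2 a) 0 x) 4 w) 1 z} {z ▹ x ▹ e}
                      (λ { 0F → ≗-refl ; 1F → ≗-refl ; (suc (suc i)) → ≡⇒≗ (sym (extend-toℕ e a i)) })
            p , q = f z z∈M
        in ∧⁺ (λ t → p (proj₁ truth t)) (λ t → proj₂ truth (q t)))
      return {Replaced φ e a} (b , b∈M , λ z z∈M →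
        let truth = λ x → assignName-truth M ρ bounded φ
                      {update (update (update (update (offset e a) 2 a) 3 b) 1 z) 0 x} {z ▹ x ▹ e}
                      (λ { 0F → ≗-refl ; 1F → ≗-refl ; (suc (suc i)) → ≡⇒≗ (sym (extend-toℕ e a i)) })
        in (λ i → do
              f , _ ← ∧⁻ (h z z∈M)
              x , x∈M , h ← ∃∈⁻ (f i)
              j , p ← ∧⁻ h
              return (x , j , proj₁ (truth x) p))
         , λ i → run do
              _ , g ← ∧⁻ (h z z∈M)
              x , j , p ← i
              return (g (∃∈⁺ x (M-trans a∈M j) (∧⁺ j (proj₂ (truth x) p)))))
      where
      ρ : Fin (suc (suc n)) → ℕ
      ρ 0F            = 1
      ρ 1F            = 0
      ρ (suc (suc i)) = 5 + toℕ i
      ψ : Named 0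
      ψ = assignName ρ (5 + n) φ
      bounded : ∀ i → ρ i < 5 + n
      bounded 0F            = s≤s (s≤s z≤n)
      bounded 1F            = s≤s z≤n
      bounded (suc (suc i)) = +-monoʳ-< 5 (toℕ<n i)
      vars : Vars (λ i → i ≢ 3 × i ≢ 4) ψ
      vars = vars-assignName ρ (5 + n)
               (λ { 0F → (λ ()) , (λ ()) ; 1F → (λ ()) , (λ ()) ; (suc (suc i)) → 5≤⇒≢ (m≤m+n 5 (toℕ i)) })
               (λ l → 5≤⇒≢ (≤-trans (m≤m+n 5 n) l)) φ

    -- Closure properties of M

    M-≗ : ∀ {x y} → x ≗ y → x ∈ M → y ∈ M
    M-≗ = ∈-≗ˡ

    -- For Δ₀ formulas, separation in `M` and in the universe cut out the same set, by absoluteness.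
    M-sep : ∀ {n} (φ : Formula (suc n)) {δ : T (isΔ₀ φ)} (e : Env n) {a} → InM e → a ∈ M → sep φ {δ} e a ∈ M
    M-sep φ {δ} e {a} m a∈M = run do
      b , b∈M , h ← M-separation φ m a∈M
      return (M-≗ (extensional
        (λ x i → let j , p = proj₁ (h x) i in ∈sep⁺ φ j (out (absΔ φ {δ} (M-trans a∈M j ▹ᴹ m)) p))
        (λ x i → let j , p = ∈sep⁻ φ i in proj₂ (h x) (j , inn (absΔ φ {δ} (M-trans a∈M j ▹ᴹ m)) p))) b∈M)

    M-∅ : ∅ ∈ M
    M-∅ = run do
      x , i ← M-inhabited
      return (M-≗ (empty≗∅ λ y j → proj₂ (∈sep⁻ ⊥̇ {e = ε₀} {x} j)) (M-sep ⊥̇ ε₀ εᴹ i))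

    M-⁅⁆ : ∀ {x y} → x ∈ M → y ∈ M → ⁅ x , y ⁆ ∈ M
    M-⁅⁆ {x} {y} i j = run do
      z , z∈M , h ← ∃∈⁻ (single-truth {pairing} (there (there (here refl))) x i y j)
      return (M-≗ (upair⁻ (out (absΔ (IsUPair 0F 2F 1F) {e = z ▹ y ▹ x ▹ ε₀} (z∈M ▹ᴹ j ▹ᴹ i ▹ᴹ εᴹ)) h)) z∈M)

    M-⋃ : ∀ {x} → x ∈ M → ⋃ x ∈ M
    M-⋃ {x} i = run do
      z , z∈M , h ← ∃∈⁻ (single-truth {union} (there (there (there (here refl)))) x i)
      return (M-≗ (extensional
        (λ w j → run do
          f , _ ← ∧⁻ (h w (M-trans z∈M j))
          y , _ , h ← ∃∈⁻ {M} (λ k → f j λ y y∈M y∈x w∈y → k y y∈M (∧⁺ y∈x w∈y))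
          k , l ← ∧⁻ h
          return (∈⋃⁺ k l))
        (λ w j → run do
          y , k , l ← ∈⋃⁻ j
          let y∈M = M-trans i k
          _ , g ← ∧⁻ (h w (M-trans y∈M l))
          return (g λ n → n y y∈M k l))) z∈M)

    -- A reservoir in `M`, from which separation later cuts out function spaces and Def(X).
    M-power : ∀ {x} → x ∈ M → ∥ Σ[ P ∈ Carrier ] P ∈ M × (∀ z → z ∈ M → z ⊆ x → z ∈ P) ∥
    M-power {x} i = do
      P , P∈M , h ← ∃∈⁻ (single-truth {powerset} (there (there (there (there (here refl))))) x i)
      return (P , P∈M , λ z j s → run do
        _ , g ← ∧⁻ (h z j)
        return (g λ w _ → s w))

    opaque
      unfolding pair

      M-pair : ∀ {x y} → x ∈ M → y ∈ M → pair x y ∈ M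
      M-pair i j = M-⁅⁆ (M-⁅⁆ i i) (M-⁅⁆ i j)

      M-pair⁻ : ∀ {x y} → pair x y ∈ M → x ∈ M × y ∈ M
      M-pair⁻ i = let j = M-trans i ∈⁅⁆₂ in M-trans j ∈⁅⁆₁ , M-trans j ∈⁅⁆₂

      pair∈power : ∀ {x y a P Q} → x ∈ M → y ∈ M → x ∈ a → y ∈ a →
        (∀ z → z ∈ M → z ⊆ a → z ∈ P) → (∀ z → z ∈ M → z ⊆ P → z ∈ Q) → pair x y ∈ Q
      pair∈power {x} {y} i j k l p q = q _ (M-pair i j) λ z m → run (∈⁅⁆⁻ m >>= λ where
          (inj₁ r) → return (∈-≗ˡ (≗-sym r) (p _ (M-⁅⁆ i i) λ w n → run (∈⁅⁆⁻ n >>= λ where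
            (inj₁ s) → return (∈-≗ˡ (≗-sym s) k)
            (inj₂ s) → return (∈-≗ˡ (≗-sym s) k))))
          (inj₂ r) → return (∈-≗ˡ (≗-sym r) (p _ (M-⁅⁆ i j) λ w n → run (∈⁅⁆⁻ n >>= λ where
            (inj₁ s) → return (∈-≗ˡ (≗-sym s) k)
            (inj₂ s) → return (∈-≗ˡ (≗-sym s) l)))))

      -- Bounds arguments and values of `f` by a set, which makes statements about them Δ₀.
      field-∈ : ∀ {f x v} → pair x v ∈ f → x ∈ ⋃ (⋃ f) × v ∈ ⋃ (⋃ f)
      field-∈ i = let j = ∈⋃⁺ i ∈⁅⁆₂ in ∈⋃⁺ j ∈⁅⁆₁ , ∈⋃⁺ j ∈⁅⁆₂

    opaque
      unfolding adj

      M-adj : ∀ {a x} → a ∈ M → x ∈ M → adj a x ∈ M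
      M-adj i j = M-⋃ (M-⁅⁆ i (M-⁅⁆ j j))

    opaque
      unfolding node

      M-node⁻ : ∀ k {a b} → node k a b ∈ M → a ∈ M × b ∈ M
      M-node⁻ k i = M-pair⁻ (proj₂ (M-pair⁻ i))

      M-node′ : ∀ k {a b} → num k ∈ M → a ∈ M → b ∈ M → node k a b ∈ M
      M-node′ k i j l = M-pair i (M-pair j l)

    M-nat : ∀ {k} → k ∈ ω → k ∈ M
    M-nat = M-trans ω∈M

    M-num : ∀ k → num k ∈ M
    M-num zero    = M-∅
    M-num (suc k) = M-adj (M-num k) (M-num k)

    M-node : ∀ k {a b} → a ∈ M → b ∈ M → node k a b ∈ M
    M-node k = M-node′ k (M-num k)

    M-pairs : ∀ {a b} → a ∈ M → b ∈ M → ∥ Σ[ Z ∈ Carrier ] Z ∈ M × (∀ x v → x ∈ a → v ∈ b → pair x v ∈ Z) ∥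
    M-pairs {a} {b} i j = do
      let c∈M = M-⋃ (M-⁅⁆ i j)
      P , P∈M , p ← M-power c∈M
      Q , Q∈M , q ← M-power P∈M
      return (Q , Q∈M , λ x v k l → pair∈power (M-trans i k) (M-trans j l) (∈⋃⁺ ∈⁅⁆₁ k) (∈⋃⁺ ∈⁅⁆₂ l) p q)

    -- A function on a natural number belongs to M as soon as each value belongs
    -- to M whenever all the earlier values do.
    module _ {f k : Carrier} (k∈ω : k ∈ ω) (F : FunOn f k)
      (values : ∀ j v → j ∈ k → pair j v ∈ f → (∀ l w → l ∈ j → pair l w ∈ f → w ∈ M) → v ∈ M) where

      private
        U : Carrier
        U = ⋃ (⋃ f)

        value∈M : ∀ {j v} → pair j v ∈ f → v ∈ M
        value∈M {j} {v} i = ord-induction φ (f ▹ U ▹ M ▹ ε₀) (nat-ord k∈ω) step j (funOn-domain F i) v (proj₂ (field-∈ i)) (at⁺ {f} {j} {v} i)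
          where
          φ : Formula 4
          φ = ∀∈ 2F (⟨ 1F , 0F ⟩∈̇ 2F ⇒ 0F ∈̇ 4F)
          step : ∀ β → β ∈ k → (∀ γ → γ ∈ β → ⟦ φ ⟧ (γ ▹ f ▹ U ▹ M ▹ ε₀)) → ⟦ φ ⟧ (β ▹ f ▹ U ▹ M ▹ ε₀)
          step β j h v _ i = values β v j (at⁻ {f} {β} {v} i) λ l w m n → h l m w (proj₂ (field-∈ n)) (at⁺ {f} {l} {w} n)

        Initial : Carrier → Set
        Initial j = Σ[ u ∈ Carrier ] u ∈ M × u ⊆ f × (∀ x v → x ∈ j → pair x v ∈ f → pair x v ∈ u)

        φ : Formula 4
        -- `Initial` in Δ₀ form: the initial segment is bounded by `M` and the values by `U`, so
        -- that `ord-induction` applies.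
        φ = ∃∈ 3F (0F ⊆̇ 2F ∧̇ ∀∈ 1F (∀∈ 4F (⟨ 1F , 0F ⟩∈̇ 4F ⇒ ⟨ 1F , 0F ⟩∈̇ 2F)))

        initial⁻ : ∀ {j} → ⟦ φ ⟧ (j ▹ f ▹ U ▹ M ▹ ε₀) → ∥ Initial j ∥
        initial⁻ {j} h = do
          u , i , h ← ∃∈⁻ h
          s , c ← ∧⁻ h
          return {Initial j} (u , i , s , λ x v j k → at⁻ {f = u} {x} {v} (c x j v (proj₂ (field-∈ k)) (at⁺ {f} {x} {v} k)))

        initial⁺ : ∀ {j} → ∥ Initial j ∥ → ⟦ φ ⟧ (j ▹ f ▹ U ▹ M ▹ ε₀)
        initial⁺ h k = h λ (u , i , s , c) → k u i (∧⁺ s λ x j v _ l → at⁺ {u} {x} {v} (c x v j (at⁻ {f} {x} {v} l)))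

        initial : ∀ j → j ∈ succ k → ∥ Initial j ∥
        initial j i = initial⁻ {j} (ord-induction φ (f ▹ U ▹ M ▹ ε₀) (nat-ord (succ∈ω k∈ω)) (λ β m h → initial⁺ {β} (step β m h)) j i)
          where
          step : ∀ β → β ∈ succ k → (∀ γ → γ ∈ β → ⟦ φ ⟧ (γ ▹ f ▹ U ▹ M ▹ ε₀)) → ∥ Initial β ∥
          step β m h = nat-case (ω-trans (succ∈ω k∈ω) m) >>= λ where
            (inj₁ p) → return {Initial β} (∅ , M-∅ , (λ z l → efq (∉∅ l)) , λ x v l _ → efq (∉∅ (∈-≗ʳ p l)))
            (inj₂ (y , y∈β , p)) → do
              u , u∈M , s , c ← initial⁻ {y} (h y y∈β)
              d ← ∈adj⁻ m
              let y∈k = case d of λ { (inj₁ l) → proj₁ (nat-ord k∈ω) β l y y∈β ; (inj₂ q) → ∈-≗ʳ q y∈β }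
              v , v∈f , uniq ← proj₂ F y y∈k
              return {Initial β} (adj u (pair y v) , M-adj u∈M (M-pair (M-nat (ω-trans k∈ω y∈k)) (value∈M v∈f)) ,
                (λ z l → run (∈adj⁻ l >>= λ { (inj₁ l) → return (s z l) ; (inj₂ q) → return (∈-≗ˡ (≗-sym q) v∈f) })) ,
                λ x w l n → run (∈adj⁻ (∈-≗ʳ p l) >>= λ where
                  (inj₁ l) → return (∈adj⁺ˡ (c x w l n))
                  (inj₂ q) → return (pair∈-cong (≗-sym q) (≗-sym (uniq w (pair∈-cong q ≗-refl n))) ∈adj⁺ʳ)))

      finite-function : f ∈ M
      finite-function = run do
        u , u∈M , s , c ← initial k ∈adj⁺ʳ
        return (M-≗ (extensional s λ p i → run (proj₁ F p i >>= λ (x , v , j , q) →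
          return (∈-≗ˡ (≗-sym q) (c x v j (∈-≗ˡ q i))))) u∈M)

    -- All assignments of the universe into a member of `M` are already in `M`, so quantifying over
    -- assignments means the same in both.
    M-fun : ∀ {t k y} → k ∈ ω → y ∈ M → Fun t k y → t ∈ M
    M-fun o i f = finite-function o (fun⇒funOn f) λ j v _ m _ → M-trans i (fun-codomain f m)

    M-formation : ∀ {N g n} → N ∈ M → Formation N g n → g ∈ M
    M-formation N∈M F@(o , f , _) = finite-function o f λ j v _ m h → run do
      s ← formation-step F m
      case s of λ where
        (step-mem i j x y q) → return (M-≗ (≗-sym q) (M-node 0 (M-trans N∈M x) (M-trans N∈M y)))
        (step-eq i j x y q)  → return (M-≗ (≗-sym q) (M-node 1 (M-trans N∈M x) (M-trans N∈M y)))
        (step-bot q)         → return (M-≗ (≗-sym q) (M-node 2 M-∅ M-∅))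
        (step-imp a b l l′ x y z w q) → return (M-≗ (≗-sym q) (M-node 3 (h l a x y) (h l′ b z w)))
        (step-all i b l x y z q)      → return (M-≗ (≗-sym q) (M-node 4 (M-trans N∈M x) (h l b y z)))

    -- Absoluteness

    private
      K : Carrier → Set
      K x = x ∈ M

    module MO = OrdinalsIn K (λ i j → M-trans j i) (λ φ e a m i → M-sep φ e m i)

    ordᴹ⁻ : ∀ {α} → α ∈ M → ⟦ IsOrd 0F ⟧ᴹ (α ▹ ε₀) → Ord K α
    ordᴹ⁻ i h = run do
      t , h ← ∧⁻ h
      l , w ← ∧⁻ h
      return {Ord K _} ((λ x j y k → let x∈M = M-trans i j in t x x∈M j y (M-trans x∈M k) k) ,
        (λ x j y k → do
           c ← ∨⁻ (l x (M-trans i j) j y (M-trans i k) k)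
           case c of λ { (inj₁ a) → return (inj₁ a) ; (inj₂ b) → ∨⁻ b >>= return ∘ inj₂ }) ,
        λ u u∈M s n → do
          m , m∈M , h ← ∃∈⁻ {M} (λ k → w u u∈M (∧⁺ (λ x _ → s x) λ k → n λ (z , j) → k z (M-trans u∈M j) j)
                           λ x x∈M j h → k x x∈M (∧⁺ j h))
          j , h ← ∧⁻ h
          return (m , j , λ x l q → h x (M-trans u∈M l) l q))

    ordᴹ⁺ : ∀ {α} → Ord K α → ⟦ IsOrd 0F ⟧ᴹ (α ▹ ε₀)
    ordᴹ⁺ (t , l , w) = ∧⁺ (λ x _ i y _ j → t x i y j) (∧⁺
      (λ x _ i y _ j → ∨⁺ (l x i y j >>= λ { (inj₁ a) → return (inj₁ a) ; (inj₂ b) → return (inj₂ (∨⁺ (return b))) }))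
      λ u u∈M h k → run do
        s , n ← ∧⁻ h
        m , i , p ← w u u∈M (λ x j → s x (M-trans u∈M j) j) (∃∈⁻ n >>= λ (z , _ , j) → return (z , j))
        return (k m (M-trans u∈M i) i λ x _ → p x))

    limitᴹ⁻ : ∀ {α} → α ∈ M → ⟦ IsLimit 0F ⟧ᴹ (α ▹ ε₀) → Limit K α
    limitᴹ⁻ i h = run do
      o , h ← ∧⁻ h
      n , m ← ∧⁻ h
      return {Limit K _} (ordᴹ⁻ i o , (∃∈⁻ n >>= λ (z , _ , j) → return (z , j)) , λ x j k →
        m x (M-trans i j) j λ y _ l p → k (y , l , p))

    limitᴹ⁺ : ∀ {α} → α ∈ M → Limit K α → ⟦ IsLimit 0F ⟧ᴹ (α ▹ ε₀)
    limitᴹ⁺ i (o , n , m) = ∧⁺ (ordᴹ⁺ o) (∧⁺ (λ k → n λ (z , j) → k z (M-trans i j) j)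
      λ x _ j k → m x j λ (y , l , p) → k y (M-trans i l) l p)

    limit-K : ∀ {α} → Limit V α → Limit K α
    limit-K (o , n , m) = Ord-V o , n , m

    limit-V : ∀ {α} → Ord V α → Limit K α → Limit V α
    limit-V o (_ , n , m) = o , n , m

    -- A natural number that `M` takes for a limit is an ordinal of the universe, hence a limit
    -- there as well.
    ω-omegaᴹ : Omega K ω
    ω-omegaᴹ = limit-K (proj₁ ω-omega) , λ n i l → proj₂ ω-omega n i (limit-V (nat-ord i) l)

    omegaᴹ⁻ : ∀ {w} → w ∈ M → ⟦ IsOmega 0F ⟧ᴹ (w ▹ ε₀) → w ≗ ω
    omegaᴹ⁻ i h = run do
      l , n ← ∧⁻ h
      return (MO.omega-unique i ω∈M (limitᴹ⁻ i l , λ x j m → n x (M-trans i j) j (limitᴹ⁺ (M-trans i j) m)) ω-omegaᴹ)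

    abs-nat : ∀ {n} {e : Env n} (k : Fin n) → e k ∈ M → Absolute (IsNat k) e
    abs-nat {e = e} k m =
      (λ h → isNat⁺ {e k} (run do
        w , i , h ← ∃∈⁻ h
        o , j ← ∧⁻ h
        return (∈-≗ʳ (omegaᴹ⁻ {w} i o) j))) ,ᴬ
      (λ h k′ → k′ ω ω∈M (∧⁺ (∧⁺ (limitᴹ⁺ ω∈M (proj₁ ω-omegaᴹ)) λ x x∈M i l → proj₂ ω-omegaᴹ x i (limitᴹ⁻ x∈M l)) (isNat⁻ {e k} h)))

    abs-numeral : ∀ {n} {e : Env n} k (i : Fin n) → e i ∈ M → Absolute (IsNumeral k i) e
    abs-numeral zero    i m = abs-∀∈ m λ d _ → abs-⊥
    abs-numeral {e = e} (suc k) i m = abs-∃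
      (λ d d∈M → abs-∧ (abs-numeral k 0F d∈M) (abs-∧ (id ,ᴬ id) (abs-∧ (abs-∀∈ d∈M λ _ _ → id ,ᴬ id)
        (abs-∀∈ m λ _ _ → abs-∨ (id ,ᴬ id) (id ,ᴬ id)))))
      (λ d h → run (∧⁻ h >>= λ (_ , h) → ∧⁻ h >>= λ (h , _) → return (M-trans m h)))

    upairᴬ : ∀ {n} {e : Env n} (z x y : Fin n) → e z ∈ M → Absolute (IsUPair z x y) e
    upairᴬ z x y m = abs-∧ (id ,ᴬ id) (abs-∧ (id ,ᴬ id) (abs-∀∈ m λ _ _ → abs-∨ (id ,ᴬ id) (id ,ᴬ id)))

    abs-opair : ∀ {n} {e : Env n} (p x y : Fin n) → e p ∈ M → Absolute (IsOPair p x y) e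
    abs-opair p x y m = abs-∃∈ m λ a i → abs-∃∈ m λ b j →
      abs-∧ (upairᴬ 1F (2 ↑ʳ x) (2 ↑ʳ x) (M-trans m i)) (abs-∧ (upairᴬ 0F (2 ↑ʳ x) (2 ↑ʳ y) (M-trans m j)) (upairᴬ (2 ↑ʳ p) 1F 0F m))

    abs-at : ∀ {n} {e : Env n} (f x y : Fin n) → e f ∈ M → Absolute (⟨ x , y ⟩∈̇ f) e
    abs-at f x y m = abs-∃∈ m λ p i → abs-opair 0F (suc x) (suc y) (M-trans m i)

    abs-node : ∀ {n} {e : Env n} k (c a b : Fin n) → e c ∈ M → Absolute (IsNode k c a b) e
    abs-node {e = e} k c a b m = abs-∃∃
      (λ x y i j → abs-∧ (abs-numeral k 1F i) (abs-∧ (abs-opair 0F (2 ↑ʳ a) (2 ↑ʳ b) j) (abs-opair (2 ↑ʳ c) 1F 0F m)))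
      (λ x y h → run do
        _ , h ← ∧⁻ h
        _ , h ← ∧⁻ h
        return (M-pair⁻ (M-≗ (opair⁻ {e c} {x} {y} h) m)))

    node-bound : ∀ {n} {e : Env n} k (c a b : Fin n) → e c ∈ M → ⟦ IsNode k c a b ⟧ e → e a ∈ M × e b ∈ M
    node-bound {e = e} k c a b m h = M-node⁻ k (M-≗ (node⁻ {e = e} k c a b h) m)

    abs-botCode : ∀ {n} {e : Env n} (c : Fin n) → e c ∈ M → Absolute (IsBotCode c) e
    abs-botCode {e = e} c m = abs-∃
      (λ d i → abs-∧ (abs-∀∈ i λ _ _ → abs-⊥) (abs-node 2 (suc c) 0F 0F m))
      (λ d h → run (∧⁻ h >>= λ (_ , h) → return (proj₁ (node-bound {e = d ▹ e} 2 (suc c) 0F 0F m h))))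

    abs-earlier : ∀ {n} {e : Env n} (g m a : Fin n) → e g ∈ M → e m ∈ M → Absolute (Earlier g m a) e
    abs-earlier g m a i j = abs-∃∈ j λ l k → abs-at (suc g) 0F (suc a) i

    abs-step : ∀ {n} {e : Env n} (N g m c : Fin n) → InM e → Absolute (FormationStep N g m c) e
    abs-step {e = e} N g m c h =
      abs-∨ (abs-∃∈ (h N) λ i _ → abs-∃∈ (h N) λ j _ → abs-node 0 (2 ↑ʳ c) 1F 0F (h c))
      (abs-∨ (abs-∃∈ (h N) λ i _ → abs-∃∈ (h N) λ j _ → abs-node 1 (2 ↑ʳ c) 1F 0F (h c))
      (abs-∨ (abs-botCode c (h c))
      (abs-∨
        (abs-∃∃ (λ a b i j → abs-∧ (abs-earlier (2 ↑ʳ g) (2 ↑ʳ m) 1F (h g) (h m))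
                              (abs-∧ (abs-earlier (2 ↑ʳ g) (2 ↑ʳ m) 0F (h g) (h m)) (abs-node 3 (2 ↑ʳ c) 1F 0F (h c))))
                (λ a b p → run (∧⁻ p >>= λ (_ , p) → ∧⁻ p >>= λ (_ , p) → return (node-bound {e = b ▹ a ▹ e} 3 (2 ↑ʳ c) 1F 0F (h c) p))))
        (abs-∃∈ (h N) λ i _ → abs-∃
          (λ b j → abs-∧ (abs-earlier (2 ↑ʳ g) (2 ↑ʳ m) 0F (h g) (h m)) (abs-node 4 (2 ↑ʳ c) 1F 0F (h c)))
          (λ b p → run (∧⁻ p >>= λ (_ , p) → return (proj₂ (node-bound {e = b ▹ i ▹ e} 4 (2 ↑ʳ c) 1F 0F (h c) p))))))))

    abs-∀⇔ : ∀ {n} {φ ψ : Formula (suc n)} {e} → (∀ d → d ∈ M → Absolute φ (d ▹ e)) → (∀ d → d ∈ M → Absolute ψ (d ▹ e)) →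
      (∀ d → ⟦ φ ⟧ (d ▹ e) → d ∈ M) → (∀ d → ⟦ ψ ⟧ (d ▹ e) → d ∈ M) → Absolute (∀̇ (φ ⇔ ψ)) e
    abs-∀⇔ {φ = φ} {ψ} a b c c′ =
      (λ f d k → k (λ p → let i = c d p in run ⦃ stable ψ ⦄ (∧⁻ (f d i) >>= λ (g , _) → return (out (b d i) (g (inn (a d i) p)))))
                   (λ p → let i = c′ d p in run ⦃ stable φ ⦄ (∧⁻ (f d i) >>= λ (_ , g) → return (out (a d i) (g (inn (b d i) p)))))) ,ᴬ
      (λ f d i → inn (abs-⇔ (a d i) (b d i)) (f d))

    abs-funOn : ∀ {n} {e : Env n} (f d : Fin n) → e f ∈ M → e d ∈ M → Absolute (IsFunOn f d) e
    abs-funOn {e = e} f d i j = abs-∧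
      (abs-∀∈ i λ p k → abs-∃∈ j λ x l → abs-∃ (λ v _ → abs-opair 2F 1F 0F (M-trans i k))
        (λ v h → proj₂ (M-pair⁻ (M-≗ (opair⁻ {p} {x} {v} h) (M-trans i k)))))
      (abs-∀∈ j λ x l → abs-∃
        (λ v v∈M → abs-∀⇔ (λ z _ → abs-at (3 ↑ʳ f) 2F 0F i) (λ _ _ → id ,ᴬ id)
          (λ z h → proj₂ (M-pair⁻ (M-trans i (at⁻ {e f} {x} {z} h)))) (λ z q → M-≗ (≗-sym q) v∈M))
        (λ v h → run (∧⁻ (h v) >>= λ (_ , g) → return (proj₂ (M-pair⁻ (M-trans i (at⁻ {e f} {x} {v} (g ≗-refl))))))))

    abs-formation : ∀ {n} {e : Env n} (N g : Fin n) → InM e → Absolute (IsFormation N g) e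
    abs-formation {e = e} N g h = abs-∃
      (λ n i → abs-∧ (abs-nat 0F i) (abs-∧ (abs-funOn (suc g) 0F (h g) i)
        (abs-∀∈ i λ m j → abs-∃
          (λ c k → abs-∧ (abs-at (3 ↑ʳ g) 1F 0F (h g)) (abs-step (3 ↑ʳ N) (3 ↑ʳ g) 1F 0F (k ▹ᴹ M-trans i j ▹ᴹ i ▹ᴹ h)))
          (λ c p → run (∧⁻ p >>= λ (p , _) → return (proj₂ (M-pair⁻ (M-trans (h g) (at⁻ {e g} {m} {c} p)))))))))
      (λ n p → run (∧⁻ p >>= λ (o , _) → return (M-nat (isNat⁻ {n} o))))

    abs-range : ∀ {n} {e : Env n} (g c : Fin n) → e g ∈ M → Absolute (InRange g c) e
    abs-range {e = e} g c i = abs-∃ (λ m _ → abs-at (suc g) 0F (suc c) i)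
      (λ m p → proj₁ (M-pair⁻ (M-trans i (at⁻ {e g} {m} {e c} p))))

    abs-form : ∀ {n} {e : Env n} (N c : Fin n) → InM e → Absolute (IsForm N c) e
    abs-form {e = e} N c h = abs-∃
      (λ g i → abs-∧ (abs-formation (suc N) 0F (i ▹ᴹ h)) (abs-range 0F (suc c) i))
      (λ g p → run do
        F , _ ← ∧⁻ p
        n , F ← formation⁻ {e = g ▹ e} (suc N) 0F F
        return (M-formation (h N) F))

    abs-fun : ∀ {n} {e : Env n} (f d y : Fin n) → InM e → Absolute (IsFun f d y) e
    abs-fun f d y h = absΔ (IsFun f d y) h

    abs-update : ∀ {n} {e : Env n} (k y t′ t i x : Fin n) → InM e → Absolute (IsUpdate k y t′ t i x) e
    abs-update k y t′ t i x h = absΔ (IsUpdate k y t′ t i x) h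

    -- The quantified codes are components of `c`, the quantified values occur in `t`, and updated
    -- assignments are finite functions; all of them lie in `M`.
    abs-tarski : ∀ {n} {e : Env n} (k y S c t : Fin n) → e k ∈ ω → InM e → Absolute (TarskiAt k y S c t) e
    abs-tarski {e = e} k y S c t k∈ω h =
      abs-∧ (abs-∀∀⇒ (λ i j _ _ → abs-node 0 (2 ↑ʳ c) 1F 0F (h c)) (λ i j → node-bound {e = j ▹ i ▹ e} 0 (2 ↑ʳ c) 1F 0F (h c))
        λ i j p q _ → abs-⇔ (abs-at (2 ↑ʳ S) (2 ↑ʳ c) (2 ↑ʳ t) (h S)) (abs-∃∃
          (λ u v _ _ → abs-∧ (abs-at (4 ↑ʳ t) 3F 1F (h t)) (abs-∧ (abs-at (4 ↑ʳ t) 2F 0F (h t)) (id ,ᴬ id)))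
          (λ u v r → values i j u v {1F ∈̇ 0F} r)))
      (abs-∧ (abs-∀∀⇒ (λ i j _ _ → abs-node 1 (2 ↑ʳ c) 1F 0F (h c)) (λ i j → node-bound {e = j ▹ i ▹ e} 1 (2 ↑ʳ c) 1F 0F (h c))
        λ i j p q _ → abs-⇔ (abs-at (2 ↑ʳ S) (2 ↑ʳ c) (2 ↑ʳ t) (h S)) (abs-∃∃
          (λ u v _ _ → abs-∧ (abs-at (4 ↑ʳ t) 3F 1F (h t)) (abs-∧ (abs-at (4 ↑ʳ t) 2F 0F (h t)) (id ,ᴬ id)))
          (λ u v r → values i j u v {1F ≐ 0F} r)))
      (abs-∧ (abs-⇒ (abs-botCode c (h c)) (abs-¬ (abs-at S c t (h S))))
      (abs-∧ (abs-∀∀⇒ (λ a b _ _ → abs-node 3 (2 ↑ʳ c) 1F 0F (h c)) (λ a b → node-bound {e = b ▹ a ▹ e} 3 (2 ↑ʳ c) 1F 0F (h c))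
        λ a b _ _ _ → abs-⇔ (abs-at (2 ↑ʳ S) (2 ↑ʳ c) (2 ↑ʳ t) (h S))
          (abs-⇒ (abs-at (2 ↑ʳ S) 1F (2 ↑ʳ t) (h S)) (abs-at (2 ↑ʳ S) 0F (2 ↑ʳ t) (h S))))
      (abs-∀∀⇒ (λ i b _ _ → abs-node 4 (2 ↑ʳ c) 1F 0F (h c)) (λ i b → node-bound {e = b ▹ i ▹ e} 4 (2 ↑ʳ c) 1F 0F (h c))
        λ i b i∈M b∈M _ → abs-⇔ (abs-at (2 ↑ʳ S) (2 ↑ʳ c) (2 ↑ʳ t) (h S))
          (abs-∀∈ (h y) λ x x∈y → abs-∀⇒
            (λ t′ t′∈M → abs-update (4 ↑ʳ k) (4 ↑ʳ y) 0F (4 ↑ʳ t) 3F 1F (t′∈M ▹ᴹ M-trans (h y) x∈y ▹ᴹ b∈M ▹ᴹ i∈M ▹ᴹ h))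
            (λ t′ u → run (∧⁻ u >>= λ (f , _) → return (M-fun k∈ω (h y) (fun⁻ {t′} {e k} {e y} f))))
            (λ t′ _ _ → abs-at (4 ↑ʳ S) 2F 0F (h S)))))))
      where
      values : ∀ i j u v {χ} → ⟦ ⟨ 3F , 1F ⟩∈̇ (4 ↑ʳ t) ∧̇ ⟨ 2F , 0F ⟩∈̇ (4 ↑ʳ t) ∧̇ χ ⟧ (v ▹ u ▹ j ▹ i ▹ e) → u ∈ M × v ∈ M
      values i j u v r = run do
        p , r ← ∧⁻ r
        q , _ ← ∧⁻ r
        return (proj₂ (M-pair⁻ (M-trans (h t) (at⁻ {e t} {i} {u} p))) , proj₂ (M-pair⁻ (M-trans (h t) (at⁻ {e t} {j} {v} q))))

    -- Downward absoluteness of satisfaction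

    FunctionSpace : (k y F : Carrier) → Set
    FunctionSpace k y F = ∀ t → t ∈ F ↔ Fun t k y

    function-space : ∀ {k y} → k ∈ ω → y ∈ M → ∥ Σ[ F ∈ Carrier ] F ∈ M × FunctionSpace k y F ∥
    function-space {k} {y} o i = do
        Z , Z∈M , z ← M-pairs (M-nat o) i
        P , P∈M , p ← M-power Z∈M
        return {Σ[ F ∈ Carrier ] F ∈ M × FunctionSpace k y F} (sep φ (k ▹ y ▹ ε₀) P , M-sep φ (k ▹ y ▹ ε₀) (M-nat o ▹ᴹ i ▹ᴹ εᴹ) P∈M , λ t →
          (λ j → fun⁻ {t} {k} {y} (proj₂ (∈sep⁻ φ j))) ,
          (λ f → ∈sep⁺ φ (p t (M-fun o i f) λ w j → run (proj₁ f w j >>= λ (x , v , l , m , q) →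
            return (∈-≗ˡ (≗-sym q) (z x v l m)))) (fun⁺ {t} {k} {y} f)))
      where
      φ : Formula 3
      φ = IsFun 0F 1F 2F

    Slice : (c W Z : Carrier) → Set
    Slice c W Z = ∀ p → p ∈ Z ↔ ∥ Σ[ t ∈ Carrier ] t ∈ W × p ≗ pair c t ∥

    M-slice : ∀ {c W} → c ∈ M → W ∈ M → ∥ Σ[ Z ∈ Carrier ] Z ∈ M × Slice c W Z ∥
    M-slice {c} {W} i j = do
        Z , Z∈M , z ← M-pairs (M-⁅⁆ i i) j
        return {Σ[ Z ∈ Carrier ] Z ∈ M × Slice c W Z} (sep φ (c ▹ W ▹ ε₀) Z , M-sep φ (c ▹ W ▹ ε₀) (i ▹ᴹ j ▹ᴹ εᴹ) Z∈M , λ p →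
          (λ l → ∃∈⁻ (proj₂ (∈sep⁻ φ {e = c ▹ W ▹ ε₀} l)) >>= λ (t , m , h) → return (t , m , opair⁻ {p} {c} {t} h)) ,
          (λ h → run (h >>= λ (t , m , q) →
            return (∈sep⁺ φ (∈-≗ˡ (≗-sym q) (z c t ∈⁅⁆₁ m)) (∃∈⁺ t m (opair⁺ {p} {c} {t} q))))))
      where
      φ : Formula 3
      φ = ∃∈ 2F (IsOPair 1F 2F 0F)

    -- S need not belong to M, but its restriction to the codes in g and the
    -- assignments k → y does: it is built in M along g, where Tarski's conditions
    -- define each new slice from the previous ones.
    module Restriction {k y g n S : Carrier} (k∈ω : k ∈ ω) (y∈M : y ∈ M) (Fg : Formation k g n)
      (τ : Satisfaction k y g S) where

      private
        g∈M : g ∈ M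
        g∈M = M-formation (M-nat k∈ω) Fg

        value∈M : ∀ {l a} → pair l a ∈ g → a ∈ M
        value∈M i = proj₂ (M-pair⁻ (M-trans g∈M i))

      module _ {F} (F∈M : F ∈ M) (fs : FunctionSpace k y F) where

        Covers : Carrier → Carrier → Set
        Covers j u = ∀ x c t → x ∈ j → pair x c ∈ g → t ∈ F → pair c t ∈ S → pair c t ∈ u

        Part : Carrier → Set
        Part j = Σ[ u ∈ Carrier ] u ∈ M × u ⊆ S × Covers j u

        TrueAt : Carrier → Set
        TrueAt c = Σ[ W ∈ Carrier ] W ∈ M × (∀ t → t ∈ W ↔ t ∈ F × pair c t ∈ S)

        true-at : ∀ {l c} (φ : Formula (suc l)) {δ : T (isΔ₀ φ)} (e : Env l) → InM e →
                  (∀ t → t ∈ F → ⟦ φ ⟧ (t ▹ e) ↔ pair c t ∈ S) → TrueAt c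
        true-at φ {δ} e m h = sep φ {δ} e F , M-sep φ e m F∈M , λ t →
          (λ i → let j , p = ∈sep⁻ φ i in j , proj₁ (h t j) p) , (λ (j , p) → ∈sep⁺ φ j (proj₂ (h t j) p))

        module _ {u i : Carrier} (u∈M : u ∈ M) (u⊆S : u ⊆ S) (cover : Covers i u) where

          agrees : ∀ {l a t} → l ∈ i → pair l a ∈ g → t ∈ F → pair a t ∈ u ↔ pair a t ∈ S
          agrees {l} {a} {t} p q r = u⊆S _ , cover l a t p q r

          -- Tarski's condition at `c`, read as a Δ₀ definition of the assignments that satisfy `c`.
          -- It mentions `S` only at earlier codes, where `agrees` lets `u` take its place; at a
          -- quantifier, `F` bounds the updated assignments.
          next : ∀ {c} → Range g c → Step k g i c → TrueAt c
          next {c} r (step-mem i j i∈k j∈k q) = true-at φ (i ▹ j ▹ y ▹ ε₀)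
              (M-trans (M-nat k∈ω) i∈k ▹ᴹ M-trans (M-nat k∈ω) j∈k ▹ᴹ y∈M ▹ᴹ εᴹ) λ t t∈F →
                let f = proj₁ (fs t) t∈F ; p , p′ = proj₁ (τ c r t f) i j q in
                (λ h → p′ (do
                  u , _ , h ← ∃∈⁻ h
                  v , _ , h ← ∃∈⁻ h
                  a , h ← ∧⁻ h
                  b , h ← ∧⁻ h
                  return (u , v , at⁻ {t} {i} {u} a , at⁻ {t} {j} {v} b , h))) ,
                (λ h k′ → p h λ (u , v , a , b , h) → k′ u (fun-codomain f a) λ k″ → k″ v (fun-codomain f b)
                  (∧⁺ (at⁺ {t} {i} {u} a) (∧⁺ (at⁺ {t} {j} {v} b) h)))
            where
            φ : Formula 4
            φ = ∃∈ 3F (∃∈ 4F (⟨ 3F , 1F ⟩∈̇ 2F ∧̇ ⟨ 4F , 0F ⟩∈̇ 2F ∧̇ 1F ∈̇ 0F))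
          next {c} r (step-eq i j i∈k j∈k q) = true-at φ (i ▹ j ▹ y ▹ ε₀)
              (M-trans (M-nat k∈ω) i∈k ▹ᴹ M-trans (M-nat k∈ω) j∈k ▹ᴹ y∈M ▹ᴹ εᴹ) λ t t∈F →
                let f = proj₁ (fs t) t∈F ; p , p′ = proj₁ (proj₂ (τ c r t f)) i j q in
                (λ h → p′ (do
                  u , _ , h ← ∃∈⁻ h
                  v , _ , h ← ∃∈⁻ h
                  a , h ← ∧⁻ h
                  b , h ← ∧⁻ h
                  return (u , v , at⁻ {t} {i} {u} a , at⁻ {t} {j} {v} b , h))) ,
                (λ h k′ → p h λ (u , v , a , b , h) → k′ u (fun-codomain f a) λ k″ → k″ v (fun-codomain f b)
                  (∧⁺ (at⁺ {t} {i} {u} a) (∧⁺ (at⁺ {t} {j} {v} b) h)))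
            where
            φ : Formula 4
            φ = ∃∈ 3F (∃∈ 4F (⟨ 3F , 1F ⟩∈̇ 2F ∧̇ ⟨ 4F , 0F ⟩∈̇ 2F ∧̇ 1F ≐ 0F))
          next {c} r (step-bot q) = true-at ⊥̇ ε₀ εᴹ λ t t∈F →
            efq , proj₁ (proj₂ (proj₂ (τ c r t (proj₁ (fs t) t∈F)))) q
          next {c} r (step-imp a b l l′ l∈i la l′∈i lb q) = true-at φ (a ▹ b ▹ u ▹ ε₀)
              (value∈M la ▹ᴹ value∈M lb ▹ᴹ u∈M ▹ᴹ εᴹ) λ t t∈F →
                let p , p′ = proj₁ (proj₂ (proj₂ (proj₂ (τ c r t (proj₁ (fs t) t∈F))))) a b q
                    h₁ , h₁′ = agrees l∈i la t∈F ; h₂ , h₂′ = agrees l′∈i lb t∈F in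
                (λ h → p′ λ s → h₂ (at⁻ {u} {b} {t} (h (at⁺ {u} {a} {t} (h₁′ s))))) ,
                (λ h s → at⁺ {u} {b} {t} (h₂′ (p h (h₁ (at⁻ {u} {a} {t} s)))))
            where
            φ : Formula 4
            φ = ⟨ 1F , 0F ⟩∈̇ 3F ⇒ ⟨ 2F , 0F ⟩∈̇ 3F
          next {c} r (step-all i b l i∈k l∈i lb q) = true-at φ (i ▹ b ▹ u ▹ k ▹ y ▹ F ▹ ε₀)
              (M-trans (M-nat k∈ω) i∈k ▹ᴹ value∈M lb ▹ᴹ u∈M ▹ᴹ M-nat k∈ω ▹ᴹ y∈M ▹ᴹ F∈M ▹ᴹ εᴹ) λ t t∈F →
                let p , p′ = proj₂ (proj₂ (proj₂ (proj₂ (τ c r t (proj₁ (fs t) t∈F))))) i b q in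
                (λ h → p′ λ x x∈y t′ up → let t′∈F = proj₂ (fs t′) (proj₁ up) in
                  u⊆S _ (at⁻ {u} {b} {t′} (h x x∈y t′ t′∈F (update⁺ {k} {y} {t′} {t} {i} {x} up)))) ,
                (λ h x x∈y t′ t′∈F up → at⁺ {u} {b} {t′} (proj₂ (agrees l∈i lb t′∈F)
                  (p h x x∈y t′ (update⁻ {k} {y} {t′} {t} {i} {x} up))))
            where
            φ : Formula 7
            φ = ∀∈ 5F (∀∈ 7F (IsUpdate 6F 7F 0F 2F 3F 1F ⇒ ⟨ 4F , 0F ⟩∈̇ 5F))

        private
          U : Carrier
          U = ⋃ (⋃ g)

          φ : Formula 6
          φ = ∃∈ 5F (0F ⊆̇ 3F ∧̇ ∀∈ 1F (∀∈ 6F (∀∈ 6F (⟨ 2F , 1F ⟩∈̇ 5F ⇒ ⟨ 1F , 0F ⟩∈̇ 6F ⇒ ⟨ 1F , 0F ⟩∈̇ 3F))))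

          e : Env 5
          e = g ▹ S ▹ F ▹ U ▹ M ▹ ε₀

          part⁻ : ∀ {j} → ⟦ φ ⟧ (j ▹ e) → ∥ Part j ∥
          part⁻ {j} h = do
            u , i , h ← ∃∈⁻ h
            s , c ← ∧⁻ h
            return {Part j} (u , i , s , λ x a t x∈j xa t∈F at → at⁻ {u} {a} {t}
              (c x x∈j a (proj₂ (field-∈ xa)) t t∈F (at⁺ {g} {x} {a} xa) (at⁺ {S} {a} {t} at)))

          part⁺ : ∀ {j} → ∥ Part j ∥ → ⟦ φ ⟧ (j ▹ e)
          part⁺ h k′ = h λ (u , i , s , c) → k′ u i (∧⁺ s λ x x∈j a _ t t∈F xa at →
            at⁺ {u} {a} {t} (c x a t x∈j (at⁻ {g} {x} {a} xa) t∈F (at⁻ {S} {a} {t} at)))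

          n∈ω : n ∈ ω
          n∈ω = proj₁ Fg

          extend-part : ∀ {β i} → β ≗ succ i → i ∈ n → Part i → ∥ Part β ∥
          extend-part {β} {i} p i∈n (u , u∈M , u⊆S , cover) = do
            c , ic , st ← proj₂ (proj₂ Fg) i i∈n
            let W , W∈M , w = next u∈M u⊆S cover (return (i , ic)) st
            Z , Z∈M , z ← M-slice (value∈M ic) W∈M
            -- The part built so far, enlarged by the slice of the new code `c`.
            return {Part β} (⋃ ⁅ u , Z ⁆ , M-⋃ (M-⁅⁆ u∈M Z∈M) ,
              (λ q j → run do
                A , A∈ , q∈A ← ∈⋃⁻ j
                d ← ∈⁅⁆⁻ A∈
                case d of λ where
                  (inj₁ r) → return (u⊆S q (∈-≗ʳ r q∈A))
                  (inj₂ r) → do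
                    t , t∈W , q≗ ← proj₁ (z q) (∈-≗ʳ r q∈A)
                    return (∈-≗ˡ (≗-sym q≗) (proj₂ (proj₁ (w t) t∈W)))) ,
              λ x a t x∈β xa t∈F at → run (∈adj⁻ (∈-≗ʳ p x∈β) >>= λ where
                (inj₁ x∈i) → return (∈⋃⁺ ∈⁅⁆₁ (cover x a t x∈i xa t∈F at))
                (inj₂ q)   → let a≗c = funOn-unique (proj₁ (proj₂ Fg)) (pair∈-cong q ≗-refl xa) ic in
                  return (∈⋃⁺ ∈⁅⁆₂ (proj₂ (z (pair a t)) (return (t , proj₂ (w t) (t∈F , pair∈-cong a≗c ≗-refl at) , pair-cong a≗c ≗-refl))))))

          part : ∀ j → j ∈ succ n → ∥ Part j ∥
          part j i = part⁻ {j} (ord-induction φ e (nat-ord (succ∈ω n∈ω)) (λ β m h → part⁺ {β} (go β m h)) j i)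
            where
            go : ∀ β → β ∈ succ n → (∀ γ → γ ∈ β → ⟦ φ ⟧ (γ ▹ e)) → ∥ Part β ∥
            go β m h = nat-case (ω-trans (succ∈ω n∈ω) m) >>= λ where
              (inj₁ p) → return {Part β} (∅ , M-∅ , (λ z l → efq (∉∅ l)) , λ x _ _ l _ _ _ → efq (∉∅ (∈-≗ʳ p l)))
              (inj₂ (i , i∈β , p)) → do
                v ← part⁻ {i} (h i i∈β)
                d ← ∈adj⁻ m
                extend-part p (case d of λ { (inj₁ l) → proj₁ (nat-ord n∈ω) β l i i∈β ; (inj₂ q) → ∈-≗ʳ q i∈β }) v

        restriction : ∥ Part n ∥
        restriction = part n ∈adj⁺ʳ

      Restricted : Set
      Restricted = Σ[ S′ ∈ Carrier ] S′ ∈ M × (∀ c t → Range g c → Fun t k y → pair c t ∈ S ↔ pair c t ∈ S′)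

      restricted : ∥ Restricted ∥
      restricted = do
        F , F∈M , fs ← function-space k∈ω y∈M
        S′ , S′∈M , s , c ← restriction F∈M fs
        return {Restricted} (S′ , S′∈M , λ a t r f →
          (λ h → run (r >>= λ (x , xa) → return (c x a t (funOn-domain (proj₁ (proj₂ Fg)) xa) xa (proj₂ (fs t) f) h))) , s _)

      -- Tarski's conditions at a code in the range of `g` refer only to codes in that range, by
      -- closure under subformulas, and there the two relations agree.
      restricted-satisfaction : ((S′ , _) : Restricted) → Satisfaction k y g S′
      restricted-satisfaction (S′ , _ , same) c r t f =
        let h₀ , h₁ , h₂ , h₃ , h₄ = τ c r t f ; p , p′ = same c t r f in
        (λ i j q → let a , b = h₀ i j q in (λ x → a (p′ x)) , λ x → p (b x)) ,
        (λ i j q → let a , b = h₁ i j q in (λ x → a (p′ x)) , λ x → p (b x)) ,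
        (λ q x → h₂ q (p′ x)) ,
        (λ a b q → let r₁ , r₂ = range-imp Fg r q ; f₁ , g₁ = same a t r₁ f ; f₂ , g₂ = same b t r₂ f ; h , h′ = h₃ a b q in
          (λ x z → f₂ (h (p′ x) (g₁ z))) , (λ x → p (h′ λ z → g₂ (x (f₁ z))))) ,
        (λ i b q → let _ , r₁ = range-all Fg r q ; h , h′ = h₄ i b q in
          (λ x z z∈y t′ u → proj₁ (same b t′ r₁ (proj₁ u)) (h (p′ x) z z∈y t′ u)) ,
          (λ x → p (h′ λ z z∈y t′ u → proj₂ (same b t′ r₁ (proj₁ u)) (x z z∈y t′ u))))

    -- Absoluteness of satisfaction and of definability

    abs-satisfaction : ∀ {n} {e : Env n} (k y g S : Fin n) → e k ∈ ω → InM e →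
      Absolute (∀̇ (InRange (suc g) 0F ⇒ ∀̇ (IsFun 0F (2 ↑ʳ k) (2 ↑ʳ y) ⇒ TarskiAt (2 ↑ʳ k) (2 ↑ʳ y) (2 ↑ʳ S) 1F 0F))) e
    abs-satisfaction {e = e} k y g S k∈ω h = abs-∀⇒
      (λ c _ → abs-range (suc g) 0F (h g))
      (λ c r → run (range⁻ {e g} {c} r >>= λ (m , i) → return (proj₂ (M-pair⁻ (M-trans (h g) i)))))
      λ c c∈M _ → abs-∀⇒
        (λ t t∈M → abs-fun 0F (2 ↑ʳ k) (2 ↑ʳ y) (t∈M ▹ᴹ c∈M ▹ᴹ h))
        (λ t f → M-fun k∈ω (h y) (fun⁻ {t} {e k} {e y} f))
        λ t t∈M _ → abs-tarski (2 ↑ʳ k) (2 ↑ʳ y) (2 ↑ʳ S) 1F 0F k∈ω (t∈M ▹ᴹ c∈M ▹ᴹ h)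

    -- Outwards the witnesses are kept. Inwards the formation sequence is in `M` by finiteness, and
    -- the satisfaction relation is exchanged for its restriction.
    abs-sat : ∀ {n} {e : Env n} (k y s c : Fin n) → InM e → Absolute (Sat k y s c) e
    abs-sat {e = e} k y s c h =
      abs-∧′ (abs-nat k (h k)) λ o → abs-∧′ (abs-fun s k y h) λ f → witnesses (isNat⁻ {e k} o) (fun⁻ {e s} {e k} {e y} f)
      where
      witnesses : e k ∈ ω → Fun (e s) (e k) (e y) → Absolute (∃̇ (IsFormation (suc k) 0F ∧̇ InRange 0F (suc c) ∧̇
         ∃̇ (∀̇ (InRange 2F 0F ⇒ ∀̇ (IsFun 0F (2 ↑ʳ (2 ↑ʳ k)) (2 ↑ʳ (2 ↑ʳ y)) ⇒ TarskiAt (2 ↑ʳ (2 ↑ʳ k)) (2 ↑ʳ (2 ↑ʳ y)) 2F 1F 0F)) ∧̇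
            ⟨ 2 ↑ʳ c , 2 ↑ʳ s ⟩∈̇ 0F))) e
      witnesses k∈ω sf =
        (λ p k′ → p λ g g∈M p → p λ F p → p λ r p → p λ S S∈M p → k′ g
          (∧⁺ (out (abs-formation (suc k) 0F (g∈M ▹ᴹ h)) F) (∧⁺ (out (abs-range {e = g ▹ e} 0F (suc c) g∈M) r)
            (∃⁺ S (out (inner g S g∈M S∈M) p))))) ,ᴬ
        (λ p k′ → p λ g p → p λ F p → p λ r p → p λ S p → p λ τ i → formation⁻ {e = g ▹ e} (suc k) 0F F λ (n , Fg) →
          let g∈M = M-formation (h k) Fg
              sat = satisfaction⁻ {e = S ▹ g ▹ e} (2 ↑ʳ k) (2 ↑ʳ y) 1F 0F τ
              module Rs = Restriction {e k} {e y} {g} {n} {S} k∈ω (h y) Fg sat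
          in Rs.restricted λ R@(S′ , S′∈M , same) →
            k′ g g∈M (∧⁺ (inn (abs-formation (suc k) 0F (g∈M ▹ᴹ h)) F) (∧⁺ (inn (abs-range {e = g ▹ e} 0F (suc c) g∈M) r)
              λ k″ → k″ S′ S′∈M (inn (inner g S′ g∈M S′∈M)
                (∧⁺ (satisfaction⁺ {e = S′ ▹ g ▹ e} (2 ↑ʳ k) (2 ↑ʳ y) 1F 0F (Rs.restricted-satisfaction R))
                    (in-S′ g S S′ same r i))))))
        where
        inner : ∀ g S → g ∈ M → S ∈ M →
          Absolute (∀̇ (InRange 2F 0F ⇒ ∀̇ (IsFun 0F (2 ↑ʳ (2 ↑ʳ k)) (2 ↑ʳ (2 ↑ʳ y)) ⇒ TarskiAt (2 ↑ʳ (2 ↑ʳ k)) (2 ↑ʳ (2 ↑ʳ y)) 2F 1F 0F)) ∧̇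
            ⟨ 2 ↑ʳ c , 2 ↑ʳ s ⟩∈̇ 0F) (S ▹ g ▹ e)
        inner g S g∈M S∈M = abs-∧ (abs-satisfaction (2 ↑ʳ k) (2 ↑ʳ y) 1F 0F k∈ω (S∈M ▹ᴹ g∈M ▹ᴹ h)) (abs-at 0F (2 ↑ʳ c) (2 ↑ʳ s) S∈M)
        in-S′ : ∀ g S S′ → (∀ c t → Range g c → Fun t (e k) (e y) → pair c t ∈ S ↔ pair c t ∈ S′) →
          ⟦ InRange 0F (suc c) ⟧ (g ▹ e) → ⟦ ⟨ 2 ↑ʳ c , 2 ↑ʳ s ⟩∈̇ 0F ⟧ (S ▹ g ▹ e) → ⟦ ⟨ 2 ↑ʳ c , 2 ↑ʳ s ⟩∈̇ 0F ⟧ (S′ ▹ g ▹ e)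
        in-S′ g S S′ same r i = at⁺ {S′} {e c} {e s} (proj₁ (same (e c) (e s) (range⁻ {g} {e c} r) sf) (at⁻ {S} {e c} {e s} i))

    -- In the environment x ▹ c ▹ s ▹ k ▹ e: (X , ∈) ⊨ c [ s(0 ↦ x) ]
    Defines : ∀ {n} → Fin n → Formula (suc (suc (suc (suc n))))
    Defines X = ∃̇ (∃̇ (IsNumeral 0 1F ∧̇ IsUpdate 5F (6 ↑ʳ X) 0F 4F 1F 2F ∧̇ Sat 5F (6 ↑ʳ X) 0F 3F))

    abs-defines : ∀ {n} (X : Fin n) {e x c s k} → k ∈ ω → InM (x ▹ c ▹ s ▹ k ▹ e) → Absolute (Defines X) (x ▹ c ▹ s ▹ k ▹ e)
    abs-defines X {e} {x} {c} {s} {k} k∈ω h = abs-∃∃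
      (λ i t i∈M t∈M → abs-∧ (abs-numeral 0 1F i∈M)
        (abs-∧ (abs-update 5F (6 ↑ʳ X) 0F 4F 1F 2F (t∈M ▹ᴹ i∈M ▹ᴹ h)) (abs-sat 5F (6 ↑ʳ X) 0F 3F (t∈M ▹ᴹ i∈M ▹ᴹ h))))
      (λ i t p → run do
        z , p ← ∧⁻ p
        u , _ ← ∧⁻ p
        f , _ ← ∧⁻ u
        return (M-≗ (≗-sym (empty≗∅ z)) M-∅ , M-fun k∈ω (h (4 ↑ʳ X)) (fun⁻ {t} {k} {e X} f)))

    DefinedWitness : (k X s c x : Carrier) → Set
    DefinedWitness k X s c x = Σ[ i ∈ Carrier ] Σ[ t ∈ Carrier ] i ≗ ∅ × Update k X t s i x × Satisfied k X t c

    defines⁻ : ∀ {n} (X : Fin n) {e x c s k} → ⟦ Defines X ⟧ (x ▹ c ▹ s ▹ k ▹ e) → ∥ DefinedWitness k (e X) s c x ∥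
    defines⁻ X {e} {x} {c} {s} {k} h = do
      i , h ← ∃⁻ h
      t , h ← ∃⁻ h
      z , h ← ∧⁻ h
      u , h ← ∧⁻ h
      return {DefinedWitness k (e X) s c x}
        (i , t , empty≗∅ z , update⁻ {k} {e X} {t} {s} {i} {x} u , sat⁻ {e = t ▹ i ▹ x ▹ c ▹ s ▹ k ▹ e} 5F (6 ↑ʳ X) 0F 3F h)

    defines⁺ : ∀ {n} (X : Fin n) {e x c s k} → ∥ DefinedWitness k (e X) s c x ∥ → ⟦ Defines X ⟧ (x ▹ c ▹ s ▹ k ▹ e)
    defines⁺ X {e} {x} {c} {s} {k} h k′ = h λ (i , t , z , u , r) → k′ i λ k″ → k″ t
      (∧⁺ (numeral⁺ {e = t ▹ i ▹ x ▹ c ▹ s ▹ k ▹ e} 0 1F z) (∧⁺ (update⁺ {k} {e X} {t} {s} {i} {x} u)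
        (sat⁺ {e = t ▹ i ▹ x ▹ c ▹ s ▹ k ▹ e} 5F (6 ↑ʳ X) 0F 3F r)))

    form-∈ : ∀ {k c} → k ∈ ω → ∥ IsForm′ k c ∥ → c ∈ M
    form-∈ o h = run do
      g , n , F , r ← h
      m , i ← r
      return (proj₂ (M-pair⁻ (M-trans (M-formation (M-nat o) F) i)))

    DefinableWitness : (z X k s c : Carrier) → Set
    DefinableWitness z X k s c = k ∈ ω × Fun s k X × ∥ IsForm′ k c ∥ ×
      (∀ x → x ∈ X → x ∈ z ↔ ∥ DefinedWitness k X s c x ∥)

    Definable : (z X : Carrier) → Set
    Definable z X = z ⊆ X × ∥ (Σ[ k ∈ Carrier ] Σ[ s ∈ Carrier ] Σ[ c ∈ Carrier ] DefinableWitness z X k s c) ∥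

    definable⁻ : ∀ {n} {e : Env n} (z X : Fin n) → ⟦ IsDefinable z X ⟧ e → ∥ Definable (e z) (e X) ∥
    definable⁻ {e = e} z X p = do
      z⊆X , p ← ∧⁻ p
      return {Definable (e z) (e X)} (z⊆X , do
        k , p ← ∃⁻ p
        s , p ← ∃⁻ p
        c , p ← ∃⁻ p
        o , p ← ∧⁻ p
        f , p ← ∧⁻ p
        F , p ← ∧⁻ p
        return {Σ[ k ∈ Carrier ] Σ[ s ∈ Carrier ] Σ[ c ∈ Carrier ] DefinableWitness (e z) (e X) k s c}
          (k , s , c , isNat⁻ {k} o , fun⁻ {s} {k} {e X} f , form⁻ {e = c ▹ s ▹ k ▹ e} 2F 0F F , λ x i →
            (λ j → run (∧⁻ (p x i) >>= λ (g , _) → return (defines⁻ X {e} {x} {c} {s} {k} (g j)))) ,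
            (λ d → run (∧⁻ (p x i) >>= λ (_ , g) → return (g (defines⁺ X {e} {x} {c} {s} {k} d))))))

    definable⁺ : ∀ {n} {e : Env n} (z X : Fin n) → Definable (e z) (e X) → ⟦ IsDefinable z X ⟧ e
    definable⁺ {e = e} z X (z⊆X , h) = ∧⁺ z⊆X λ k′ → h λ (k , s , c , o , f , F , q) → k′ k λ k″ → k″ s λ k‴ → k‴ c
      (∧⁺ (isNat⁺ {k} o) (∧⁺ (fun⁺ {s} {k} {e X} f) (∧⁺ (λ r → F λ F → form⁺ {e = c ▹ s ▹ k ▹ e} 2F 0F F r)
        λ x i → ∧⁺ (λ j → defines⁺ X {e} {x} {c} {s} {k} (proj₁ (q x i) j))
                   (λ d → proj₂ (q x i) (defines⁻ X {e} {x} {c} {s} {k} d)))))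

    -- Definability over `X` only refers to satisfaction in `X`, so separation in `M`, with code and
    -- assignment as parameters in `M`, recovers the same set.
    definable∈M : ∀ {z X} → X ∈ M → Definable z X → z ∈ M
    definable∈M {z} {X} i (z⊆X , p) = run do
      k , s , c , k∈ω , f , F , p ← p
      let h = form-∈ k∈ω F ▹ᴹ M-fun k∈ω i f ▹ᴹ M-nat k∈ω ▹ᴹ i ▹ᴹ εᴹ
      b , b∈M , q ← M-separation (Defines 0F) {c ▹ s ▹ k ▹ X ▹ ε₀} h i
      return (M-≗ (extensional
        (λ x x∈b → let x∈X , d = proj₁ (q x) x∈b in proj₂ (p x x∈X)
          (defines⁻ 0F {X ▹ ε₀} {x} {c} {s} {k} (out (abs-defines 0F {X ▹ ε₀} k∈ω (M-trans i x∈X ▹ᴹ h)) d)))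
        (λ x x∈z → let x∈X = z⊆X x x∈z in proj₂ (q x) (x∈X ,
          inn (abs-defines 0F {X ▹ ε₀} k∈ω (M-trans i x∈X ▹ᴹ h))
            (defines⁺ 0F {X ▹ ε₀} {x} {c} {s} {k} (proj₁ (p x x∈X) x∈z))))) b∈M)

    abs-definable : ∀ {n} {e : Env n} (z X : Fin n) → InM e → Absolute (IsDefinable z X) e
    abs-definable {e = e} z X h = abs-∧ (abs-∀∈ (h z) λ _ _ → id ,ᴬ id) (abs-∃
      (λ k k∈M → abs-∃ (λ s s∈M → abs-∃ (λ c c∈M → body (c∈M ▹ᴹ s∈M ▹ᴹ k∈M ▹ᴹ h))
        (λ c p → run do
          o , p ← ∧⁻ p
          _ , p ← ∧⁻ p
          F , _ ← ∧⁻ p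
          return (form-∈ (isNat⁻ {k} o) (form⁻ {e = c ▹ s ▹ k ▹ e} 2F 0F F))))
        (λ s p → run do
          c , p ← ∃⁻ p
          o , p ← ∧⁻ p
          f , _ ← ∧⁻ p
          return (M-fun (isNat⁻ {k} o) (h X) (fun⁻ {s} {k} {e X} f))))
      (λ k p → run do
        s , p ← ∃⁻ p
        c , p ← ∃⁻ p
        o , _ ← ∧⁻ p
        return (M-nat (isNat⁻ {k} o))))
      where
      body : ∀ {c s k} → InM (c ▹ s ▹ k ▹ e) →
        Absolute (IsNat 2F ∧̇ IsFun 1F 2F (3 ↑ʳ X) ∧̇ IsForm 2F 0F ∧̇ ∀∈ (3 ↑ʳ X) (0F ∈̇ (4 ↑ʳ z) ⇔ Defines X)) (c ▹ s ▹ k ▹ e)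
      body {c} {s} {k} h = abs-∧′ (abs-nat 2F (h 2F)) λ o → abs-∧ (abs-fun 1F 2F (3 ↑ʳ X) h) (abs-∧ (abs-form 2F 0F h)
        (abs-∀∈ (h (3 ↑ʳ X)) λ x i → abs-⇔ (id ,ᴬ id) (abs-defines X (isNat⁻ {k} o) (M-trans (h (3 ↑ʳ X)) i ▹ᴹ h))))

    IsDefOf : Carrier → Carrier → Set
    IsDefOf D X = ∀ z → z ∈ D ↔ ∥ Definable z X ∥

    def⁻ : ∀ {n} {e : Env n} (D X : Fin n) → ⟦ IsDef D X ⟧ e → IsDefOf (e D) (e X)
    def⁻ {e = e} D X h z =
      (λ i → ∧⁻ (h z) >>= λ (g , _) → definable⁻ {e = z ▹ e} 0F (suc X) (g i)) ,
      (λ d → run (∧⁻ (h z) >>= λ (_ , g) → d >>= λ d → return (g (definable⁺ {e = z ▹ e} 0F (suc X) d))))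

    def⁺ : ∀ {n} {e : Env n} (D X : Fin n) → IsDefOf (e D) (e X) → ⟦ IsDef D X ⟧ e
    def⁺ {e = e} D X h z = ∧⁺ (λ i → run ⦃ stable (IsDefinable 0F (suc X)) {z ▹ e} ⦄ (proj₁ (h z) i >>= λ d → return (definable⁺ {e = z ▹ e} 0F (suc X) d)))
      (λ d → proj₂ (h z) (definable⁻ {e = z ▹ e} 0F (suc X) d))

    abs-def : ∀ {n} {e : Env n} (D X : Fin n) → InM e → Absolute (IsDef D X) e
    abs-def {e = e} D X h = abs-∀⇔ {φ = 0F ∈̇ suc D} {IsDefinable 0F (suc X)} (λ z z∈M → id ,ᴬ id) (λ z z∈M → abs-definable {e = z ▹ e} 0F (suc X) (z∈M ▹ᴹ h))
      (λ z i → M-trans (h D) i) (λ z p → run (definable⁻ {e = z ▹ e} 0F (suc X) p >>= λ d → return (definable∈M (h X) d)))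

    -- All definable subsets of `X` are in `M`, and `M` recognises them; collecting them from the
    -- power set in `M` gives the Def(X) of the universe.
    def-exists : ∀ {X} → X ∈ M → ∥ Σ[ D ∈ Carrier ] D ∈ M × IsDefOf D X ∥
    def-exists {X} i = do
      P , P∈M , p ← M-power i
      D , D∈M , q ← M-separation (IsDefinable 0F 1F) {X ▹ ε₀} (i ▹ᴹ εᴹ) P∈M
      return {Σ[ D ∈ Carrier ] D ∈ M × IsDefOf D X} (D , D∈M , λ z →
        (λ z∈D → definable⁻ {e = z ▹ X ▹ ε₀} 0F 1F (out (abs-definable {e = z ▹ X ▹ ε₀} 0F 1F (M-trans D∈M z∈D ▹ᴹ i ▹ᴹ εᴹ)) (proj₂ (proj₁ (q z) z∈D)))) ,
        (λ d → run do
          d ← d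
          let z∈M = definable∈M i d
          return (proj₂ (q z) (p z z∈M (proj₁ d) , inn (abs-definable {e = z ▹ X ▹ ε₀} 0F 1F (z∈M ▹ᴹ i ▹ᴹ εᴹ)) (definable⁺ {e = z ▹ X ▹ ε₀} 0F 1F d)))))

    def-unique : ∀ {D E X} → IsDefOf D X → IsDefOf E X → D ≗ E
    def-unique p q = extensional (λ z i → proj₂ (q z) (proj₁ (p z) i)) (λ z i → proj₂ (p z) (proj₁ (q z) i))

    -- The constructible hierarchy

    LimitUnion : (f β w : Carrier) → Set
    LimitUnion f β w = Σ[ η ∈ Carrier ] Σ[ Z ∈ Carrier ] η ∈ β × pair η Z ∈ f × w ∈ Z

    SuccStage : (f η Y : Carrier) → Set
    SuccStage f η Y = Σ[ Z ∈ Carrier ] pair η Z ∈ f × IsDefOf Y Z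

    LStep : (f β Y : Carrier) → Set
    LStep f β Y = (β ≗ ∅ → Y ≗ ∅) × (∀ η → β ≗ succ η → ∥ SuccStage f η Y ∥) ×
      (Limit V β → ∀ w → w ∈ Y ↔ ∥ LimitUnion f β w ∥)

    lclause⁻ : ∀ {n} {e : Env n} (f β Y : Fin n) → ⟦ LClause f β Y ⟧ e → ∥ LStep (e f) (e β) (e Y) ∥
    lclause⁻ {e = e} f β Y h = do
      z , h ← ∧⁻ h
      s , l ← ∧⁻ h
      return {LStep (e f) (e β) (e Y)} (
        (λ p → empty≗∅ (z λ d i → ∉∅ (∈-≗ʳ p i))) ,
        (λ η p → do
          Z , h ← ∃⁻ (s η (suc⁺ {e β} {η} p))
          a , d ← ∧⁻ h
          return {SuccStage (e f) η (e Y)} (Z , at⁻ {e f} {η} {Z} a , def⁻ {e = Z ▹ η ▹ e} (2 ↑ʳ Y) 0F d)) ,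
        (λ m w →
          (λ i → do
            g , _ ← ∧⁻ (l (limit⁺ {e β} m) w)
            η , j , h ← ∃∈⁻ (g i)
            Z , h ← ∃⁻ h
            a , k ← ∧⁻ h
            return {LimitUnion (e f) (e β) w} (η , Z , j , at⁻ {e f} {η} {Z} a , k)) ,
          (λ h → run (∧⁻ (l (limit⁺ {e β} m) w) >>= λ (_ , g) → return (g λ k → h λ (η , Z , j , a , i) →
            k η j λ k → k Z (∧⁺ (at⁺ {e f} {η} {Z} a) i))))))

    lclause⁺ : ∀ {n} {e : Env n} (f β Y : Fin n) → LStep (e f) (e β) (e Y) → ⟦ LClause f β Y ⟧ e
    lclause⁺ {e = e} f β Y (z , s , l) = ∧⁺ (λ p d i → ∉∅ (∈-≗ʳ (z (empty≗∅ p)) i))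
      (∧⁺ (λ η p k → s η (suc⁻ {e β} {η} p) λ (Z , a , d) → k Z (∧⁺ (at⁺ {e f} {η} {Z} a) (def⁺ {e = Z ▹ η ▹ e} (2 ↑ʳ Y) 0F d)))
          (λ m w → ∧⁺
            (λ i k → proj₁ (l (limit⁻ {e β} m) w) i λ (η , Z , j , a , w∈Z) → k η j λ k → k Z (∧⁺ (at⁺ {e f} {η} {Z} a) w∈Z))
            (λ h → proj₂ (l (limit⁻ {e β} m) w) (do
              η , j , h ← ∃∈⁻ h
              Z , h ← ∃⁻ h
              a , k ← ∧⁻ h
              return {LimitUnion (e f) (e β) w} (η , Z , j , at⁻ {e f} {η} {Z} a , k)))))

    LStage : (f ξ : Carrier) → Set
    LStage f ξ = Σ[ Y ∈ Carrier ] pair ξ Y ∈ f × LStep f ξ Y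

    LSequence : (f θ : Carrier) → Set
    LSequence f θ = FunOn f θ × (∀ ξ → ξ ∈ θ → ∥ LStage f ξ ∥)

    lsequence-cong : ∀ {f θ θ′} → θ ≗ θ′ → LSequence f θ → LSequence f θ′
    lsequence-cong p ((a , b) , c) =
      ((λ q j → a q j >>= λ (x , v , k , r) → return (x , v , ∈-≗ʳ p k , r)) , (λ x j → b x (∈-≗ʳ (≗-sym p) j))) ,
      (λ ξ j → c ξ (∈-≗ʳ (≗-sym p) j))

    LWitness : (X α : Carrier) → Set
    LWitness X α = Σ[ θ ∈ Carrier ] Σ[ f ∈ Carrier ] θ ≗ succ α × LSequence f θ × pair α X ∈ f

    LBody : ∀ {n} → Fin n → Fin n → Formula (suc (suc n))
    LBody X α = IsSuc 1F (2 ↑ʳ α) ∧̇ IsFunOn 0F 1F ∧̇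
      ∀∈ 1F (∃̇ (⟨ 1F , 0F ⟩∈̇ 2F ∧̇ LClause 2F 1F 0F)) ∧̇ ⟨ 2 ↑ʳ α , 2 ↑ʳ X ⟩∈̇ 0F

    lbody⁻ : ∀ {n} (X α : Fin n) {f θ e} → ⟦ LBody X α ⟧ (f ▹ θ ▹ e) → ∥ LWitness (e X) (e α) ∥
    lbody⁻ X α {f} {θ} {e} h = do
      s , h ← ∧⁻ h
      F , h ← ∧⁻ h
      l , i ← ∧⁻ h
      return {LWitness (e X) (e α)} (θ , f , suc⁻ {θ} {e α} s , (funOn⁻ {f} {θ} F , λ ξ j → do
        Y , h ← ∃⁻ (l ξ j)
        a , h ← ∧⁻ h
        c ← lclause⁻ {e = Y ▹ ξ ▹ f ▹ θ ▹ e} 2F 1F 0F h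
        return {LStage f ξ} (Y , at⁻ {f} {ξ} {Y} a , c)) , at⁻ {f} {e α} {e X} i)

    lbody⁺ : ∀ {n} (X α : Fin n) {f θ e} → θ ≗ succ (e α) → LSequence f θ → pair (e α) (e X) ∈ f → ⟦ LBody X α ⟧ (f ▹ θ ▹ e)
    lbody⁺ X α {f} {θ} {e} p (F , l) i = ∧⁺ (suc⁺ {θ} {e α} p) (∧⁺ (funOn⁺ {f} {θ} F) (∧⁺
      (λ ξ j k → l ξ j λ (Y , a , c) → k Y (∧⁺ (at⁺ {f} {ξ} {Y} a) (lclause⁺ {e = Y ▹ ξ ▹ f ▹ θ ▹ e} 2F 1F 0F c)))
      (at⁺ {f} {e α} {e X} i)))

    isL⁻ : ∀ {n} {e : Env n} (X α : Fin n) → ⟦ IsL X α ⟧ e → ∥ LWitness (e X) (e α) ∥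
    isL⁻ {e = e} X α h = do
      θ , h ← ∃⁻ h
      f , h ← ∃⁻ h
      lbody⁻ X α {f} {θ} {e} h

    def-cong : ∀ {D X X′} → X ≗ X′ → IsDefOf D X → IsDefOf D X′
    def-cong {D} {X} {X′} p d =
      def⁻ {e = X′ ▹ D ▹ ε₀} 1F 0F (≗-subst (IsDef 1F 0F) (D ▹ ε₀) {X} {X′} p (def⁺ {e = X ▹ D ▹ ε₀} 1F 0F d))

    ord-cong : ∀ {α β} → α ≗ β → Ord V α → Ord V β
    ord-cong {α} {β} p o = ord⁻ {β} (≗-subst (IsOrd 0F) ε₀ p (ord⁺ {α} o))

    ord-∈succ : ∀ {α ξ} → Ord V α → ξ ∈ succ α → ∥ Ord V ξ ∥
    ord-∈succ o i = ∈adj⁻ i >>= λ where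
      (inj₁ j) → return (VO.ord-∈ tt o j)
      (inj₂ p) → return (ord-cong (≗-sym p) o)

    succ-transitive : ∀ {α} → Transitive α → Transitive (succ α)
    succ-transitive t x i y j = run (∈adj⁻ i >>= λ where
      (inj₁ k) → return (∈adj⁺ˡ (t x k y j))
      (inj₂ p) → return (∈adj⁺ˡ (∈-≗ʳ p j)))

    -- The two sequences are compared by Δ₀ induction, their values being bounded by the double
    -- unions of `f` and `f′`.
    module Uniqueness {α f f′ : Carrier} (o : Ord V α) (Lf : LSequence f (succ α)) (Lf′ : LSequence f′ (succ α)) where

      private
        AgreeAt : Carrier → Set
        AgreeAt ζ = ∀ Y Y′ → pair ζ Y ∈ f → pair ζ Y′ ∈ f′ → Y ≗ Y′

        below : ∀ {ζ η} → ζ ∈ succ α → η ∈ ζ → η ∈ succ α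
        below i j = succ-transitive (proj₁ o) _ i _ j

        union-⊆ : ∀ {g g′ ζ w} → FunOn g′ (succ α) → ζ ∈ succ α →
          (∀ η → η ∈ ζ → ∀ Z Z′ → pair η Z ∈ g → pair η Z′ ∈ g′ → Z ≗ Z′) → LimitUnion g ζ w → ∥ LimitUnion g′ ζ w ∥
        union-⊆ {g} {g′} {ζ} {w} F i h (η , Z , j , a , w∈Z) = do
          Z′ , a′ , _ ← proj₂ F η (below i j)
          return {LimitUnion g′ ζ w} (η , Z′ , j , a′ , ∈-≗ʳ (h η j Z Z′ a a′) w∈Z)

        agree-step : ∀ ζ → ζ ∈ succ α → (∀ η → η ∈ ζ → AgreeAt η) → AgreeAt ζ
        agree-step ζ i h Y Y′ a a′ = run do
          Y₁ , b , z , s , l ← proj₂ Lf ζ i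
          Y₁′ , b′ , z′ , s′ , l′ ← proj₂ Lf′ ζ i
          oζ ← ord-∈succ o i
          c ← ord-case oζ
          let Y≗ = funOn-unique (proj₁ Lf) a b ; Y′≗ = funOn-unique (proj₁ Lf′) a′ b′
              finish : Y₁ ≗ Y₁′ → Y ≗ Y′
              finish q = ≗-trans Y≗ (≗-trans q (≗-sym Y′≗))
          case c of λ where
            (is-empty p) → return (finish (≗-trans (z p) (≗-sym (z′ p))))
            (is-succ η j p) → do
              Z , u , d ← s η p
              Z′ , u′ , d′ ← s′ η p
              return (finish (def-unique (def-cong (h η j Z Z′ u u′) d) d′))
            (is-limit m) → return (finish (extensional
              (λ w k → proj₂ (l′ m w) (proj₁ (l m w) k >>= union-⊆ (proj₁ Lf′) i h))
              (λ w k → proj₂ (l m w) (proj₁ (l′ m w) k >>= union-⊆ (proj₁ Lf) i λ η j Z′ Z u′ u → ≗-sym (h η j Z Z′ u u′)))))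

        φ : Formula 5
        φ = ∀∈ 3F (∀∈ 5F (⟨ 2F , 1F ⟩∈̇ 3F ⇒ ⟨ 2F , 0F ⟩∈̇ 4F ⇒ 1F ≐ 0F))

        e : Env 4
        e = f ▹ f′ ▹ ⋃ (⋃ f) ▹ ⋃ (⋃ f′) ▹ ε₀

        agree⁻ : ∀ {ζ} → ⟦ φ ⟧ (ζ ▹ e) → AgreeAt ζ
        agree⁻ {ζ} h Y Y′ a a′ = h Y (proj₂ (field-∈ a)) Y′ (proj₂ (field-∈ a′)) (at⁺ {f} {ζ} {Y} a) (at⁺ {f′} {ζ} {Y′} a′)

        agree⁺ : ∀ {ζ} → AgreeAt ζ → ⟦ φ ⟧ (ζ ▹ e)
        agree⁺ {ζ} h Y _ Y′ _ a a′ = h Y Y′ (at⁻ {f} {ζ} {Y} a) (at⁻ {f′} {ζ} {Y′} a′)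

        agree-below : ∀ ζ → ζ ∈ α → AgreeAt ζ
        agree-below ζ i = agree⁻ {ζ} (ord-induction φ e o
          (λ β j h → agree⁺ {β} (agree-step β (∈adj⁺ˡ j) λ η k → agree⁻ {η} (h η k))) ζ i)

      sequences-agree : AgreeAt α
      -- The induction covers the members of α; one further step reaches α itself.
      sequences-agree = agree-step α ∈adj⁺ʳ agree-below

    -- The recursion clause at ζ looks up values only at arguments below ζ.
    lstep-restrict : ∀ {f h ζ Y} → (∀ η Z → η ∈ ζ → pair η Z ∈ f ↔ pair η Z ∈ h) → LStep f ζ Y → LStep h ζ Y
    lstep-restrict {f} {h} {ζ} {Y} r (z , s , l) = z ,
      (λ η p → s η p >>= λ (Z , a , d) → return {SuccStage h η Y} (Z , proj₁ (r η Z (∈-≗ʳ (≗-sym p) ∈adj⁺ʳ)) a , d)) ,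
      (λ m w →
        (λ i → proj₁ (l m w) i >>= λ (η , Z , j , a , k) → return {LimitUnion h ζ w} (η , Z , j , proj₁ (r η Z j) a , k)) ,
        (λ u → proj₂ (l m w) (u >>= λ (η , Z , j , a , k) → return {LimitUnion f ζ w} (η , Z , j , proj₂ (r η Z j) a , k))))

    -- Absoluteness of the hierarchy

    abs-suc : ∀ {n} {e : Env n} (z x : Fin n) → e z ∈ M → e x ∈ M → Absolute (IsSuc z x) e
    abs-suc z x i j = abs-∧ (id ,ᴬ id) (abs-∧ (abs-∀∈ j λ _ _ → id ,ᴬ id) (abs-∀∈ i λ _ _ → abs-∨ (id ,ᴬ id) (id ,ᴬ id)))

    -- `M` tests only its own sets for minima and might accept a set as an ordinal that is none in
    -- the universe; hence the hypothesis `Ord V`.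
    abs-limit : ∀ {n} {e : Env n} (β : Fin n) → e β ∈ M → Ord V (e β) → Absolute (IsLimit β) e
    abs-limit {e = e} β i o = (λ l → limit⁺ {e β} (limit-V o (limitᴹ⁻ {e β} i l))) ,ᴬ (λ l → limitᴹ⁺ {e β} i (limit-K (limit⁻ {e β} l)))

    abs-lclause : ∀ {n} {e : Env n} (f β Y : Fin n) → InM e → Ord V (e β) → Absolute (LClause f β Y) e
    abs-lclause {e = e} f β Y h o =
      abs-∧ (abs-⇒ (abs-∀∈ (h β) λ _ _ → abs-⊥) (abs-∀∈ (h Y) λ _ _ → abs-⊥))
      (abs-∧ (abs-∀⇒ (λ η i → abs-suc (suc β) 0F (h β) i)
          (λ η p → M-trans (h β) (∈-≗ʳ (≗-sym (suc⁻ {e β} {η} p)) ∈adj⁺ʳ))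
          λ η i _ → abs-∃ (λ Z j → abs-∧ (abs-at {e = Z ▹ η ▹ e} (2 ↑ʳ f) 1F 0F (h f)) (abs-def {e = Z ▹ η ▹ e} (2 ↑ʳ Y) 0F (j ▹ᴹ i ▹ᴹ h)))
            (λ Z p → run (∧⁻ p >>= λ (a , _) → return (proj₂ (M-pair⁻ (M-trans (h f) (at⁻ {e f} {η} {Z} a)))))))
        (abs-⇒ (abs-limit {e = e} β (h β) o) (abs-∀⇔
          (λ w _ → id ,ᴬ id)
          (λ w _ → abs-∃∈ (h β) λ η i → abs-∃ (λ Z j → abs-∧ (abs-at {e = Z ▹ η ▹ w ▹ e} (3 ↑ʳ f) 1F 0F (h f)) (id ,ᴬ id))
            (λ Z p → run (∧⁻ p >>= λ (a , _) → return (proj₂ (M-pair⁻ (M-trans (h f) (at⁻ {e f} {η} {Z} a)))))))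
          (λ w i → M-trans (h Y) i)
          (λ w p → run do
            η , _ , p ← ∃∈⁻ p
            Z , p ← ∃⁻ p
            a , i ← ∧⁻ p
            return (M-trans (proj₂ (M-pair⁻ (M-trans (h f) (at⁻ {e f} {η} {Z} a)))) i)))))

    abs-lbody : ∀ {n} (X α : Fin n) {f θ e} → InM (f ▹ θ ▹ e) → Ord V (e α) → Absolute (LBody X α) (f ▹ θ ▹ e)
    abs-lbody X α {f} {θ} {e} h o = abs-∧′ (abs-suc {e = f ▹ θ ▹ e} 1F (2 ↑ʳ α) (h 1F) (h (2 ↑ʳ α))) λ s →
      abs-∧ (abs-funOn {e = f ▹ θ ▹ e} 0F 1F (h 0F) (h 1F)) (abs-∧
        (abs-∀∈ (h 1F) λ ξ i → stage ξ i (ord-∈succ o (∈-≗ʳ (suc⁻ {θ} {e α} s) i)))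
        (abs-at {e = f ▹ θ ▹ e} 0F (2 ↑ʳ α) (2 ↑ʳ X) (h 0F)))
      where
      -- That ξ is an ordinal is known only under `∥_∥`. It can be unwrapped separately in each
      -- direction, because an existential formula is a function into `R`.
      stage : ∀ ξ → ξ ∈ θ → ∥ Ord V ξ ∥ → Absolute (∃̇ (⟨ 1F , 0F ⟩∈̇ 2F ∧̇ LClause 2F 1F 0F)) (ξ ▹ f ▹ θ ▹ e)
      stage ξ i oξ = (λ p k → oξ λ oξ → out (with-ord oξ) p k) ,ᴬ (λ p k → oξ λ oξ → inn (with-ord oξ) p k)
        where
        with-ord : Ord V ξ → Absolute (∃̇ (⟨ 1F , 0F ⟩∈̇ 2F ∧̇ LClause 2F 1F 0F)) (ξ ▹ f ▹ θ ▹ e)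
        with-ord oξ = abs-∃
          (λ Y j → abs-∧ (abs-at {e = Y ▹ ξ ▹ f ▹ θ ▹ e} 2F 1F 0F (h 0F))
            (abs-lclause {e = Y ▹ ξ ▹ f ▹ θ ▹ e} 2F 1F 0F (j ▹ᴹ M-trans (h 1F) i ▹ᴹ h) oξ))
          (λ Y p → run (∧⁻ p >>= λ (a , _) → return (proj₂ (M-pair⁻ (M-trans (h 0F) (at⁻ {f} {ξ} {Y} a))))))

    isLᴹ⁻ : ∀ {n} {e : Env n} (X α : Fin n) → InM e → Ord V (e α) → ⟦ IsL X α ⟧ᴹ e → ∥ LWitness (e X) (e α) ∥
    isLᴹ⁻ {e = e} X α h o p = do
      θ , i , p ← ∃∈⁻ p
      f , j , p ← ∃∈⁻ p
      lbody⁻ X α {f} {θ} {e} (out (abs-lbody X α {f} {θ} {e} (j ▹ᴹ i ▹ᴹ h) o) p)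

    isLᴹ⁺ : ∀ {n} {e : Env n} (X α : Fin n) {f} → InM e → Ord V (e α) → f ∈ M → LSequence f (succ (e α)) → pair (e α) (e X) ∈ f → ⟦ IsL X α ⟧ᴹ e
    isLᴹ⁺ {e = e} X α {f} h o f∈M L i k = k (succ (e α)) θ∈M λ k → k f f∈M
        (inn (abs-lbody X α {f} {succ (e α)} {e} (f∈M ▹ᴹ θ∈M ▹ᴹ h) o) (lbody⁺ X α {f} {succ (e α)} {e} ≗-refl L i))
      where
      θ∈M : succ (e α) ∈ M
      θ∈M = M-adj (h α) (h α)

    -- The initial segments of a constructible sequence belong to M

    -- p = (η , L_η), where p and η are the first two variables
    Stage-L : ∀ {n} → Formula (suc (suc n))
    Stage-L = ∃̇ (IsOPair 1F 2F 0F ∧̇ IsL 0F 2F)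

    stage-L⁻ : ∀ {n} {ρ : Env n} {z η} → InM ρ → z ∈ M → η ∈ M → Ord V η → ⟦ Stage-L ⟧ᴹ (z ▹ η ▹ ρ) →
               ∥ (Σ[ Y ∈ Carrier ] z ≗ pair η Y × LWitness Y η) ∥
    stage-L⁻ {ρ = ρ} {z} {η} ρ∈M z∈M η∈M oη h = do
      Y , Y∈M , h ← ∃∈⁻ h
      p , l ← ∧⁻ h
      w ← isLᴹ⁻ {e = Y ▹ z ▹ η ▹ ρ} 0F 2F (Y∈M ▹ᴹ z∈M ▹ᴹ η∈M ▹ᴹ ρ∈M) oη l
      return {Σ[ Y ∈ Carrier ] z ≗ pair η Y × LWitness Y η}
        (Y , opair⁻ {z} {η} {Y} (out (abs-opair {e = Y ▹ z ▹ η ▹ ρ} 1F 2F 0F z∈M) p) , w)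

    stage-L⁺ : ∀ {n} {ρ : Env n} {z η Y h} → InM ρ → z ∈ M → η ∈ M → Y ∈ M → Ord V η → z ≗ pair η Y → h ∈ M → LSequence h (succ η) → pair η Y ∈ h →
               ⟦ Stage-L ⟧ᴹ (z ▹ η ▹ ρ)
    stage-L⁺ {ρ = ρ} {z} {η} {Y} {h} ρ∈M z∈M η∈M Y∈M oη p h∈M Lh i k = k Y Y∈M (∧⁺
      (inn (abs-opair {e = Y ▹ z ▹ η ▹ ρ} 1F 2F 0F z∈M) (opair⁺ {z} {η} {Y} p))
      (isLᴹ⁺ {e = Y ▹ z ▹ η ▹ ρ} 0F 2F {h} (Y∈M ▹ᴹ z∈M ▹ᴹ η∈M ▹ᴹ ρ∈M) oη h∈M Lh i))

    -- By induction on ξ the restriction of f to ξ + 1 belongs to M.  At ξ,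
    -- replacement in M applies to the formula IsL: its solutions in M are values of
    -- f by uniqueness in the universe, and they exist by the induction hypothesis.
    module Segments {γ f : Carrier} (o : Ord V γ) (γ∈M : γ ∈ M) (L : LSequence f (succ γ)) where

      private
        F : FunOn f (succ γ)
        F = proj₁ L

        below : ∀ {ξ η} → ξ ∈ succ γ → η ∈ ξ → η ∈ succ γ
        below i j = succ-transitive (proj₁ o) _ i _ j

        θ-∈M : ∀ {ξ} → ξ ∈ succ γ → ξ ∈ M
        θ-∈M = M-trans (M-adj γ∈M γ∈M)

        -- h is the restriction of f to the arguments in d
        IsSegment : (d h : Carrier) → Set
        IsSegment d h = h ∈ M × h ⊆ f × (∀ η Y → pair η Y ∈ f → pair η Y ∈ h ↔ η ∈ d)

        Segment : Carrier → Set
        Segment d = Σ Carrier (IsSegment d)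

        -- A restriction still obeys the clauses, since these look only downwards; so a segment
        -- lying in `M` witnesses `IsL` there.
        segment-sequence : ∀ {ξ h} → ξ ∈ succ γ → IsSegment (succ ξ) h → LSequence h (succ ξ)
        segment-sequence {ξ} {h} i (_ , s , r) =
            ( (λ p j → proj₁ F p (s p j) >>= λ (x , v , _ , q) →
                 return (x , v , proj₁ (r x v (∈-≗ˡ q (s p j))) (∈-≗ˡ q j) , q))
            , (λ x j → proj₂ F x (into j) >>= λ (v , a , u) →
                 return (v , proj₂ (r x v a) j , λ v′ a′ → u v′ (s _ a′))) )
          , λ ζ j → proj₂ L ζ (into j) >>= λ (Y , a , l) → return {LStage h ζ} (Y , proj₂ (r ζ Y a) j ,
              lstep-restrict (λ η Z k → (λ b → proj₂ (r η Z b) (trans-succ j k)) , s _) l)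
          where
          into : ∀ {x} → x ∈ succ ξ → x ∈ succ γ
          into j = run (∈adj⁻ j >>= λ where
            (inj₁ k) → return (below i k)
            (inj₂ p) → return (∈-≗ˡ (≗-sym p) i))
          trans-succ : ∀ {ζ η} → ζ ∈ succ ξ → η ∈ ζ → η ∈ succ ξ
          trans-succ {ζ} {η} j k = run (∈adj⁻ j >>= λ where
            (inj₁ l) → ord-∈succ o i >>= λ oξ → return (∈adj⁺ˡ (proj₁ oξ ζ l η k))
            (inj₂ p) → return (∈adj⁺ˡ (∈-≗ʳ p k)))

        unique : ∀ {η Y Y′ h} → Ord V η → LSequence h (succ η) → pair η Y ∈ h → LWitness Y′ η → Y′ ≗ Y
        unique {η} {Y} {Y′} {h} oη Lh i (θ , f′ , p , L′ , i′) =
          Uniqueness.sequences-agree {η} {f′} {h} oη (lsequence-cong p L′) Lh Y′ Y i′ i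


        module _ {ξ : Carrier} (i : ξ ∈ succ γ) (ih : ∀ η → η ∈ ξ → ∥ Segment (succ η) ∥) where

          functional : ∀ η → η ∈ ξ → ∥ (Σ[ w ∈ Carrier ] w ∈ M × (∀ z → z ∈ M → ⟦ Stage-L ⟧ᴹ (z ▹ η ▹ ε₀) ↔ z ≗ w)) ∥
          functional η j = do
            h , seg@(h∈M , s , r) ← ih η j
            Y , a , _ ← proj₂ F η (below i j)
            oη ← ord-∈succ o (below i j)
            let Lh  = segment-sequence (below i j) seg
                a′  = proj₂ (r η Y a) ∈adj⁺ʳ
                p∈M = M-trans h∈M a′
                η∈M , Y∈M = M-pair⁻ p∈M
            return {Σ[ w ∈ Carrier ] w ∈ M × (∀ z → z ∈ M → ⟦ Stage-L ⟧ᴹ (z ▹ η ▹ ε₀) ↔ z ≗ w)}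
              (pair η Y , p∈M , λ z z∈M →
                (λ q → run (stage-L⁻ {ρ = ε₀} {z} {η} εᴹ z∈M η∈M oη q >>= λ (Y′ , e , w) →
                  return (≗-trans e (pair-cong ≗-refl (unique oη Lh a′ w))))) ,
                (λ e → stage-L⁺ {ρ = ε₀} {z} {η} {Y} {h} εᴹ z∈M η∈M Y∈M oη e h∈M Lh a′))

          initial-segment : ∥ Segment ξ ∥
          initial-segment = do
            b , b∈M , q ← M-replacement Stage-L {ε₀} {ξ} εᴹ (θ-∈M i) functional
            let char : ∀ p → p ∈ b → ∥ (Σ[ η ∈ Carrier ] η ∈ ξ × Σ[ Y ∈ Carrier ] pair η Y ∈ f × p ≗ pair η Y) ∥
                char = λ p p∈b → do
                  η , j , h ← proj₁ (q p (M-trans b∈M p∈b)) p∈b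
                  w , w∈M , u ← functional η j
                  g , g∈M , s , r ← ih η j
                  Y , a , _ ← proj₂ F η (below i j)
                  oη ← ord-∈succ o (below i j)
                  Y′ , e , wit ← stage-L⁻ {ρ = ε₀} {p} {η} εᴹ (M-trans b∈M p∈b) (θ-∈M (below i j)) oη h
                  return {Σ[ η ∈ Carrier ] η ∈ ξ × Σ[ Y ∈ Carrier ] pair η Y ∈ f × p ≗ pair η Y}
                    (η , j , Y , a , ≗-trans e (pair-cong ≗-refl
                      (unique oη (segment-sequence (below i j) (g∈M , s , r)) (proj₂ (r η Y a) ∈adj⁺ʳ) wit)))
            return {Segment ξ} (b , b∈M ,
              (λ p p∈b → run (char p p∈b >>= λ (_ , _ , _ , a , e) → return (∈-≗ˡ (≗-sym e) a))) ,
              λ η Y a →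
                (λ p∈b → run (char _ p∈b >>= λ (_ , j , _ , _ , e) → return (∈-≗ˡ (≗-sym (proj₁ (pair-injective e))) j))) ,
                (λ j → run do
                  h , seg@(h∈M , s , r) ← ih η j
                  oη ← ord-∈succ o (below i j)
                  let a′  = proj₂ (r η Y a) ∈adj⁺ʳ
                      p∈M = M-trans h∈M a′
                      η∈M , Y∈M = M-pair⁻ p∈M
                  return (proj₂ (q (pair η Y) p∈M) (return (η , j ,
                    stage-L⁺ {ρ = ε₀} {pair η Y} {η} {Y} {h} εᴹ p∈M η∈M Y∈M oη ≗-refl h∈M (segment-sequence (below i j) seg) a′)))))

          stage∈M : ∀ {Y} → pair ξ Y ∈ f → Y ∈ M
          stage∈M {Y} a = run do
            r , r∈M , s , q ← initial-segment
            Y₁ , b , z , sc , l ← proj₂ L ξ i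
            oξ ← ord-∈succ o i
            c ← ord-case oξ
            let Y≗ = funOn-unique F a b
            case c of λ where
              (is-empty p) → return (M-≗ (≗-sym (≗-trans Y≗ (z p))) M-∅)
              (is-succ η j p) → do
                Z , u , d ← sc η p
                D , D∈M , d′ ← def-exists (proj₂ (M-pair⁻ (M-trans r∈M (proj₂ (q η Z u) j))))
                return (M-≗ (≗-sym (≗-trans Y≗ (def-unique d d′))) D∈M)
              (is-limit m) →
                -- The earlier stages are second components of pairs in `r`, hence members of `W`; φ
                -- cuts their union, the limit stage, out of `⋃ W`.
                let W = ⋃ (⋃ r)
                    e = ξ ▹ W ▹ r ▹ ε₀
                    W∈M = M-⋃ (M-⋃ r∈M)
                in return (M-≗ (≗-sym (≗-trans Y≗ (extensional
                  (λ w k → run do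
                    η , Z , j , u , w∈Z ← proj₁ (l m w) k
                    let u′ = proj₂ (q η Z u) j
                    return (∈sep⁺ φ (∈⋃⁺ (proj₂ (field-∈ u′)) w∈Z)
                      (∃∈⁺ η j (∃∈⁺ Z (proj₂ (field-∈ u′)) (∧⁺ (at⁺ {r} {η} {Z} u′) w∈Z)))))
                  (λ w k → proj₂ (l m w) (do
                    η , j , h ← ∃∈⁻ (proj₂ (∈sep⁻ φ {e = e} k))
                    Z , _ , h ← ∃∈⁻ h
                    u , w∈Z ← ∧⁻ h
                    return {LimitUnion f ξ w} (η , Z , j , s _ (at⁻ {r} {η} {Z} u) , w∈Z))))))
                  (M-sep φ e (θ-∈M i ▹ᴹ W∈M ▹ᴹ r∈M ▹ᴹ εᴹ) (M-⋃ W∈M)))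
            where
            φ : Formula 4
            φ = ∃∈ 1F (∃∈ 3F (⟨ 1F , 0F ⟩∈̇ 5F ∧̇ 2F ∈̇ 0F))

          segment-step : ∥ Segment (succ ξ) ∥
          segment-step = do
            r , r∈M , s , q ← initial-segment
            Y , a , u ← proj₂ F ξ i
            let Y∈M = stage∈M a
            return {Segment (succ ξ)} (adj r (pair ξ Y) , M-adj r∈M (M-pair (θ-∈M i) Y∈M) ,
              (λ p j → run (∈adj⁻ j >>= λ where
                (inj₁ k) → return (s p k)
                (inj₂ e) → return (∈-≗ˡ (≗-sym e) a))) ,
              λ η Z b →
                (λ j → run (∈adj⁻ j >>= λ where
                  (inj₁ k) → return (∈adj⁺ˡ (proj₁ (q η Z b) k))
                  (inj₂ e) → return (∈-≗ˡ (≗-sym (proj₁ (pair-injective e))) ∈adj⁺ʳ))) ,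
                (λ j → run (∈adj⁻ j >>= λ where
                  (inj₁ k) → return (∈adj⁺ˡ (proj₂ (q η Z b) k))
                  (inj₂ e) → return (∈-≗ˡ (pair-cong (≗-sym e) (≗-sym (u Z (pair∈-cong e ≗-refl b)))) ∈adj⁺ʳ))))

        U : Carrier
        U = ⋃ (⋃ f)

        φ : Formula 4
        -- `Segment (succ ξ)` in Δ₀ form: the segment is bounded by `M`, arguments and values of `f`
        -- by `U`.
        φ = ∃∈ 3F (0F ⊆̇ 2F ∧̇ ∀∈ 3F (∀∈ 4F (⟨ 1F , 0F ⟩∈̇ 4F ⇒ (⟨ 1F , 0F ⟩∈̇ 2F ⇔ (1F ∈̇ 3F ∨̇ 1F ≐ 3F)))))

        env : Env 3
        env = f ▹ U ▹ M ▹ ε₀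

        succ⁻ : ∀ {η ξ} → ((η ∈ ξ → R) → η ≗ ξ) → η ∈ succ ξ
        succ⁻ h = run (∨⁻ h >>= λ { (inj₁ i) → return (∈adj⁺ˡ i) ; (inj₂ p) → return (∈-≗ˡ (≗-sym p) ∈adj⁺ʳ) })

        segment⁻ : ∀ {ξ} → ⟦ φ ⟧ (ξ ▹ env) → ∥ Segment (succ ξ) ∥
        segment⁻ {ξ} h = do
          g , i , h ← ∃∈⁻ h
          s , r ← ∧⁻ h
          return {Segment (succ ξ)} (g , i , s , λ η Y a →
            let η∈U , Y∈U = field-∈ a in
            (λ b → run (∧⁻ (r η η∈U Y Y∈U (at⁺ {f} {η} {Y} a)) >>= λ (k , _) → return (succ⁻ (k (at⁺ {g} {η} {Y} b))))) ,
            (λ j → run (∧⁻ (r η η∈U Y Y∈U (at⁺ {f} {η} {Y} a)) >>= λ (_ , k) → return (at⁻ {g} {η} {Y} (k (∨⁺ (∈adj⁻ j)))))))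

        segment⁺ : ∀ {ξ} → ∥ Segment (succ ξ) ∥ → ⟦ φ ⟧ (ξ ▹ env)
        segment⁺ {ξ} h k = h λ (g , i , s , r) → k g i (∧⁺ s λ η _ Y _ a → ∧⁺
          (λ b → ∨⁺ (∈adj⁻ (proj₁ (r η Y (at⁻ {f} {η} {Y} a)) (at⁻ {g} {η} {Y} b))))
          (λ j → at⁺ {g} {η} {Y} (proj₂ (r η Y (at⁻ {f} {η} {Y} a)) (succ⁻ j))))

        segments : ∀ ξ → ξ ∈ γ → ∥ Segment (succ ξ) ∥
        segments ξ j = segment⁻ {ξ} (ord-induction φ env o
          (λ β k h → segment⁺ {β} (segment-step (∈adj⁺ˡ k) λ η l → segment⁻ {η} (h η l))) ξ j)

      L-stage∈M : ∀ {X} → pair γ X ∈ f → X ∈ M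
      L-stage∈M = stage∈M ∈adj⁺ʳ segments

    -- The Schröder–Bernstein construction inside M

    -- Given an injection f of α into κ ⊆ α, let C be the least subset of α that
    -- contains α ∖ κ and is closed under f; the bijection κ → α is f⁻¹ on C and
    -- the identity elsewhere.
    module SchröderBernstein {f κ α : Carrier} (f∈M : f ∈ M) (κ∈M : κ ∈ M) (α∈M : α ∈ M) (κ⊆α : κ ⊆ α)
      (f-inj : Injection f α κ) where

      private
        F : Fun f α κ
        F = proj₁ f-inj

        Closed : Carrier → Set
        Closed Z = (∀ x → x ∈ α → (x ∈ κ → R) → x ∈ Z) × (∀ x v → x ∈ Z → pair x v ∈ f → v ∈ Z)

        IsClosed : Formula 5
        IsClosed = ∀∈ 4F (¬̇ (0F ∈̇ 4F) ⇒ 0F ∈̇ 1F) ∧̇ ∀∈ 0F (∀∈ 4F (⟨ 1F , 0F ⟩∈̇ 4F ⇒ 0F ∈̇ 2F))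

        closed⁻ : ∀ {Z x} → ⟦ IsClosed ⟧ (Z ▹ x ▹ f ▹ κ ▹ α ▹ ε₀) → ∥ Closed Z ∥
        closed⁻ {Z} h = do
          a , b ← ∧⁻ h
          return {Closed Z} (a , λ x v i p → b x i v (fun-codomain F p) (at⁺ {f} {x} {v} p))

        closed⁺ : ∀ {Z x} → Closed Z → ⟦ IsClosed ⟧ (Z ▹ x ▹ f ▹ κ ▹ α ▹ ε₀)
        closed⁺ {Z} (a , b) = ∧⁺ a λ x i v _ p → b x v i (at⁻ {f} {x} {v} p)

        -- The quantifier over closed sets is unbounded, so `C` is obtained by the full separation
        -- of `M`; accordingly it is least among the closed sets that belong to `M`.
        C-formula : Formula 4
        C-formula = ∀̇ (IsClosed ⇒ 1F ∈̇ 0F)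

        LeastClosed : Carrier → Set
        LeastClosed C = C ∈ M × Closed C × C ⊆ α × (∀ Z → Z ∈ M → Closed Z → C ⊆ Z)

        least-closed : ∥ Σ Carrier LeastClosed ∥
        least-closed = do
            C , C∈M , q ← M-separation C-formula {f ▹ κ ▹ α ▹ ε₀} (f∈M ▹ᴹ κ∈M ▹ᴹ α∈M ▹ᴹ εᴹ) α∈M
            let least : ∀ Z → Z ∈ M → Closed Z → C ⊆ Z
                least = λ Z Z∈M c x x∈C → proj₂ (proj₁ (q x) x∈C) Z Z∈M
                          (inn (absolute Z∈M (M-trans C∈M x∈C)) (closed⁺ {Z} {x} c))
                member : ∀ x → x ∈ α → (∀ Z → Z ∈ M → Closed Z → x ∈ Z) → x ∈ C
                member = λ x x∈α h → proj₂ (q x) (x∈α , λ Z Z∈M c → run (closed⁻ {Z} {x}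
                          (out (absolute Z∈M (M-trans α∈M x∈α)) c) >>= λ c → return (h Z Z∈M c)))
            return {Σ Carrier LeastClosed} (C , C∈M ,
              ((λ x x∈α n → member x x∈α λ Z _ c → proj₁ c x x∈α n) ,
               (λ x v x∈C p → member v (κ⊆α v (fun-codomain F p)) λ Z Z∈M c → proj₂ c x v (least Z Z∈M c x x∈C) p)) ,
              (λ x x∈C → proj₁ (proj₁ (q x) x∈C)) , least)
          where
          absolute : ∀ {Z x} → Z ∈ M → x ∈ M → Absolute IsClosed (Z ▹ x ▹ f ▹ κ ▹ α ▹ ε₀)
          absolute i j = absΔ IsClosed (i ▹ᴹ j ▹ᴹ f∈M ▹ᴹ κ∈M ▹ᴹ α∈M ▹ᴹ εᴹ)

        module _ {C : Carrier} (C∈M : C ∈ M) (C-closed : Closed C) (C⊆α : C ⊆ α)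
          (C-least : ∀ Z → Z ∈ M → Closed Z → C ⊆ Z) where

          image : ∀ {v} → v ∈ C → v ∈ κ → ∥ (Σ[ x ∈ Carrier ] x ∈ C × pair x v ∈ f) ∥
          image {v} v∈C v∈κ k = proj₂ (∈sep⁻ φ {e = v ▹ ε₀} (C-least Z (M-sep φ (v ▹ ε₀) (M-trans C∈M v∈C ▹ᴹ εᴹ) C∈M) closed v v∈C)) ≗-refl
            where
            φ : Formula 2
            φ = ¬̇ (0F ≐ 1F)
            Z : Carrier
            Z = sep φ (v ▹ ε₀) C
            closed : Closed Z
            closed = (λ x x∈α n → ∈sep⁺ φ (proj₁ C-closed x x∈α n) λ p → n (∈-≗ˡ (≗-sym p) v∈κ)) ,
              (λ x w i p → let x∈C = proj₁ (∈sep⁻ φ {e = v ▹ ε₀} i) in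
                ∈sep⁺ φ (proj₂ C-closed x w x∈C p) λ q → k (x , x∈C , pair∈-cong ≗-refl q p))

          Matched : Carrier → Carrier → Set
          Matched v x = ∥ (pair x v ∈ f × x ∈ C) ⊎ (v ≗ x × (x ∈ C → R)) ∥

          ψ : Formula 5
          ψ = ∃∈ 3F (∃∈ 5F (IsOPair 2F 1F 0F ∧̇ ((⟨ 0F , 1F ⟩∈̇ 3F ∧̇ 0F ∈̇ 4F) ∨̇ (1F ≐ 0F ∧̇ ¬̇ (0F ∈̇ 4F)))))

          e : Env 4
          e = f ▹ C ▹ κ ▹ α ▹ ε₀

          ψ⁺ : ∀ {v x} → v ∈ κ → x ∈ α → Matched v x → ⟦ ψ ⟧ (pair v x ▹ e)
          ψ⁺ {v} {x} i j m = ∃∈⁺ v i (∃∈⁺ x j (∧⁺ (opair⁺ {pair v x} {v} {x} ≗-refl) (∨⁺ (m >>= λ where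
            (inj₁ (p , c)) → return (inj₁ (∧⁺ (at⁺ {f} {x} {v} p) c))
            (inj₂ (p , n)) → return (inj₂ (∧⁺ p n))))))

          ψ⁻ : ∀ {p} → ⟦ ψ ⟧ (p ▹ e) → ∥ (Σ[ v ∈ Carrier ] Σ[ x ∈ Carrier ] v ∈ κ × x ∈ α × p ≗ pair v x × Matched v x) ∥
          ψ⁻ {p} h = do
            v , i , h ← ∃∈⁻ h
            x , j , h ← ∃∈⁻ h
            q , h ← ∧⁻ h
            return {Σ[ v ∈ Carrier ] Σ[ x ∈ Carrier ] v ∈ κ × x ∈ α × p ≗ pair v x × Matched v x}
              (v , x , i , j , opair⁻ {p} {v} {x} q , (∨⁻ h >>= λ where
                (inj₁ h) → ∧⁻ h >>= λ (a , c) → return (inj₁ (at⁻ {f} {x} {v} a , c))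
                (inj₂ h) → ∧⁻ h >>= λ (a , c) → return (inj₂ (a , c))))

          -- In the mixed cases v would lie in `C`, as the image of a point of `C`, and also outside
          -- `C`, being equal to a point outside it.
          matched-functional : ∀ {v x x′} → Matched v x → Matched v x′ → x ≗ x′
          matched-functional {v} {x} {x′} m m′ = run (m >>= λ a → m′ >>= λ b → case a , b of λ where
            (inj₁ (p , _) , inj₁ (q , _)) → return (proj₂ f-inj x x′ v p q)
            (inj₁ (p , c) , inj₂ (q , n)) → λ _ → n (∈-≗ˡ q (proj₂ C-closed x v c p))
            (inj₂ (p , n) , inj₁ (q , c)) → λ _ → n (∈-≗ˡ p (proj₂ C-closed x′ v c q))
            (inj₂ (p , _) , inj₂ (q , _)) → return (≗-trans (≗-sym p) q))

          matched-injective : ∀ {v v′ x} → Matched v x → Matched v′ x → v ≗ v′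
          matched-injective m m′ = run (m >>= λ a → m′ >>= λ b → case a , b of λ where
            (inj₁ (p , _) , inj₁ (q , _)) → return (funOn-unique (fun⇒funOn F) p q)
            (inj₁ (_ , c) , inj₂ (_ , n)) → λ _ → n c
            (inj₂ (_ , n) , inj₁ (_ , c)) → λ _ → n c
            (inj₂ (p , _) , inj₂ (q , _)) → return (≗-trans p (≗-sym q)))

          matched-cong : ∀ {v v′ x x′} → v ≗ v′ → x ≗ x′ → Matched v x → Matched v′ x′
          matched-cong p q m = m >>= λ where
            (inj₁ (a , c)) → return (inj₁ (pair∈-cong q p a , ∈-≗ˡ q c))
            (inj₂ (a , n)) → return (inj₂ (≗-trans (≗-sym p) (≗-trans a q) , λ c → n (∈-≗ˡ (≗-sym q) c)))

          matched-total : ∀ v → v ∈ κ → ∥ (Σ[ x ∈ Carrier ] x ∈ α × Matched v x) ∥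
          matched-total v v∈κ = em {v ∈ C} >>= λ where
            (inj₁ v∈C) → image v∈C v∈κ >>= λ (x , x∈C , p) →
              return {Σ[ x ∈ Carrier ] x ∈ α × Matched v x} (x , C⊆α x x∈C , return (inj₁ (p , x∈C)))
            (inj₂ n)   → return {Σ[ x ∈ Carrier ] x ∈ α × Matched v x} (v , κ⊆α v v∈κ , return (inj₂ (≗-refl , n)))

          matched-onto : ∀ x → x ∈ α → ∥ (Σ[ v ∈ Carrier ] v ∈ κ × Matched v x) ∥
          matched-onto x x∈α = em {x ∈ C} >>= λ where
            (inj₁ x∈C) → proj₂ F x x∈α >>= λ (v , v∈κ , p , _) →
              return {Σ[ v ∈ Carrier ] v ∈ κ × Matched v x} (v , v∈κ , return (inj₁ (p , x∈C)))
            (inj₂ n)   → return {Σ[ v ∈ Carrier ] v ∈ κ × Matched v x}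
              (x , run (λ k → n (proj₁ C-closed x x∈α k)) , return (inj₂ (≗-refl , n)))

          matching : ∥ (Σ[ h ∈ Carrier ] h ∈ M × Bijection h κ α) ∥
          matching = do
            Z , Z∈M , z ← M-pairs κ∈M α∈M
            let h = sep ψ e Z
                h⁻ : ∀ {v x} → pair v x ∈ h → v ∈ κ × x ∈ α × Matched v x
                h⁻ = λ {v} {x} i → run ⦃ stable-× ⦃ stable-∈ ⦄ ⦃ stable-× ⦄ ⦄ (ψ⁻ {pair v x} (proj₂ (∈sep⁻ ψ {e = e} i)) >>= λ (v′ , x′ , a , b , q , m) →
                       let r , s = pair-injective q in
                       return (∈-≗ˡ (≗-sym r) a , ∈-≗ˡ (≗-sym s) b , matched-cong (≗-sym r) (≗-sym s) m))
                h⁺ : ∀ {v x} → v ∈ κ → x ∈ α → Matched v x → pair v x ∈ h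
                h⁺ = λ {v} {x} i j m → ∈sep⁺ ψ (z v x i j) (ψ⁺ {v} {x} i j m)
            return {Σ[ h ∈ Carrier ] h ∈ M × Bijection h κ α}
              (h , M-sep ψ e (f∈M ▹ᴹ C∈M ▹ᴹ κ∈M ▹ᴹ α∈M ▹ᴹ εᴹ) Z∈M ,
                ((((λ p i → ψ⁻ {p} (proj₂ (∈sep⁻ ψ {e = e} i)) >>= λ (v , x , a , b , q , _) → return (v , x , a , b , q)) ,
                   (λ v v∈κ → matched-total v v∈κ >>= λ (x , x∈α , m) →
                     return (x , x∈α , h⁺ v∈κ x∈α m , λ x′ i → matched-functional (proj₂ (proj₂ (h⁻ i))) m))) ,
                  (λ a b v i j → matched-injective (proj₂ (proj₂ (h⁻ i))) (proj₂ (proj₂ (h⁻ j))))) ,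
                 (λ x x∈α → matched-onto x x∈α >>= λ (v , v∈κ , m) → return (v , h⁺ v∈κ x∈α m))))

      bijection-exists : ∥ (Σ[ h ∈ Carrier ] h ∈ M × Bijection h κ α) ∥
      bijection-exists = do
        C , C∈M , c , s , l ← least-closed
        matching C∈M c s l

    -- By transitivity f is in `M` along with its constructible stage. Being a bijection is Δ₀, so
    -- `M` recognises the one built from f, against its own |κ| < |α|.
    no-collapse : ∀ {n} (x c : Fin n) {e κ α f} → κ ∈ M → α ∈ M → e c ∈ M → κ ⊆ α → Ord V (e c) → ⟦ IsL x c ⟧ e → f ∈ e x →
      Injection f α κ → HoldsWitness M (1F ≺ 0F) κ α → R
    no-collapse x c {e} {κ} {α} {f} κ∈M α∈M γ∈M κ⊆α o isL f∈X inj (k , t , a , b , s) = run do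
      θ , l , p , L , i ← isL⁻ {e = e} x c isL
      let X∈M = Segments.L-stage∈M {e c} {l} o γ∈M (lsequence-cong p L) i
          f∈M = M-trans X∈M f∈X
      h , h∈M , bij ← SchröderBernstein.bijection-exists f∈M κ∈M α∈M κ⊆α inj
      less ← satisfied-rel (1F ≺ 0F) M-inhabited a b s
      _ , n ← ∧⁻ less
      return (n (∃∈⁺ h h∈M (inn (absΔ (IsBijection 0F 2F 1F) {_} {h ▹ α ▹ κ ▹ ε₀} (h∈M ▹ᴹ α∈M ▹ᴹ κ∈M ▹ᴹ εᴹ)) (bijection⁺ {h} {κ} {α} bij))))

  -- The argument in the universe

  -- Membership in `succ δ` serves as the relation of being at most δ.
  ord-max : ∀ {α β} → Ord V α → Ord V β → ∥ (Σ[ δ ∈ Carrier ] Ord V δ × α ∈ succ δ × β ∈ succ δ) ∥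
  ord-max {α} {β} a b = VO.comparable tt tt a b >>= λ where
    (inj₁ p)        → return (β , b , ∈adj⁺ˡ p , ∈adj⁺ʳ)
    (inj₂ (inj₁ p)) → return (β , b , ∈-≗ˡ (≗-sym p) ∈adj⁺ʳ , ∈adj⁺ʳ)
    (inj₂ (inj₂ p)) → return (α , a , ∈adj⁺ʳ , ∈adj⁺ˡ p)

  succ-≤-trans : ∀ {α β γ} → Ord V γ → α ∈ succ β → β ∈ succ γ → α ∈ succ γ
  succ-≤-trans {α} {β} {γ} o i j = run (∈adj⁻ i >>= λ where
    (inj₂ p) → return (∈-≗ˡ (≗-sym p) j)
    (inj₁ k) → ∈adj⁻ j >>= λ where
      (inj₁ l) → return (∈adj⁺ˡ (proj₁ o β l α k))
      (inj₂ q) → return (∈adj⁺ˡ (∈-≗ʳ q k)))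

  collapse : ∀ {m} {e′ : Env m} {n} {e : Env n} {M κ α δ f} (x c : Fin n) → Ord V α → κ ∈ α → α ∈ succ δ → e c ∈ succ δ → ω ∈ succ δ →
    Ord V (e c) → ⟦ IsL x c ⟧ e → f ∈ e x → Injection f α κ →
    ⟦ IsModel 0F ⟧ (M ▹ e′) → δ ∈ M → HoldsWitness M (1F ≺ 0F) κ α → R
  collapse {m} {e′} {n} {e} {M} {κ} {α} {δ} {f} x c oα κ∈α α≤δ γ≤δ ω≤δ oγ isL f∈X inj model δ∈M wit = run do
    transitive , _ ← ∧⁻ model
    let below : ∀ {x} → x ∈ succ δ → x ∈ M
        below = λ i → run (∈adj⁻ i >>= λ { (inj₁ j) → return (transitive δ δ∈M _ j) ; (inj₂ p) → return (∈-≗ˡ (≗-sym p) δ∈M) })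
        α∈M = below α≤δ
    return {R} (InModel.no-collapse {m} {e′} M model (below ω≤δ) x c {e}
      (transitive α α∈M κ κ∈α) α∈M (below γ≤δ) (λ x i → proj₁ oα κ κ∈α x i) oγ isL f∈X inj wit)

  -- Stated for any ordinal into which every set injects, so as to serve both theories: `GC`
  -- provides one, and ω is one when every set is countable.
  refute-TMA : ∀ {κ} → Ord V κ → (∀ y → ∥ (Σ[ f ∈ Carrier ] Injection f y κ) ∥) → ⟦ V=L ⟧ ε₀ → ⟦ TMA ⟧ ε₀ → R
  refute-TMA {κ} oκ greatest constructible tall = run do
    α , h ← ∃⁻ (tall κ (ord⁺ {κ} oκ))
    a , h ← ∧⁻ h
    κ∈α , h ← ∧⁻ h
    let oα = ord⁻ {α} a
    f , inj ← greatest α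
    γ , l ← ∃⁻ (constructible f)
    X , l ← ∃⁻ l
    c , l ← ∧⁻ l
    isL , f∈X ← ∧⁻ l
    let oγ = ord⁻ {γ} c
    β , oβ , α≤β , γ≤β ← ord-max oα oγ
    δ , oδ , β≤δ , ω≤δ ← ord-max oβ ω-ord
    M , h ← ∃⁻ (h δ (∧⁺ (ord⁺ {δ} oδ) (∨⁺ (∈adj⁻ (succ-≤-trans oδ α≤β β≤δ)))))
    model , h ← ∧⁻ h
    δ∈M , h ← ∧⁻ h
    wit ← holds⁻ {e = M ▹ δ ▹ α ▹ κ ▹ ε₀} 0F (1F ≺ 0F) 3F 2F h
    return {R} (collapse {e′ = δ ▹ α ▹ κ ▹ ε₀}
      {e = X ▹ γ ▹ f ▹ ε₀} {M} {κ} {α} {δ} {f} 0F 1F oα κ∈α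
      (succ-≤-trans oδ α≤β β≤δ) (succ-≤-trans oδ γ≤β β≤δ) ω≤δ oγ isL f∈X inj model δ∈M wit)

  greatest-cardinality : ⟦ GC ⟧ ε₀ → ∥ (Σ[ κ ∈ Carrier ] Ord V κ × (∀ y → ∥ (Σ[ f ∈ Carrier ] Injection f y κ) ∥)) ∥
  greatest-cardinality h = do
    κ , h ← ∃⁻ h
    o , g ← ∧⁻ h
    return {Σ[ κ ∈ Carrier ] Ord V κ × (∀ y → ∥ (Σ[ f ∈ Carrier ] Injection f y κ) ∥)} (κ , ord⁻ {κ} o , λ y → do
      f , i ← ∃⁻ (g y)
      j ← injection⁻ {f} {y} {κ} i
      return {Σ[ f ∈ Carrier ] Injection f y κ} (f , j))

  countable⇒ω-greatest : ⟦ everySetCountable ⟧ ε₀ → ∀ y → ∥ (Σ[ f ∈ Carrier ] Injection f y ω) ∥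
  countable⇒ω-greatest h y = do
    w , h ← ∃⁻ (h y)
    o , h ← ∧⁻ h
    f , i ← ∃⁻ h
    j ← injection⁻ {f} {y} {ω} (≗-subst (IsInjection 1F 2F 0F) (f ▹ y ▹ ε₀) {w} {ω} (omega⁺-unique {w} o) i)
    return {Σ[ f ∈ Carrier ] Injection f y ω} (f , j)

-- The calculus admits an empty domain for sentences; the empty set axiom provides the element that
-- `complete` asks for.
nonempty-domain : ∀ {T : Theory} → T emptySet → T ⊢ ∃̇ (¬̇ ⊥̇)
nonempty-domain t = ⇒-intro (⇒-elim (axiom t) (∀-intro (⇒-intro
  (⇒-elim (∀-elim (assume (there (here refl))) 0F) (⇒-intro (assume (here refl)))))))

proposition5p9 : (LZFC ⊕ GC ⊕ V=L ⊢ ¬̇ TMA) × (LZFC ⊕ everySetCountable ⊕ V=L ⊢ ¬̇ TMA)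
proposition5p9 =
  ⇒-intro (complete (nonempty-domain (inj₁ (inj₁ (inj₁ bst-empty)))) λ S axioms hypotheses →
    let bst : ∀ {σ} → BST σ → Structure.⟦_⟧ S σ ε₀
        bst = λ t → axioms (inj₁ (inj₁ (inj₁ t)))
    in Universe.greatest-cardinality S bst (axioms (inj₁ (inj₂ refl))) λ (κ , o , g) →
         Universe.refute-TMA S bst o g (axioms (inj₂ refl)) (hypotheses (here refl))) ,
  ⇒-intro (complete (nonempty-domain (inj₁ (inj₁ (inj₁ bst-empty)))) λ S axioms hypotheses →
    let bst : ∀ {σ} → BST σ → Structure.⟦_⟧ S σ ε₀
        bst = λ t → axioms (inj₁ (inj₁ (inj₁ t)))
    in Universe.refute-TMA S bst (Universe.ω-ord S bst)
         (Universe.countable⇒ω-greatest S bst (axioms (inj₁ (inj₂ refl))))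
         (axioms (inj₂ refl)) (hypotheses (here refl)))
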